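{- For every positive integer $k$, in $\mathbb C[[\mathbf r,\mathbf t]]$, \[ \sum_{n\ge0}\frac1{|B_n|}\sum_{\underline\mu\vdash n}\sum_{y\in C_{\underline\mu}}\sum_{\underline\lambda\vdash n}\sum_{\substack{x\in C_{\underline\lambda}\\ x^k=y}}\prod_{\ell,\varepsilon}r_{\ell,\varepsilon}^{\ell m_{\ell,\varepsilon}}\prod_{j,\theta}t_{j,\theta}^{jb_{j,\theta}} =\exp\Big(\sum_{j,\theta}\sum_{\substack{h\mid k\\ \gcd(h,j)=1}}\frac{t_{j,\theta}^{jk/h}}{2jk/h}\sum_{\varepsilon\in R_{h,\theta}}r_{jk/h,\varepsilon}^{jk/h}\Big), \] where $R_{h,\theta}=\{\varepsilon\in\mathbb Z_2:\varepsilon^h=\theta\}$, $\underline\lambda$ has $m_{\ell,\varepsilon}$ cycles of length $\ell$ and class $\varepsilon$, and $\underline\mu$ has $b_{j,\theta}$ cycles of length $j$ and class $\theta$.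
   Context: $B_n$ is the group of bijections $w$ of $\{\pm1,\dots,\pm n\}$ with $w(-i)=-w(i)$. Cycles: if $c=(a_1,\dots,a_\ell)$ is a cycle of $w$ on $\{\pm1,\dots,\pm n\}$ so is $\bar c$ (negated entries); if $c\ne\bar c$, $c\bar c$ is a cycle of length $\ell$ and $\mathbb Z_2$-class $+1$; if $c=\bar c$, a cycle of length $\ell/2$ and class $-1$. $C_{\underline\lambda}$ is the conjugacy class of elements of signed cycle type $\underline\lambda=(\lambda^+,\lambda^-)\vdash n$ ($\lambda^\varepsilon$ lists lengths of cycles of class $\varepsilon$). $\mathbb Z_2=\{\pm1\}$; $\mathbf r=(r_{\ell,\varepsilon})$, $\mathbf t=(t_{j,\theta})$ ($\ell,j\ge1$, $\varepsilon,\theta\in\mathbb Z_2$) are indeterminates; $h$ runs over positive divisors of $k$. -}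

module Defs where

open import Data.Bool using (Bool; true; false; _∧_; _∨_; not; if_then_else_)
open import Data.Nat as ℕ using (ℕ; zero; suc; _≡ᵇ_; _<ᵇ_)
open import Data.Nat.DivMod using (_/_)
open import Data.Nat.GCD using (gcd)
open import Data.Nat.Divisibility using (_∣?_)
open import Data.Fin using (Fin; toℕ) renaming (zero to fz; suc to fs)
open import Data.Fin.Properties using () renaming (_≟_ to _≟F_)
open import Data.List using (List; []; _∷_; length; concatMap; map; foldr; upTo; allFin; cartesianProduct)
open import Data.Bool.ListAction using (and; or)
open import Data.Product using (_×_; _,_; proj₁; proj₂)
open import Data.Sign using (Sign; +; -) renaming (_*_ to _*s_)
open import Data.Sign.Properties using () renaming (_≟_ to _≟S_)
open import Data.Integer using () renaming (+_ to ι)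
open import Data.Rational as ℚ using (ℚ; 0ℚ; 1ℚ)
open import Relation.Nullary.Decidable using (⌊_⌋)
open import Relation.Binary.PropositionalEquality using (_≡_)

funs : {A : Set} → (n : ℕ) → List A → List (Fin n → A)
funs zero    xs = (λ ()) ∷ []
funs (suc n) xs =
  concatMap (λ x → map (λ f → λ { fz → x ; (fs i) → f i }) (funs n xs)) xs

allSigns : List Sign
allSigns = + ∷ - ∷ []

_==S_ : Sign → Sign → Bool
s ==S t = ⌊ s ≟S t ⌋

_^s_ : Sign → ℕ → Sign
s ^s zero  = +
s ^s suc h = s *s (s ^s h)

Σℚ : {A : Set} → List A → (A → ℚ) → ℚ
Σℚ xs f = foldr (λ x acc → f x ℚ.+ acc) 0ℚ xs

-- 1/n for n ≥ 1 (only ever applied to positive n)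
inv : ℕ → ℚ
inv zero    = 0ℚ
inv (suc n) = ι 1 ℚ./ suc n

fromℕ : ℕ → ℚ
fromℕ n = ι n ℚ./ 1

filterB : {A : Set} → (A → Bool) → List A → List A
filterB p []       = []
filterB p (x ∷ xs) = if p x then x ∷ filterB p xs else filterB p xs

count : {A : Set} → (A → Bool) → List A → ℕ
count p xs = length (filterB p xs)

-- The hyperoctahedral group B_n
-- {±1,…,±n} is encoded as Sign × Fin n, (s , i) standing for s·(i+1).

Point : ℕ → Set
Point n = Sign × Fin n

allPoints : (n : ℕ) → List (Point n)
allPoints n = cartesianProduct allSigns (allFin n)

_==P_ : {n : ℕ} → Point n → Point n → Bool
(s , i) ==P (t , j) = (s ==S t) ∧ ⌊ i ≟F j ⌋

-- a candidate element: its values on the positive points +1,…,+n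
SMap : ℕ → Set
SMap n = Fin n → Point n

-- the map on {±1,…,±n} determined by w(-i) = -w(i)
app : {n : ℕ} → SMap n → Point n → Point n
app w (s , i) = (s *s proj₁ (w i) , proj₂ (w i))

isBijection : {n : ℕ} → SMap n → Bool
isBijection {n} w =
  and (map (λ p → and (map (λ q → not (app w p ==P app w q) ∨ (p ==P q)) (allPoints n))) (allPoints n))
  ∧ and (map (λ q → or (map (λ p → app w p ==P q) (allPoints n))) (allPoints n))

Bn : (n : ℕ) → List (SMap n)
Bn n = filterB isBijection (funs n (allPoints n))

_==M_ : {n : ℕ} → SMap n → SMap n → Bool
_==M_ {n} v w = and (map (λ i → v i ==P w i) (allFin n))

idM : {n : ℕ} → SMap n
idM i = (+ , i)

powM : {n : ℕ} → SMap n → ℕ → SMap n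
powM x zero    = idM
powM x (suc k) = λ i → app x (powM x k i)

iter : {n : ℕ} → SMap n → ℕ → Point n → Point n
iter w zero    p = p
iter w (suc m) p = app w (iter w m p)

firstReturn : {n : ℕ} → SMap n → Point n → (fuel start : ℕ) → ℕ
firstReturn w p zero       start = 0
firstReturn w p (suc fuel) start =
  if iter w start p ==P p then start else firstReturn w p fuel (suc start)

orbitLen : {n : ℕ} → SMap n → Fin n → ℕ
orbitLen {n} w i = firstReturn w (+ , i) (2 ℕ.* n) 1

-- the cycle c through +i satisfies c = c̄ iff it contains -i
selfConj : {n : ℕ} → SMap n → Fin n → Bool
selfConj w i = or (map (λ m → iter w m (+ , i) ==P (- , i)) (upTo (orbitLen w i)))

cycType : {n : ℕ} → SMap n → Fin n → ℕ × Sign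
cycType w i = if selfConj w i then (orbitLen w i / 2 , -) else (orbitLen w i , +)

-- m_{ℓ,ε}(w) : the number of cycles of length ℓ and class ε
-- (each such cycle contains exactly ℓ of the indices 1..n in absolute value)
mult : {n : ℕ} → SMap n → (ℓ : ℕ) → Sign → ℕ
mult w zero    ε = 0
mult {n} w (suc ℓ) ε =
  count (λ i → (proj₁ (cycType w i) ≡ᵇ suc ℓ) ∧ (proj₂ (cycType w i) ==S ε)) (allFin n) / suc ℓ

expo : {n : ℕ} → SMap n → (ℓ : ℕ) → Sign → ℕ
expo w ℓ ε = ℓ ℕ.* mult w ℓ ε

-- Formal power series in r_{ℓ,ε}, t_{j,θ} over ℚ.
-- A monomial whose variables all have index ≤ N is given by N and two
-- exponent vectors a, c : Fin N → Sign → ℕ (a i ε = exponent of r_{i+1,ε},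
-- c i θ = exponent of t_{i+1,θ}). A series is its coefficient function;
-- `Ser` gives the coefficient at every such monomial (compatibly in N).

Exps : ℕ → Set
Exps N = Fin N → Sign → ℕ

Ser : Set
Ser = (N : ℕ) → Exps N → Exps N → ℚ

_≋_ : Ser → Ser → Set
F ≋ G = ∀ N (a c : Exps N) → F N a c ≡ G N a c

degE : {N : ℕ} → Exps N → ℕ
degE {N} a = foldr ℕ._+_ 0 (map (λ i → a i + ℕ.+ a i -) (allFin N))

isZeroE : {N : ℕ} → Exps N → Bool
isZeroE {N} a = and (map (λ i → (a i + ≡ᵇ 0) ∧ (a i - ≡ᵇ 0)) (allFin N))

_==E_ : {N : ℕ} → Exps N → Exps N → Bool
_==E_ {N} a b = and (map (λ i → (a i + ≡ᵇ b i +) ∧ (a i - ≡ᵇ b i -)) (allFin N))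

below : (N : ℕ) → Exps N → List (Exps N)
below zero    a = (λ ()) ∷ []
below (suc N) a =
  concatMap (λ p → concatMap (λ q → map (λ f → λ { fz + → p ; fz - → q ; (fs i) s → f i s })
                                         (below N (λ i → a (fs i))))
                             (upTo (suc (a fz -))))
            (upTo (suc (a fz +)))

subE : {N : ℕ} → Exps N → Exps N → Exps N
subE a b i s = a i s ℕ.∸ b i s

oneS : Ser
oneS N a c = if isZeroE a ∧ isZeroE c then 1ℚ else 0ℚ

mulS : Ser → Ser → Ser
mulS F G N a c =
  Σℚ (below N a) (λ a₁ → Σℚ (below N c) (λ c₁ → F N a₁ c₁ ℚ.* G N (subE a a₁) (subE c c₁)))

powS : Ser → ℕ → Ser
powS F zero    = oneS
powS F (suc m) = mulS F (powS F m)

fact : ℕ → ℕ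
fact zero    = 1
fact (suc n) = suc n ℕ.* fact n

-- exp F = Σ_m F^m / m!  for F without constant term; powers F^m with
-- m > total degree do not contribute to a given coefficient.
expS : Ser → Ser
expS F N a c =
  Σℚ (upTo (suc (degE a ℕ.+ degE c))) (λ m → inv (fact m) ℚ.* powS F m N a c)

matches : {n N : ℕ} → SMap n → Exps N → Bool
matches {n} {N} w a =
  and (map (λ i → (expo w (suc (toℕ i)) + ≡ᵇ a i +) ∧ (expo w (suc (toℕ i)) - ≡ᵇ a i -)) (allFin N))
  ∧ and (map (λ ℓ → not (N <ᵇ ℓ) ∨ ((expo w ℓ + ≡ᵇ 0) ∧ (expo w ℓ - ≡ᵇ 0))) (upTo (suc n)))

Gn : (k n : ℕ) → Ser
Gn k n N a c =
  inv (length (Bn n)) ℚ.*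
  fromℕ (count (λ xy → (powM (proj₁ xy) k ==M proj₂ xy)
                       ∧ matches (proj₁ xy) a ∧ matches (proj₂ xy) c)
               (cartesianProduct (Bn n) (Bn n)))

-- Σ_{n ≥ 0} Gn k n (Gn k n has only monomials of degree 2n, so only
-- n ≤ total degree contribute to a coefficient)
LHS : ℕ → Ser
LHS k N a c = Σℚ (upTo (suc (degE a ℕ.+ degE c))) (λ n → Gn k n N a c)

isMono : {N : ℕ} → (j : ℕ) → Sign → (L : ℕ) → Sign → Exps N → Exps N → Bool
isMono {N} j θ L ε a c =
  (L ℕ.≤ᵇ N) ∧ (j ℕ.≤ᵇ N)
  ∧ and (map (λ i → and (map (λ s →
        (a i s ≡ᵇ (if (suc (toℕ i) ≡ᵇ L) ∧ (s ==S ε) then L else 0))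
      ∧ (c i s ≡ᵇ (if (suc (toℕ i) ≡ᵇ j) ∧ (s ==S θ) then L else 0))) allSigns)) (allFin N))

-- Φ = Σ_{j,θ} Σ_{h | k, gcd(h,j)=1} t_{j,θ}^{jk/h}/(2jk/h) Σ_{ε^h = θ} r_{jk/h,ε}^{jk/h}
-- (h = suc h' ranges over 1..k; j = suc j' over 1..N since other
--  variables do not occur in monomials supported in indices ≤ N)
Phi : ℕ → Ser
Phi k N a c =
  Σℚ (upTo N) λ j' → Σℚ allSigns λ θ → Σℚ (upTo k) λ h' →
    if ⌊ suc h' ∣? k ⌋ ∧ (gcd (suc h') (suc j') ≡ᵇ 1)
    then Σℚ allSigns (λ ε →
           if (ε ^s suc h') ==S θ
              ∧ isMono (suc j') θ (suc j' ℕ.* k / suc h') ε a c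
           then inv (2 ℕ.* (suc j' ℕ.* k / suc h'))
           else 0ℚ)
    else 0ℚ

RHS : ℕ → Ser
RHS k = expS (Phi k)

module Submission where

-- Both sides are expanded over lists of cycles.  On the left, every element of
-- B_{n+1} arises exactly once from an element of B_n by inserting one new letter:
-- as a fixed point of either class, or, with either sign, behind any of the n old
-- letters, which lengthens the cycle of that letter by one.  So the cycle-list sum
-- satisfies p_{n+1} F = p_n (insertions F).  The degree-n part of
-- exp (Σ_u p_u / 2 len u), evaluated at F, obeys the same recursion up to the
-- factor 2 (n + 1): both sides of the step are turned, by moving a distinguished
-- cycle to the front of the word, into the same sum Σ_u F (u ∷ v), where the new
-- fixed points supply the cycles of length 1 that are missing from the lengthened
-- cycles.  Finally the k-th power of a cycle of length l and class ε consists of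
-- gcd (l, k) cycles of length j = l / gcd (l, k) and class ε^h, h = k / gcd (l, k),
-- and (j , h) runs over the pairs with h ∣ k, gcd (h, j) = 1, j k / h = l.

open import Defs
import Data.Bool.Properties
open import Data.Bool using (Bool; true; false; _∧_; _∨_; not; if_then_else_; T)
open import Data.Bool.ListAction using (and; or)
open import Data.Empty using (⊥-elim)
open import Data.Nat as ℕ using (ℕ; zero; suc; pred; _+_; _*_; _∸_; _≤_; _<_; _≡ᵇ_; _≤ᵇ_; _<ᵇ_; z≤n; s≤s)
import Data.Nat.Properties as ℕₚ
open import Data.Nat.DivMod using (_/_; _%_; m≡m%n+[m/n]*n; m%n<n; m*n/n≡m; m*[n/m]≡n)
open import Data.Nat.Divisibility using (_∣_; _∣?_; divides; ∣⇒≤; ∣m∣n⇒∣m+n; *-cancelʳ-∣; _∣0; m%n≡0⇒n∣m)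
open import Data.Nat.GCD using (gcd; gcd-comm; gcd[m,n]∣m; gcd[m,n]∣n; gcd[m,n]≡0⇒m≡0; c*gcd[m,n]≡gcd[cm,cn])
open import Data.Nat.Coprimality using (gcd≡1⇒coprime; coprime-divisor)
open import Data.Integer using () renaming (+_ to ι)
import Data.Integer as ℤ
import Data.Integer.Properties as ℤₚ
open import Data.Rational as ℚ using (ℚ; 0ℚ; 1ℚ) renaming (_+_ to _+ℚ_; _*_ to _*ℚ_)
import Data.Rational.Properties as ℚₚ
import Data.Rational.Unnormalised as ℚᵘ
import Data.Rational.Unnormalised.Properties as ℚᵘₚ
open import Data.Rational.Solver using (module +-*-Solver)
open import Data.Fin using (Fin; toℕ) renaming (zero to fz; suc to fs)
open import Data.Fin.Properties using (suc-injective) renaming (_≟_ to _≟F_)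
open import Data.Sign using (Sign) renaming (+ to ⊕; - to ⊖; _*_ to _·_)
import Data.Sign.Properties as Signₚ
open import Data.List using (List; []; _∷_; length; map; foldr; concatMap; upTo; allFin; tabulate; cartesianProduct; _++_; _∷ʳ_)
open import Data.List.Properties using (map-upTo; upTo-∷ʳ; map-tabulate; length-tabulate; map-cong)
open import Data.List.Relation.Unary.All as All using (All; []; _∷_)
open import Data.List.Relation.Unary.Any using (here; there)
open import Data.List.Membership.Propositional using (_∈_)
open import Data.List.Membership.Propositional.Properties using (∈-cartesianProduct⁺; ∈-allFin; ∈-upTo⁺; ∈-upTo⁻)
open import Data.List.Relation.Binary.Permutation.Propositional as ↭ using (_↭_)
open import Data.List.Relation.Binary.Permutation.Propositional.Properties using (All-resp-↭)
open import Data.Vec as Vec using (Vec; lookup; toList; updateAt)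
open import Data.Vec.Properties using (lookup∘updateAt; lookup∘updateAt′)
open import Data.Product using (_×_; _,_; proj₁; proj₂; ∃; Σ)
open import Function using (_∘_; id)
open import Relation.Nullary using (Dec; yes; no)
open import Relation.Nullary.Decidable using (⌊_⌋)
open import Relation.Binary.PropositionalEquality hiding (J)
open ≡-Reasoning

-- Conjugacy classes and their sizes are never counted. The constant 1 / 2 len u, the inverse order
-- of the centralizer of one cycle, is tested only through the recursion: singling out a cycle with
-- the factor 2 len u cancels its weight, while over all cycles of a word of size n + 1 these
-- factors add up to 2 (n + 1) = |B_{n+1}| / |B_n|. This is the degree operator applied to an
-- exponential. For fixed exponents `a`, `c` the coefficient is a symmetric function F of the cycle
-- list. The recursion changes F, so the comparison is made for every symmetric F and specialised to
-- `coefficient k a c` only at the end. The sums are cut off at M for the lengths of cycles and at D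
-- for their number. Each shift of an index then leaves a boundary term, which vanishes because only
-- words of one given size count. Elements of B_n are functions, listed by search and compared
-- pointwise. The enumeration by insertion carries a certificate `Cycles`, from which the results of
-- the orbit search are read off; the two lists are exchanged inside sums by counting matches, not
-- by a permutation of lists.

private variable
  A B : Set
  P Q : Set
  m n : ℕ

-- Finite sums of rationals

Σ-cong : (xs : List A) {f g : A → ℚ} → (∀ x → f x ≡ g x) → Σℚ xs f ≡ Σℚ xs g
Σ-cong []       e = refl
Σ-cong (x ∷ xs) e = cong₂ _+ℚ_ (e x) (Σ-cong xs e)

Σ-congAll : {xs : List A} {f g : A → ℚ} → All (λ x → f x ≡ g x) xs → Σℚ xs f ≡ Σℚ xs g
Σ-congAll []       = refl
Σ-congAll (e ∷ es) = cong₂ _+ℚ_ e (Σ-congAll es)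

Σ-zero : (xs : List A) → Σℚ xs (λ _ → 0ℚ) ≡ 0ℚ
Σ-zero []       = refl
Σ-zero (x ∷ xs) = trans (ℚₚ.+-identityˡ _) (Σ-zero xs)

+-interchange : ∀ a b c d → (a +ℚ b) +ℚ (c +ℚ d) ≡ (a +ℚ c) +ℚ (b +ℚ d)
+-interchange = solve 4 (λ a b c d → (a :+ b) :+ (c :+ d) := (a :+ c) :+ (b :+ d)) refl
  where open +-*-Solver

Σ-+ : (xs : List A) (f g : A → ℚ) → Σℚ xs (λ x → f x +ℚ g x) ≡ Σℚ xs f +ℚ Σℚ xs g
Σ-+ []       f g = sym (ℚₚ.+-identityˡ 0ℚ)
Σ-+ (x ∷ xs) f g = trans (cong ((f x +ℚ g x) +ℚ_) (Σ-+ xs f g)) (+-interchange (f x) (g x) (Σℚ xs f) (Σℚ xs g))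

Σ-*ˡ : (xs : List A) (c : ℚ) (f : A → ℚ) → Σℚ xs (λ x → c *ℚ f x) ≡ c *ℚ Σℚ xs f
Σ-*ˡ []       c f = sym (ℚₚ.*-zeroʳ c)
Σ-*ˡ (x ∷ xs) c f = trans (cong (c *ℚ f x +ℚ_) (Σ-*ˡ xs c f)) (sym (ℚₚ.*-distribˡ-+ c (f x) (Σℚ xs f)))

Σ-*ʳ : (xs : List A) (c : ℚ) (f : A → ℚ) → Σℚ xs (λ x → f x *ℚ c) ≡ Σℚ xs f *ℚ c
Σ-*ʳ xs c f = trans (Σ-cong xs (λ x → ℚₚ.*-comm (f x) c)) (trans (Σ-*ˡ xs c f) (ℚₚ.*-comm c (Σℚ xs f)))

Σ-swap : (xs : List A) (ys : List B) (f : A → B → ℚ) →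
  Σℚ xs (λ x → Σℚ ys (f x)) ≡ Σℚ ys (λ y → Σℚ xs (λ x → f x y))
Σ-swap []       ys f = sym (Σ-zero ys)
Σ-swap (x ∷ xs) ys f = trans (cong (Σℚ ys (f x) +ℚ_) (Σ-swap xs ys f))
        (sym (Σ-+ ys (f x) (λ y → Σℚ xs (λ x → f x y))))

Σ-++ : (xs ys : List A) (f : A → ℚ) → Σℚ (xs ++ ys) f ≡ Σℚ xs f +ℚ Σℚ ys f
Σ-++ []       ys f = sym (ℚₚ.+-identityˡ _)
Σ-++ (x ∷ xs) ys f = trans (cong (f x +ℚ_) (Σ-++ xs ys f)) (sym (ℚₚ.+-assoc (f x) (Σℚ xs f) (Σℚ ys f)))

Σ-map : (h : A → B) (xs : List A) (f : B → ℚ) → Σℚ (map h xs) f ≡ Σℚ xs (f ∘ h)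
Σ-map h []       f = refl
Σ-map h (x ∷ xs) f = cong (f (h x) +ℚ_) (Σ-map h xs f)

Σ-concatMap : (h : A → List B) (xs : List A) (f : B → ℚ) →
  Σℚ (concatMap h xs) f ≡ Σℚ xs (λ x → Σℚ (h x) f)
Σ-concatMap h []       f = refl
Σ-concatMap h (x ∷ xs) f = trans (Σ-++ (h x) _ f) (cong (Σℚ (h x) f +ℚ_) (Σ-concatMap h xs f))

Σ-cartesianProduct : (xs : List A) (ys : List B) (f : A × B → ℚ) →
  Σℚ (cartesianProduct xs ys) f ≡ Σℚ xs (λ x → Σℚ ys (λ y → f (x , y)))
Σ-cartesianProduct []       ys f = refl
Σ-cartesianProduct (x ∷ xs) ys f =
  trans (Σ-++ (map (x ,_) ys) _ f) (cong₂ _+ℚ_ (Σ-map (x ,_) ys f) (Σ-cartesianProduct xs ys f))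

Σ-allFin-suc : ∀ n (f : Fin (suc n) → ℚ) → Σℚ (allFin (suc n)) f ≡ f fz +ℚ Σℚ (allFin n) (f ∘ fs)
Σ-allFin-suc n f = cong (f fz +ℚ_)
  (trans (cong (λ l → Σℚ l f) (sym (map-tabulate id fs))) (Σ-map fs (allFin n) f))

Σ-upTo-suc : ∀ n (f : ℕ → ℚ) → Σℚ (upTo (suc n)) f ≡ f 0 +ℚ Σℚ (upTo n) (f ∘ suc)
Σ-upTo-suc n f = cong (f 0 +ℚ_)
  (trans (cong (λ l → Σℚ l f) (sym (map-upTo suc n))) (Σ-map suc (upTo n) f))

Σ-upTo-last : ∀ n (f : ℕ → ℚ) → Σℚ (upTo (suc n)) f ≡ Σℚ (upTo n) f +ℚ f n
Σ-upTo-last n f = begin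
  Σℚ (upTo (suc n)) f          ≡⟨ cong (λ l → Σℚ l f) (sym (upTo-∷ʳ n)) ⟩
  Σℚ (upTo n ∷ʳ n) f           ≡⟨ Σ-++ (upTo n) _ f ⟩
  Σℚ (upTo n) f +ℚ (f n +ℚ 0ℚ) ≡⟨ cong (Σℚ (upTo n) f +ℚ_) (ℚₚ.+-identityʳ (f n)) ⟩
  Σℚ (upTo n) f +ℚ f n         ∎

Σ-upTo-cong : ∀ n {f g : ℕ → ℚ} → (∀ i → i < n → f i ≡ g i) → Σℚ (upTo n) f ≡ Σℚ (upTo n) g
Σ-upTo-cong zero    e = refl
Σ-upTo-cong (suc n) {f} {g} e = begin
  Σℚ (upTo (suc n)) f   ≡⟨ Σ-upTo-last n f ⟩
  Σℚ (upTo n) f +ℚ f n  ≡⟨ cong₂ _+ℚ_ (Σ-upTo-cong n (λ i l → e i (ℕₚ.m<n⇒m<1+n l))) (e n ℕₚ.≤-refl) ⟩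
  Σℚ (upTo n) g +ℚ g n  ≡⟨ Σ-upTo-last n g ⟨
  Σℚ (upTo (suc n)) g   ∎

-- Indicators

𝟙 : Bool → ℚ
𝟙 b = if b then 1ℚ else 0ℚ

𝟙-∧ : ∀ b c → 𝟙 (b ∧ c) ≡ 𝟙 b *ℚ 𝟙 c
𝟙-∧ true  c = sym (ℚₚ.*-identityˡ _)
𝟙-∧ false c = sym (ℚₚ.*-zeroˡ (𝟙 c))

⇔-≡ : ∀ {b c} → (b ≡ true → c ≡ true) → (c ≡ true → b ≡ true) → b ≡ c
⇔-≡ {true}  {c}     f g = sym (f refl)
⇔-≡ {false} {false} f g = refl
⇔-≡ {false} {true}  f g = g refl

𝟙-*-cong : ∀ b {x y} → (b ≡ true → x ≡ y) → 𝟙 b *ℚ x ≡ 𝟙 b *ℚ y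
𝟙-*-cong true  e = cong (1ℚ *ℚ_) (e refl)
𝟙-*-cong false {x} {y} e = trans (ℚₚ.*-zeroˡ x) (sym (ℚₚ.*-zeroˡ y))

Σ-filterB : (p : A → Bool) (xs : List A) (f : A → ℚ) →
  Σℚ (filterB p xs) f ≡ Σℚ xs (λ x → 𝟙 (p x) *ℚ f x)
Σ-filterB p []       f = refl
Σ-filterB p (x ∷ xs) f with p x
... | true  = cong₂ _+ℚ_ (sym (ℚₚ.*-identityˡ (f x))) (Σ-filterB p xs f)
... | false = trans (Σ-filterB p xs f) (sym (trans (cong (_+ℚ rest) (ℚₚ.*-zeroˡ (f x))) (ℚₚ.+-identityˡ rest)))
  where rest = Σℚ xs (λ x → 𝟙 (p x) *ℚ f x)

-- Natural numbers as rationals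

fromℕ-toℚᵘ : ∀ n → ℚ.toℚᵘ (fromℕ n) ℚᵘ.≃ ℚᵘ.mkℚᵘ (ι n) 0
fromℕ-toℚᵘ n = ℚₚ.toℚᵘ-fromℚᵘ (ℚᵘ.mkℚᵘ (ι n) 0)

-- Identities between counts, exponents and sizes are proved as identities between rational sums,
-- where summations can be exchanged; this brings them back to `ℕ`.
fromℕ-injective : ∀ {m n} → fromℕ m ≡ fromℕ n → m ≡ n
fromℕ-injective {m} {n} e
  with ℚᵘₚ.≃-trans (ℚᵘₚ.≃-sym (fromℕ-toℚᵘ m)) (ℚᵘₚ.≃-trans (ℚᵘₚ.≃-reflexive (cong ℚ.toℚᵘ e)) (fromℕ-toℚᵘ n))
... | ℚᵘ.*≡* eq = ℤₚ.+-injective (trans (sym (ℤₚ.*-identityʳ (ι m))) (trans eq (ℤₚ.*-identityʳ (ι n))))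

fromℕ-+ : ∀ m n → fromℕ (m + n) ≡ fromℕ m +ℚ fromℕ n
fromℕ-+ m n = ℚₚ.toℚᵘ-injective
  (ℚᵘₚ.≃-trans (fromℕ-toℚᵘ (m + n))
  (ℚᵘₚ.≃-trans (ℚᵘ.*≡* (cong₂ ℤ._*_ (sym (cong₂ ℤ._+_ (ℤₚ.*-identityʳ (ι m)) (ℤₚ.*-identityʳ (ι n)))) refl))
  (ℚᵘₚ.≃-trans (ℚᵘₚ.+-cong (ℚᵘₚ.≃-sym (fromℕ-toℚᵘ m)) (ℚᵘₚ.≃-sym (fromℕ-toℚᵘ n)))
  (ℚᵘₚ.≃-sym (ℚₚ.toℚᵘ-homo-+ (fromℕ m) (fromℕ n))))))

fromℕ-* : ∀ m n → fromℕ (m * n) ≡ fromℕ m *ℚ fromℕ n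
fromℕ-* m n = ℚₚ.toℚᵘ-injective
  (ℚᵘₚ.≃-trans (fromℕ-toℚᵘ (m * n))
  (ℚᵘₚ.≃-trans (ℚᵘ.*≡* (cong (ℤ._* ι 1) (ℤₚ.pos-* m n)))
  (ℚᵘₚ.≃-trans (ℚᵘₚ.*-cong (ℚᵘₚ.≃-sym (fromℕ-toℚᵘ m)) (ℚᵘₚ.≃-sym (fromℕ-toℚᵘ n)))
  (ℚᵘₚ.≃-sym (ℚₚ.toℚᵘ-homo-* (fromℕ m) (fromℕ n))))))

fromℕ-*-inv : ∀ n → fromℕ (suc n) *ℚ inv (suc n) ≡ 1ℚ
fromℕ-*-inv n = ℚₚ.toℚᵘ-injective
  (ℚᵘₚ.≃-trans (ℚₚ.toℚᵘ-homo-* (fromℕ (suc n)) (inv (suc n)))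
  (ℚᵘₚ.≃-trans (ℚᵘₚ.*-cong (fromℕ-toℚᵘ (suc n)) (ℚₚ.toℚᵘ-fromℚᵘ (ℚᵘ.mkℚᵘ (ι 1) n)))
  (ℚᵘ.*≡* (trans (ℤₚ.*-identityʳ _) (trans (ℤₚ.*-identityʳ (ι (suc n)))
    (sym (trans (ℤₚ.*-identityˡ _) (cong (λ m → ι (suc m)) (ℕₚ.+-identityʳ n)))))))))

fromℕ-count : (p : A → Bool) (xs : List A) → fromℕ (count p xs) ≡ Σℚ xs (𝟙 ∘ p)
fromℕ-count p []       = refl
fromℕ-count p (x ∷ xs) with p x
... | true  = trans (fromℕ-+ 1 (count p xs)) (cong (1ℚ +ℚ_) (fromℕ-count p xs))
... | false = trans (fromℕ-count p xs) (sym (ℚₚ.+-identityˡ _))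

-- Boolean tests and what they decide

∧-split : ∀ b {c} → b ∧ c ≡ true → b ≡ true × c ≡ true
∧-split true e = refl , e

and-map⁻ : (p : A → Bool) {xs : List A} → and (map p xs) ≡ true → All (λ x → p x ≡ true) xs
and-map⁻ p {[]}     e = []
and-map⁻ p {x ∷ xs} e = let (a , b) = ∧-split (p x) e in a ∷ and-map⁻ p b

and-map⁺ : (p : A → Bool) {xs : List A} → All (λ x → p x ≡ true) xs → and (map p xs) ≡ true
and-map⁺ p []       = refl
and-map⁺ p (e ∷ es) = cong₂ _∧_ e (and-map⁺ p es)

≡ᵇ⁻ : ∀ m n → (m ≡ᵇ n) ≡ true → m ≡ n
≡ᵇ⁻ m n e = ℕₚ.≡ᵇ⇒≡ m n (subst T (sym e) _)

≡ᵇ⁺ : ∀ {m n} → m ≡ n → (m ≡ᵇ n) ≡ true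
≡ᵇ⁺ {zero}  refl = refl
≡ᵇ⁺ {suc m} refl = ≡ᵇ⁺ {m} refl

≤ᵇ⁻ : ∀ {m n} → (m ≤ᵇ n) ≡ true → m ≤ n
≤ᵇ⁻ {m} {n} e = ℕₚ.≤ᵇ⇒≤ m n (subst T (sym e) _)

≤ᵇ⁺ : ∀ {m n} → m ≤ n → (m ≤ᵇ n) ≡ true
≤ᵇ⁺ {m} {n} m≤n with m ≤ᵇ n in e
... | true  = refl
... | false = ⊥-elim (subst T e (ℕₚ.≤⇒≤ᵇ m≤n))

-- Words of cycles and the exponential formula

*-left-comm : ∀ a b c → a *ℚ (b *ℚ c) ≡ b *ℚ (a *ℚ c)
*-left-comm = solve 3 (λ a b c → a :* (b :* c) := b :* (a :* c)) refl
  where open +-*-Solver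

inv-inverse : ∀ n → n ≢ 0 → fromℕ n *ℚ inv n ≡ 1ℚ
inv-inverse zero    n≢0 = ⊥-elim (n≢0 refl)
inv-inverse (suc n) _   = fromℕ-*-inv n

inv-unique : ∀ n x → n ≢ 0 → fromℕ n *ℚ x ≡ 1ℚ → x ≡ inv n
inv-unique n x n≢0 e = begin
  x                          ≡⟨ ℚₚ.*-identityʳ x ⟨
  x *ℚ 1ℚ                    ≡⟨ cong (x *ℚ_) (inv-inverse n n≢0) ⟨
  x *ℚ (fromℕ n *ℚ inv n)    ≡⟨ solve 3 (λ x a b → x :* (a :* b) := (a :* x) :* b) refl x (fromℕ n) (inv n) ⟩
  (fromℕ n *ℚ x) *ℚ inv n    ≡⟨ cong (_*ℚ inv n) e ⟩
  1ℚ *ℚ inv n                ≡⟨ ℚₚ.*-identityˡ (inv n) ⟩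
  inv n                      ∎
  where open +-*-Solver

*-≢0 : ∀ {m n} → m ≢ 0 → n ≢ 0 → m * n ≢ 0
*-≢0 {m} {n} m≢0 n≢0 = ℕ.≢-nonZero⁻¹ (m * n)
  {{ℕₚ.m*n≢0 m n {{ℕ.≢-nonZero m≢0}} {{ℕ.≢-nonZero n≢0}}}}

inv-cancelˡ : ∀ m n → m ≢ 0 → n ≢ 0 → fromℕ m *ℚ inv (m * n) ≡ inv n
inv-cancelˡ m n m≢0 n≢0 = inv-unique n _ n≢0 (begin
  fromℕ n *ℚ (fromℕ m *ℚ inv (m * n)) ≡⟨ ℚₚ.*-assoc (fromℕ n) (fromℕ m) (inv (m * n)) ⟨
  (fromℕ n *ℚ fromℕ m) *ℚ inv (m * n) ≡⟨ cong (_*ℚ inv (m * n)) (trans (ℚₚ.*-comm (fromℕ n) (fromℕ m)) (sym (fromℕ-* m n))) ⟩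
  fromℕ (m * n) *ℚ inv (m * n)        ≡⟨ inv-inverse (m * n) (*-≢0 m≢0 n≢0) ⟩
  1ℚ                                  ∎)

fact≢0 : ∀ n → fact n ≢ 0
fact≢0 zero    ()
fact≢0 (suc n) = *-≢0 {suc n} (λ ()) (fact≢0 n)

-- Rests on (m + 1) / (m + 1)! = 1 / m!. The shifted sum stops one term short of the other, which is
-- why `J D` has to vanish.
Σ-fact-shift : ∀ D (Z J : ℕ → ℚ) → Z 0 ≡ 0ℚ → (∀ m → Z (suc m) ≡ fromℕ (suc m) *ℚ J m) → J D ≡ 0ℚ →
  Σℚ (upTo (suc D)) (λ m → inv (fact m) *ℚ Z m) ≡ Σℚ (upTo (suc D)) (λ m → inv (fact m) *ℚ J m)
Σ-fact-shift D Z J Z0 ZJ JD = begin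
  Σℚ (upTo (suc D)) (λ m → inv (fact m) *ℚ Z m)
    ≡⟨ Σ-upTo-suc D (λ m → inv (fact m) *ℚ Z m) ⟩
  1ℚ *ℚ Z 0 +ℚ Σℚ (upTo D) (λ m → inv (fact (suc m)) *ℚ Z (suc m))
    ≡⟨ cong₂ _+ℚ_ (trans (ℚₚ.*-identityˡ (Z 0)) Z0) (Σ-cong (upTo D) step) ⟩
  0ℚ +ℚ Σℚ (upTo D) (λ m → inv (fact m) *ℚ J m)
    ≡⟨ ℚₚ.+-comm 0ℚ S ⟩
  Σℚ (upTo D) (λ m → inv (fact m) *ℚ J m) +ℚ 0ℚ
    ≡⟨ cong (S +ℚ_) (sym (trans (cong (inv (fact D) *ℚ_) JD) (ℚₚ.*-zeroʳ (inv (fact D))))) ⟩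
  Σℚ (upTo D) (λ m → inv (fact m) *ℚ J m) +ℚ inv (fact D) *ℚ J D
    ≡⟨ Σ-upTo-last D (λ m → inv (fact m) *ℚ J m) ⟨
  Σℚ (upTo (suc D)) (λ m → inv (fact m) *ℚ J m) ∎
  where
  S : ℚ
  S = Σℚ (upTo D) (λ m → inv (fact m) *ℚ J m)
  step : ∀ m → inv (fact (suc m)) *ℚ Z (suc m) ≡ inv (fact m) *ℚ J m
  step m = begin
    inv (fact (suc m)) *ℚ Z (suc m)                   ≡⟨ cong (inv (fact (suc m)) *ℚ_) (ZJ m) ⟩
    inv (fact (suc m)) *ℚ (fromℕ (suc m) *ℚ J m)      ≡⟨ solve 3 (λ a b c → a :* (b :* c) := (b :* a) :* c) refl (inv (fact (suc m))) (fromℕ (suc m)) (J m) ⟩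
    (fromℕ (suc m) *ℚ inv (fact (suc m))) *ℚ J m      ≡⟨ cong (_*ℚ J m) (inv-cancelˡ (suc m) (fact m) (λ ()) (fact≢0 m)) ⟩
    inv (fact m) *ℚ J m                               ∎
    where open +-*-Solver

-- (l , ε) stands for a cycle of length l + 1 and class ε.
Col : Set
Col = ℕ × Sign

len : Col → ℕ
len u = suc (proj₁ u)

inc : Col → Col
inc (l , ε) = (suc l , ε)

size : List Col → ℕ
size []      = 0
size (u ∷ v) = len u + size v

length≤size : ∀ v → length v ≤ size v
length≤size []            = z≤n
length≤size ((l , _) ∷ v) = s≤s (ℕₚ.≤-trans (length≤size v) (ℕₚ.m≤n+m (size v) l))

-- One entry per position, so equal cycles are picked as often as they occur.
picks : List Col → List (Col × List Col)
picks []      = []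
picks (u ∷ v) = (u , v) ∷ map (λ p → proj₁ p , u ∷ proj₂ p) (picks v)

Σ-picks-∷ : ∀ u v (H : Col → List Col → ℚ) →
  Σℚ (picks (u ∷ v)) (λ p → H (proj₁ p) (proj₂ p)) ≡
  H u v +ℚ Σℚ (picks v) (λ p → H (proj₁ p) (u ∷ proj₂ p))
Σ-picks-∷ u v H = cong (H u v +ℚ_) (Σ-map _ (picks v) (λ p → H (proj₁ p) (proj₂ p)))

Symmetric : (List Col → ℚ) → Set
Symmetric F = ∀ {v v′} → v ↭ v′ → F v ≡ F v′

-- A permutation of the word permutes the picks but also reorders the remainders, hence the symmetry
-- required of each `H u`. This is what keeps `insertions F` symmetric.
Σ-picks-↭ : ∀ {v v′} → v ↭ v′ → (H : Col → List Col → ℚ) → (∀ u → Symmetric (H u)) →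
  Σℚ (picks v) (λ p → H (proj₁ p) (proj₂ p)) ≡ Σℚ (picks v′) (λ p → H (proj₁ p) (proj₂ p))
Σ-picks-↭ ↭.refl        H s = refl
Σ-picks-↭ {x ∷ v} {x ∷ v′} (↭.prep x π) H s = begin
  _ ≡⟨ Σ-picks-∷ x v H ⟩
  H x v +ℚ Σℚ (picks v) (λ p → H (proj₁ p) (x ∷ proj₂ p))
    ≡⟨ cong₂ _+ℚ_ (s x π) (Σ-picks-↭ π (λ u r → H u (x ∷ r)) (λ u ρ → s u (↭.prep x ρ))) ⟩
  H x v′ +ℚ Σℚ (picks v′) (λ p → H (proj₁ p) (x ∷ proj₂ p))
    ≡⟨ Σ-picks-∷ x v′ H ⟨
  _ ∎
Σ-picks-↭ {x ∷ y ∷ v} {y ∷ x ∷ v′} (↭.swap x y π) H s = begin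
  _ ≡⟨ two x y v ⟩
  H x (y ∷ v) +ℚ (H y (x ∷ v) +ℚ Σℚ (picks v) (λ p → H (proj₁ p) (x ∷ y ∷ proj₂ p)))
    ≡⟨ cong₂ _+ℚ_ (s x (↭.prep y π)) (cong₂ _+ℚ_ (s y (↭.prep x π))
         (trans (Σ-picks-↭ π (λ u r → H u (x ∷ y ∷ r)) (λ u ρ → s u (↭.prep x (↭.prep y ρ))))
                (Σ-cong (picks v′) (λ p → s (proj₁ p) (↭.swap x y ↭.refl))))) ⟩
  H x (y ∷ v′) +ℚ (H y (x ∷ v′) +ℚ S)
    ≡⟨ solve 3 (λ a b c → a :+ (b :+ c) := b :+ (a :+ c)) refl (H x (y ∷ v′)) (H y (x ∷ v′)) S ⟩
  H y (x ∷ v′) +ℚ (H x (y ∷ v′) +ℚ S)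
    ≡⟨ two y x v′ ⟨
  _ ∎
  where
  open +-*-Solver
  S : ℚ
  S = Σℚ (picks v′) (λ p → H (proj₁ p) (y ∷ x ∷ proj₂ p))
  two : ∀ x y v → Σℚ (picks (x ∷ y ∷ v)) (λ p → H (proj₁ p) (proj₂ p)) ≡
    H x (y ∷ v) +ℚ (H y (x ∷ v) +ℚ Σℚ (picks v) (λ p → H (proj₁ p) (x ∷ y ∷ proj₂ p)))
  two x y v = trans (Σ-picks-∷ x (y ∷ v) H) (cong (H x (y ∷ v) +ℚ_) (Σ-picks-∷ y v (λ u r → H u (x ∷ r))))
Σ-picks-↭ (↭.trans π ρ) H s = trans (Σ-picks-↭ π H s) (Σ-picks-↭ ρ H s)

-- The equation on sizes holds for every pair that arises from `v`; it lets an indicator of `size v`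
-- be read as one of the modified word.
Σ-picks-cong : ∀ v {H K : Col → List Col → ℚ} → (∀ u r → len u + size r ≡ size v → H u r ≡ K u r) →
  Σℚ (picks v) (λ p → H (proj₁ p) (proj₂ p)) ≡ Σℚ (picks v) (λ p → K (proj₁ p) (proj₂ p))
Σ-picks-cong []      e = refl
Σ-picks-cong (x ∷ v) {H} {K} e = begin
  _ ≡⟨ Σ-picks-∷ x v H ⟩
  _ ≡⟨ cong₂ _+ℚ_ (e x v refl) (Σ-picks-cong v (λ u r q → e u (x ∷ r)
         (trans (left-comm (len u) (len x) (size r)) (cong (len x +_) q)))) ⟩
  _ ≡⟨ Σ-picks-∷ x v K ⟨
  _ ∎
  where
  left-comm : ∀ a b c → a + (b + c) ≡ b + (a + c)
  left-comm a b c = trans (sym (ℕₚ.+-assoc a b c)) (trans (cong (_+ c) (ℕₚ.+-comm a b)) (ℕₚ.+-assoc b a c))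

-- By symmetry, moving the picked cycle to the front does not change `F`, and the lengths of the
-- cycles add up to the size.
Σ-picks-size : ∀ v (F : List Col → ℚ) → Symmetric F →
  Σℚ (picks v) (λ p → fromℕ (2 * len (proj₁ p)) *ℚ F (proj₁ p ∷ proj₂ p)) ≡ fromℕ (2 * size v) *ℚ F v
Σ-picks-size []      F s = sym (ℚₚ.*-zeroˡ (F []))
Σ-picks-size (x ∷ v) F s = begin
  _ ≡⟨ Σ-picks-∷ x v (λ u r → fromℕ (2 * len u) *ℚ F (u ∷ r)) ⟩
  a *ℚ F (x ∷ v) +ℚ Σℚ (picks v) (λ p → fromℕ (2 * len (proj₁ p)) *ℚ F (proj₁ p ∷ x ∷ proj₂ p))
    ≡⟨ cong (a *ℚ F (x ∷ v) +ℚ_) (trans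
         (Σ-cong (picks v) (λ p → cong (fromℕ (2 * len (proj₁ p)) *ℚ_) (s (↭.swap _ _ ↭.refl))))
         (Σ-picks-size v (λ r → F (x ∷ r)) (λ π → s (↭.prep x π)))) ⟩
  a *ℚ F (x ∷ v) +ℚ b *ℚ F (x ∷ v)
    ≡⟨ ℚₚ.*-distribʳ-+ (F (x ∷ v)) a b ⟨
  (a +ℚ b) *ℚ F (x ∷ v)
    ≡⟨ cong (_*ℚ F (x ∷ v)) (trans (sym (fromℕ-+ (2 * len x) (2 * size v)))
         (cong fromℕ (sym (ℕₚ.*-distribˡ-+ 2 (len x) (size v))))) ⟩
  fromℕ (2 * size (x ∷ v)) *ℚ F (x ∷ v) ∎
  where
  a b : ℚ
  a = fromℕ (2 * len x)
  b = fromℕ (2 * size v)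

-- The effect of inserting a new letter in all possible ways into an element with
-- cycles v: it becomes a fixed point of either class, or it is put, with either
-- sign, behind one of the len u letters of a cycle u.
insertions : (List Col → ℚ) → List Col → ℚ
insertions F v = Σℚ allSigns (λ ε → F ((0 , ε) ∷ v)) +ℚ
  Σℚ (picks v) (λ p → fromℕ (2 * len (proj₁ p)) *ℚ F (inc (proj₁ p) ∷ proj₂ p))

insertions-symmetric : ∀ F → Symmetric F → Symmetric (insertions F)
insertions-symmetric F s π = cong₂ _+ℚ_
  (Σ-cong allSigns (λ ε → s (↭.prep (0 , ε) π)))
  (Σ-picks-↭ π (λ u r → fromℕ (2 * len u) *ℚ F (inc u ∷ r))
    (λ u ρ → cong (fromℕ (2 * len u) *ℚ_) (s (↭.prep _ ρ))))

colours : ℕ → List Col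
colours M = cartesianProduct (upTo M) allSigns

Σ-colours : ∀ M f → Σℚ (colours M) f ≡ Σℚ (upTo M) (λ l → Σℚ allSigns (λ ε → f (l , ε)))
Σ-colours M f = Σ-cartesianProduct (upTo M) allSigns f

-- `2 * len u` is the order of the centralizer of a single cycle `u` among the signed permutations
-- of its `len u` letters.
weight : Col → ℚ
weight u = inv (2 * len u)

weight-inverse : ∀ u x → weight u *ℚ (fromℕ (2 * len u) *ℚ x) ≡ x
weight-inverse u x = begin
  weight u *ℚ (a *ℚ x)   ≡⟨ solve 3 (λ w a x → w :* (a :* x) := (a :* w) :* x) refl (weight u) a x ⟩
  (a *ℚ weight u) *ℚ x   ≡⟨ cong (_*ℚ x) (inv-inverse (2 * len u) (λ ())) ⟩
  1ℚ *ℚ x                ≡⟨ ℚₚ.*-identityˡ x ⟩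
  x                      ∎
  where
  open +-*-Solver
  a : ℚ
  a = fromℕ (2 * len u)

module _ (M : ℕ) where

  -- The coefficient-free form of (Σ_u p_u / 2 len u)^m: the value of F at each
  -- word u₁ … u_m, weighted by ∏ 1 / 2 len uᵢ.
  wordSum : ℕ → (List Col → ℚ) → ℚ
  wordSum zero    F = F []
  wordSum (suc m) F = Σℚ (colours M) (λ u → weight u *ℚ wordSum m (λ v → F (u ∷ v)))

  wordSum-cong : ∀ m {F G} → (∀ v → length v ≡ m → F v ≡ G v) → wordSum m F ≡ wordSum m G
  wordSum-cong zero    e = e [] refl
  wordSum-cong (suc m) e = Σ-cong (colours M) (λ u → cong (weight u *ℚ_)
    (wordSum-cong m (λ v l → e (u ∷ v) (cong suc l))))

  wordSum-*ˡ : ∀ m c F → wordSum m (λ v → c *ℚ F v) ≡ c *ℚ wordSum m F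
  wordSum-*ˡ zero    c F = refl
  wordSum-*ˡ (suc m) c F = trans (Σ-cong (colours M) (λ u →
    trans (cong (weight u *ℚ_) (wordSum-*ˡ m c (λ v → F (u ∷ v))))
          (*-left-comm (weight u) c (wordSum m (λ v → F (u ∷ v))))))
    (Σ-*ˡ (colours M) c _)

  wordSum-+ : ∀ m F G → wordSum m (λ v → F v +ℚ G v) ≡ wordSum m F +ℚ wordSum m G
  wordSum-+ zero    F G = refl
  wordSum-+ (suc m) F G = trans (Σ-cong (colours M) (λ u →
    trans (cong (weight u *ℚ_) (wordSum-+ m (λ v → F (u ∷ v)) (λ v → G (u ∷ v))))
          (ℚₚ.*-distribˡ-+ (weight u) (wordSum m (λ v → F (u ∷ v))) (wordSum m (λ v → G (u ∷ v))))))
    (Σ-+ (colours M) (λ u → weight u *ℚ wordSum m (λ v → F (u ∷ v))) _)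

  wordSum-zero : ∀ m → wordSum m (λ _ → 0ℚ) ≡ 0ℚ
  wordSum-zero zero    = refl
  wordSum-zero (suc m) = trans (Σ-cong (colours M) (λ u →
    trans (cong (weight u *ℚ_) (wordSum-zero m)) (ℚₚ.*-zeroʳ (weight u)))) (Σ-zero (colours M))

  wordSum-Σ : ∀ m (xs : List A) (F : A → List Col → ℚ) →
    wordSum m (λ v → Σℚ xs (λ x → F x v)) ≡ Σℚ xs (λ x → wordSum m (F x))
  wordSum-Σ m []       F = wordSum-zero m
  wordSum-Σ m (x ∷ xs) F = trans (wordSum-+ m (F x) _) (cong (wordSum m (F x) +ℚ_) (wordSum-Σ m xs F))

  -- A letter at any of the m + 1 positions contributes as much as the first one.
  mutual
    wordSum-picks : ∀ m (H : Col → List Col → ℚ) →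
      wordSum (suc m) (λ v → Σℚ (picks v) (λ p → H (proj₁ p) (proj₂ p))) ≡
      fromℕ (suc m) *ℚ Σℚ (colours M) (λ u → weight u *ℚ wordSum m (H u))
    wordSum-picks m H = begin
      _ ≡⟨ Σ-cong (colours M) (λ u → trans
             (cong (weight u *ℚ_) (trans (wordSum-cong m (λ v _ → Σ-picks-∷ u v H)) (wordSum-+ m (H u) _)))
             (ℚₚ.*-distribˡ-+ (weight u) (wordSum m (H u)) (R u))) ⟩
      Σℚ (colours M) (λ u → weight u *ℚ wordSum m (H u) +ℚ weight u *ℚ R u)
        ≡⟨ Σ-+ (colours M) (λ u → weight u *ℚ wordSum m (H u)) (λ u → weight u *ℚ R u) ⟩
      S +ℚ Σℚ (colours M) (λ u → weight u *ℚ R u)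
        ≡⟨ cong (S +ℚ_) (later-picks m H) ⟩
      S +ℚ fromℕ m *ℚ S
        ≡⟨ cong (_+ℚ fromℕ m *ℚ S) (ℚₚ.*-identityˡ S) ⟨
      1ℚ *ℚ S +ℚ fromℕ m *ℚ S
        ≡⟨ ℚₚ.*-distribʳ-+ S 1ℚ (fromℕ m) ⟨
      (1ℚ +ℚ fromℕ m) *ℚ S
        ≡⟨ cong (_*ℚ S) (fromℕ-+ 1 m) ⟨
      fromℕ (suc m) *ℚ S ∎
      where
      S : ℚ
      S = Σℚ (colours M) (λ u → weight u *ℚ wordSum m (H u))
      R : Col → ℚ
      R u = wordSum m (λ v → Σℚ (picks v) (λ p → H (proj₁ p) (u ∷ proj₂ p)))

    -- One summand for each of the `m` positions behind the head: `wordSum-picks` for the shorter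
    -- words supplies this factor, and exchanging the sums over the head `u` and the picked `c` puts
    -- `c` in front.
    later-picks : ∀ m (H : Col → List Col → ℚ) →
      Σℚ (colours M) (λ u → weight u *ℚ wordSum m (λ v → Σℚ (picks v) (λ p → H (proj₁ p) (u ∷ proj₂ p)))) ≡
      fromℕ m *ℚ Σℚ (colours M) (λ u → weight u *ℚ wordSum m (H u))
    later-picks zero H = begin
      _ ≡⟨ Σ-cong (colours M) (λ u → ℚₚ.*-zeroʳ (weight u)) ⟩
      _ ≡⟨ Σ-zero (colours M) ⟩
      0ℚ ≡⟨ ℚₚ.*-zeroˡ (Σℚ (colours M) (λ u → weight u *ℚ wordSum 0 (H u))) ⟨
      _ ∎
    later-picks (suc m) H = begin
      _ ≡⟨ Σ-cong (colours M) (λ u → trans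
             (cong (weight u *ℚ_) (wordSum-picks m (λ c r → H c (u ∷ r))))
             (*-left-comm (weight u) (fromℕ (suc m)) (total u))) ⟩
      _ ≡⟨ Σ-*ˡ (colours M) (fromℕ (suc m)) (λ u → weight u *ℚ total u) ⟩
      _ ≡⟨ cong (fromℕ (suc m) *ℚ_) (begin
             Σℚ (colours M) (λ u → weight u *ℚ total u)
               ≡⟨ Σ-cong (colours M) (λ u → sym (Σ-*ˡ (colours M) (weight u) (λ c → weight c *ℚ t c u))) ⟩
             Σℚ (colours M) (λ u → Σℚ (colours M) (λ c → weight u *ℚ (weight c *ℚ t c u)))
               ≡⟨ Σ-swap (colours M) (colours M) (λ u c → weight u *ℚ (weight c *ℚ t c u)) ⟩
             Σℚ (colours M) (λ c → Σℚ (colours M) (λ u → weight u *ℚ (weight c *ℚ t c u)))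
               ≡⟨ Σ-cong (colours M) (λ c → trans
                    (Σ-cong (colours M) (λ u → *-left-comm (weight u) (weight c) (t c u)))
                    (Σ-*ˡ (colours M) (weight c) (λ u → weight u *ℚ t c u))) ⟩
             Σℚ (colours M) (λ c → weight c *ℚ wordSum (suc m) (H c)) ∎) ⟩
      _ ∎
      where
      t : Col → Col → ℚ
      t c u = wordSum m (λ r → H c (u ∷ r))
      total : Col → ℚ
      total u = Σℚ (colours M) (λ c → weight c *ℚ t c u)

  -- The factor `2 * len u` cancels the weight of the picked cycle once it is in front, so `u`
  -- enters the right-hand sum unweighted.
  wordSum-picks-len : ∀ m (G : Col → List Col → ℚ) →
    wordSum (suc m) (λ v → Σℚ (picks v) (λ p → fromℕ (2 * len (proj₁ p)) *ℚ G (proj₁ p) (proj₂ p))) ≡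
    fromℕ (suc m) *ℚ Σℚ (colours M) (λ u → wordSum m (G u))
  wordSum-picks-len m G = trans (wordSum-picks m (λ u r → fromℕ (2 * len u) *ℚ G u r))
    (cong (fromℕ (suc m) *ℚ_) (Σ-cong (colours M) (λ u →
      trans (cong (weight u *ℚ_) (wordSum-*ˡ m (fromℕ (2 * len u)) (G u))) (weight-inverse u (wordSum m (G u))))))

  -- Lengthening turns the lengths 1 to `M` into 2 to `M + 1`. The fixed points fill the gap at 1,
  -- and only the length `M + 1`, encoded by `M`, is in excess.
  telescope : ∀ (f : Col → ℚ) → (∀ ε → f (M , ε) ≡ 0ℚ) →
    Σℚ allSigns (λ ε → f (0 , ε)) +ℚ Σℚ (colours M) (f ∘ inc) ≡ Σℚ (colours M) f
  telescope f z = begin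
    g 0 +ℚ Σℚ (colours M) (f ∘ inc)  ≡⟨ cong (g 0 +ℚ_) (Σ-colours M (f ∘ inc)) ⟩
    g 0 +ℚ Σℚ (upTo M) (g ∘ suc)     ≡⟨ Σ-upTo-suc M g ⟨
    Σℚ (upTo (suc M)) g              ≡⟨ Σ-upTo-last M g ⟩
    Σℚ (upTo M) g +ℚ g M             ≡⟨ cong (Σℚ (upTo M) g +ℚ_) (trans (Σ-cong allSigns z) (Σ-zero allSigns)) ⟩
    Σℚ (upTo M) g +ℚ 0ℚ              ≡⟨ ℚₚ.+-identityʳ (Σℚ (upTo M) g) ⟩
    Σℚ (upTo M) g                    ≡⟨ Σ-colours M f ⟨
    Σℚ (colours M) f                 ∎
    where
    g : ℕ → ℚ
    g l = Σℚ allSigns (λ ε → f (l , ε))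

  module _ (D : ℕ) where

    expSum : (List Col → ℚ) → ℚ
    expSum F = Σℚ (upTo (suc D)) (λ m → inv (fact m) *ℚ wordSum m F)

    degreePart : ℕ → (List Col → ℚ) → List Col → ℚ
    degreePart n F v = 𝟙 (size v ≡ᵇ n) *ℚ F v

    degreePart-symmetric : ∀ n F → Symmetric F → Symmetric (degreePart n F)
    degreePart-symmetric n F s π = cong₂ (λ a b → 𝟙 (a ≡ᵇ n) *ℚ b) (size-↭ π) (s π)
      where
      size-↭ : ∀ {v v′} → v ↭ v′ → size v ≡ size v′
      size-↭ ↭.refl        = refl
      size-↭ (↭.prep x π)  = cong (len x +_) (size-↭ π)
      size-↭ {v′ = _ ∷ _ ∷ v′} (↭.swap x y π) = trans (sym (ℕₚ.+-assoc (len x) (len y) _))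
        (trans (cong₂ _+_ (ℕₚ.+-comm (len x) (len y)) (size-↭ π)) (ℕₚ.+-assoc (len y) (len x) (size v′)))
      size-↭ (↭.trans π ρ) = trans (size-↭ π) (size-↭ ρ)

    degreePart-big : ∀ n F v → n < size v → degreePart n F v ≡ 0ℚ
    degreePart-big n F v n<s with size v ≡ᵇ n in e
    ... | true  = ⊥-elim (ℕₚ.<-irrefl (sym (≡ᵇ⁻ (size v) n e)) n<s)
    ... | false = ℚₚ.*-zeroˡ (F v)

    -- An insertion adds exactly one letter, so the test for size `suc n` on the new word computes
    -- to the test for size `n` on `v`; for a lengthened cycle this uses the size equation of the
    -- pick.
    degreePart-insertions : ∀ n F v → degreePart n (insertions F) v ≡ insertions (degreePart (suc n) F) v
    degreePart-insertions n F v = begin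
      𝟙 (size v ≡ᵇ n) *ℚ insertions F v
        ≡⟨ ℚₚ.*-distribˡ-+ b (Σℚ allSigns (λ ε → F ((0 , ε) ∷ v))) (Σℚ (picks v) h) ⟩
      b *ℚ Σℚ allSigns (λ ε → F ((0 , ε) ∷ v)) +ℚ b *ℚ Σℚ (picks v) h
        ≡⟨ cong₂ _+ℚ_ (sym (Σ-*ˡ allSigns b (λ ε → F ((0 , ε) ∷ v)))) (sym (Σ-*ˡ (picks v) b h)) ⟩
      Σℚ allSigns (λ ε → b *ℚ F ((0 , ε) ∷ v)) +ℚ Σℚ (picks v) (λ p → b *ℚ h p)
        ≡⟨ cong (Σℚ allSigns (λ ε → b *ℚ F ((0 , ε) ∷ v)) +ℚ_)
             (Σ-picks-cong v {λ u r → b *ℚ h (u , r)} (λ u r e →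
               trans (*-left-comm b (fromℕ (2 * len u)) (F (inc u ∷ r)))
                     (cong (λ s → fromℕ (2 * len u) *ℚ (𝟙 (s ≡ᵇ n) *ℚ F (inc u ∷ r))) (sym e)))) ⟩
      insertions (degreePart (suc n) F) v ∎
      where
      b : ℚ
      b = 𝟙 (size v ≡ᵇ n)
      h : Col × List Col → ℚ
      h p = fromℕ (2 * len (proj₁ p)) *ℚ F (inc (proj₁ p) ∷ proj₂ p)

    -- Since `G` lives on words of size `suc n`, the bound by `D` removes words of more than `D`
    -- cycles and the bound by `M` removes cycles of length `M + 1`; so neither cutoff disturbs the
    -- recursion.
    expSum-insertions : ∀ n F → Symmetric F → suc n ≤ D → suc n ≤ M →
      expSum (degreePart n (insertions F)) ≡ fromℕ (2 * suc n) *ℚ expSum (degreePart (suc n) F)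
    expSum-insertions n F s n<D n<M = begin
      expSum (degreePart n (insertions F))
        ≡⟨ Σ-cong (upTo (suc D)) (λ m → cong (inv (fact m) *ℚ_)
             (trans (wordSum-cong m (λ v _ → degreePart-insertions n F v)) (wordSum-+ m fixed grown))) ⟩
      Σℚ (upTo (suc D)) (λ m → inv (fact m) *ℚ (wordSum m fixed +ℚ Z m))
        ≡⟨ split Z ⟩
      L +ℚ Σℚ (upTo (suc D)) (λ m → inv (fact m) *ℚ Z m)
        -- The cycle to be lengthened goes to the front and loses its weight; one of the `m` cycles
        -- is used up, which shifts `1 / m!`.
        ≡⟨ cong (L +ℚ_) (Σ-fact-shift D Z K refl (λ m → wordSum-picks-len m (λ u r → G (inc u ∷ r)))(vanish inc)) ⟩
      L +ℚ Σℚ (upTo (suc D)) (λ m → inv (fact m) *ℚ K m)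
        ≡⟨ split K ⟨
      Σℚ (upTo (suc D)) (λ m → inv (fact m) *ℚ (wordSum m fixed +ℚ K m))
        ≡⟨ Σ-cong (upTo (suc D)) (λ m → cong (inv (fact m) *ℚ_) (L+K m)) ⟩
      Σℚ (upTo (suc D)) (λ m → inv (fact m) *ℚ J m)
        -- The same shift, read backwards, for picks that leave the cycle as it is.
        ≡⟨ Σ-fact-shift D Z′ J refl (λ m → wordSum-picks-len m (λ u r → G (u ∷ r))) (vanish id) ⟨
      Σℚ (upTo (suc D)) (λ m → inv (fact m) *ℚ Z′ m)
        ≡⟨ Σ-cong (upTo (suc D)) (λ m → trans
             (cong (inv (fact m) *ℚ_) (trans (wordSum-cong m (λ v _ → size-G v)) (wordSum-*ˡ m (fromℕ (2 * suc n)) G)))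
             (*-left-comm (inv (fact m)) (fromℕ (2 * suc n)) (wordSum m G))) ⟩
      Σℚ (upTo (suc D)) (λ m → fromℕ (2 * suc n) *ℚ (inv (fact m) *ℚ wordSum m G))
        ≡⟨ Σ-*ˡ (upTo (suc D)) (fromℕ (2 * suc n)) (λ m → inv (fact m) *ℚ wordSum m G) ⟩
      fromℕ (2 * suc n) *ℚ expSum G ∎
      where
      G fixed grown : List Col → ℚ
      G = degreePart (suc n) F
      fixed v = Σℚ allSigns (λ ε → G ((0 , ε) ∷ v))
      grown v = Σℚ (picks v) (λ p → fromℕ (2 * len (proj₁ p)) *ℚ G (inc (proj₁ p) ∷ proj₂ p))
      Z Z′ K J : ℕ → ℚ
      Z m = wordSum m grown
      Z′ m = wordSum m (λ v → Σℚ (picks v) (λ p → fromℕ (2 * len (proj₁ p)) *ℚ G (proj₁ p ∷ proj₂ p)))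
      K m = Σℚ (colours M) (λ u → wordSum m (λ r → G (inc u ∷ r)))
      J m = Σℚ (colours M) (λ u → wordSum m (λ r → G (u ∷ r)))
      L : ℚ
      L = Σℚ (upTo (suc D)) (λ m → inv (fact m) *ℚ wordSum m fixed)
      split : ∀ (Y : ℕ → ℚ) → Σℚ (upTo (suc D)) (λ m → inv (fact m) *ℚ (wordSum m fixed +ℚ Y m)) ≡
        L +ℚ Σℚ (upTo (suc D)) (λ m → inv (fact m) *ℚ Y m)
      split Y = trans (Σ-cong (upTo (suc D)) (λ m → ℚₚ.*-distribˡ-+ (inv (fact m)) (wordSum m fixed) (Y m)))
        (Σ-+ (upTo (suc D)) (λ m → inv (fact m) *ℚ wordSum m fixed) (λ m → inv (fact m) *ℚ Y m))
      zeroes : ∀ m u → (∀ r → length r ≡ m → suc n < len u + size r) → wordSum m (λ r → G (u ∷ r)) ≡ 0ℚ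
      zeroes m u big = trans (wordSum-cong m (λ r l → degreePart-big (suc n) F (u ∷ r) (big r l))) (wordSum-zero m)
      -- The `D` cycles behind the first one already have at least `D ≥ suc n` letters.
      vanish : (g : Col → Col) → Σℚ (colours M) (λ u → wordSum D (λ r → G (g u ∷ r))) ≡ 0ℚ
      vanish g = trans (Σ-cong (colours M) (λ u → zeroes D (g u) (λ r l →
        s≤s (ℕₚ.≤-trans n<D (ℕₚ.≤-trans (ℕₚ.≤-reflexive (sym l))
          (ℕₚ.≤-trans (length≤size r) (ℕₚ.m≤n+m (size r) (proj₁ (g u))))))))) (Σ-zero (colours M))
      L+K : ∀ m → wordSum m fixed +ℚ K m ≡ J m
      L+K m = trans (cong (_+ℚ K m) (wordSum-Σ m allSigns (λ ε v → G ((0 , ε) ∷ v))))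
        (telescope (λ u → wordSum m (λ r → G (u ∷ r)))
          (λ ε → zeroes m (M , ε) (λ r _ → s≤s (ℕₚ.≤-trans n<M (ℕₚ.m≤m+n M (size r))))))
      size-G : ∀ v → Σℚ (picks v) (λ p → fromℕ (2 * len (proj₁ p)) *ℚ G (proj₁ p ∷ proj₂ p)) ≡ fromℕ (2 * suc n) *ℚ G v
      size-G v = trans (Σ-picks-size v G (degreePart-symmetric (suc n) F s)) (begin
        fromℕ (2 * size v) *ℚ (𝟙 (size v ≡ᵇ suc n) *ℚ F v)   ≡⟨ *-left-comm (fromℕ (2 * size v)) (𝟙 (size v ≡ᵇ suc n)) (F v) ⟩
        𝟙 (size v ≡ᵇ suc n) *ℚ (fromℕ (2 * size v) *ℚ F v)   ≡⟨ 𝟙-*-cong (size v ≡ᵇ suc n) (λ e → cong (λ t → fromℕ (2 * t) *ℚ F v) (≡ᵇ⁻ (size v) (suc n) e)) ⟩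
        𝟙 (size v ≡ᵇ suc n) *ℚ (fromℕ (2 * suc n) *ℚ F v)    ≡⟨ *-left-comm (𝟙 (size v ≡ᵇ suc n)) (fromℕ (2 * suc n)) (F v) ⟩
        fromℕ (2 * suc n) *ℚ G v                             ∎)

-- Insertion of a letter into a signed permutation

⌊⌋⁺ : (d : Dec P) → P → ⌊ d ⌋ ≡ true
⌊⌋⁺ (yes _) p = refl
⌊⌋⁺ (no ¬p) p = ⊥-elim (¬p p)

⌊⌋⁻ : (d : Dec P) → ⌊ d ⌋ ≡ true → P
⌊⌋⁻ (yes p) _ = p

⌊⌋-cong : (d : Dec P) (e : Dec Q) → (P → Q) → (Q → P) → ⌊ d ⌋ ≡ ⌊ e ⌋
⌊⌋-cong d e f g = ⇔-≡ (λ t → ⌊⌋⁺ e (f (⌊⌋⁻ d t))) (λ t → ⌊⌋⁺ d (g (⌊⌋⁻ e t)))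

count-cong : {p q : A → Bool} (xs : List A) → (∀ x → p x ≡ q x) → count p xs ≡ count q xs
count-cong         []       e = refl
count-cong {p = p} {q} (x ∷ xs) e with p x | q x | e x
... | true  | .true  | refl = cong suc (count-cong xs e)
... | false | .false | refl = count-cong xs e

count-none : (p : A → Bool) (xs : List A) → (∀ x → p x ≡ false) → count p xs ≡ 0
count-none p []       e = refl
count-none p (x ∷ xs) e rewrite e x = count-none p xs e

count-map : (p : B → Bool) (f : A → B) (xs : List A) → count p (map f xs) ≡ count (p ∘ f) xs
count-map p f []       = refl
count-map p f (x ∷ xs) with p (f x)
... | true  = cong suc (count-map p f xs)
... | false = count-map p f xs

count-allFin-suc : ∀ n (p : Fin (suc n) → Bool) →
  count p (allFin (suc n)) ≡ (if p fz then 1 else 0) + count (p ∘ fs) (allFin n)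
count-allFin-suc n p = trans (head (p fz) refl) (cong ((if p fz then 1 else 0) +_)
  (trans (cong (count p) (sym (map-tabulate id fs))) (count-map p fs (allFin n))))
  where
  head : ∀ b → p fz ≡ b → count p (allFin (suc n)) ≡ (if p fz then 1 else 0) + count p (tabulate fs)
  head true  e rewrite e = refl
  head false e rewrite e = refl

-- Signs acting on points, and orbits

sign-cancel : ∀ s t → s · (s · t) ≡ t
sign-cancel s t = trans (sym (Signₚ.*-assoc s s t)) (cong (_· t) (Signₚ.s*s≡+ s))

infixr 8 _∙_
_∙_ : Sign → Point n → Point n
s ∙ (t , i) = (s · t , i)

∙-cancel : ∀ s (p : Point n) → s ∙ s ∙ p ≡ p
∙-cancel s (t , i) = cong (_, i) (sign-cancel s t)

app-∙ : ∀ (w : SMap n) s p → app w (s ∙ p) ≡ s ∙ app w p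
app-∙ w s (t , i) = cong (_, proj₂ (w i)) (Signₚ.*-assoc s t (proj₁ (w i)))

iter-∙ : ∀ (w : SMap n) m s p → iter w m (s ∙ p) ≡ s ∙ iter w m p
iter-∙ w zero    s p = refl
iter-∙ w (suc m) s p = trans (cong (app w) (iter-∙ w m s p)) (app-∙ w s (iter w m p))

iter-+ : ∀ (w : SMap n) a b p → iter w (a + b) p ≡ iter w a (iter w b p)
iter-+ w zero    b p = refl
iter-+ w (suc a) b p = cong (app w) (iter-+ w a b p)

iter-comm : ∀ (w : SMap n) a b p → iter w a (iter w b p) ≡ iter w b (iter w a p)
iter-comm w a b p = trans (sym (iter-+ w a b p)) (trans (cong (λ m → iter w m p) (ℕₚ.+-comm a b)) (iter-+ w b a p))

orb : SMap n → ℕ → Fin n → Fin n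
orb w m i = proj₂ (iter w m (⊕ , i))

orb-iter : ∀ (w : SMap n) m p → proj₂ (iter w m p) ≡ orb w m (proj₂ p)
orb-iter w m (s , i) = cong proj₂ (trans
  (cong (λ t → iter w m (t , i)) (sym (Signₚ.*-identityʳ s))) (iter-∙ w m s (⊕ , i)))

orb-+ : ∀ (w : SMap n) a b i → orb w (a + b) i ≡ orb w a (orb w b i)
orb-+ w a b i = trans (cong proj₂ (iter-+ w a b (⊕ , i))) (orb-iter w a (iter w b (⊕ , i)))

orb-comm : ∀ (w : SMap n) a b i → orb w a (orb w b i) ≡ orb w b (orb w a i)
orb-comm w a b i = trans (sym (orb-+ w a b i)) (trans (cong (λ m → orb w m i) (ℕₚ.+-comm a b)) (orb-+ w b a i))

-- `minimal` speaks of indices, that is, of absolute values, so `len u` is the signed length for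
-- both classes; the class is the sign with which the index first recurs.
record Returns (w : SMap n) (i : Fin n) (u : Col) : Set where
  constructor returns
  field
    back    : iter w (len u) (⊕ , i) ≡ (proj₂ u , i)
    minimal : ∀ m → 0 < m → m < len u → orb w m i ≢ i

open Returns

-- Iteration commutes with signs: the sign `t` collected on the way from `i` to `j` enters twice and
-- cancels, so the class is the same. The way back `b` carries an early return at `j` over to one at
-- `i`.
Returns-rotate : ∀ {w : SMap n} {i j u} a b → Returns w i u → orb w a i ≡ j → orb w b j ≡ i → Returns w j u
Returns-rotate {w = w} {i} {_} {u@(_ , ε)} a b R refl bj = record { back = back′ ; minimal = minimal′ }
  where
  t : Sign
  t = proj₁ (iter w a (⊕ , i))
  j : Fin _
  j = orb w a i
  fromi : (⊕ , j) ≡ t ∙ iter w a (⊕ , i)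
  fromi = cong (_, j) (sym (Signₚ.s*s≡+ t))
  back′ : iter w (len u) (⊕ , j) ≡ (ε , j)
  back′ = begin
    iter w (len u) (⊕ , j)                     ≡⟨ cong (iter w (len u)) fromi ⟩
    iter w (len u) (t ∙ iter w a (⊕ , i))      ≡⟨ iter-∙ w (len u) t _ ⟩
    t ∙ iter w (len u) (iter w a (⊕ , i))      ≡⟨ cong (t ∙_) (iter-comm w (len u) a (⊕ , i)) ⟩
    t ∙ iter w a (iter w (len u) (⊕ , i))      ≡⟨ cong (λ p → t ∙ iter w a p) (trans (back R) (cong (_, i) (sym (Signₚ.*-identityʳ ε)))) ⟩
    t ∙ iter w a (ε ∙ (⊕ , i))                 ≡⟨ cong (t ∙_) (iter-∙ w a ε (⊕ , i)) ⟩
    (t · (ε · t) , j)                          ≡⟨ cong (λ s → t · s , j) (Signₚ.*-comm ε t) ⟩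
    (t · (t · ε) , j)                          ≡⟨ cong (_, j) (sign-cancel t ε) ⟩
    (ε , j)                                    ∎
  minimal′ : ∀ m → 0 < m → m < len u → orb w m j ≢ j
  minimal′ m 0<m m<l e = minimal R m 0<m m<l (begin
    orb w m i           ≡⟨ cong (orb w m) (sym bj) ⟩
    orb w m (orb w b j) ≡⟨ orb-comm w m b j ⟩
    orb w b (orb w m j) ≡⟨ cong (orb w b) e ⟩
    orb w b j           ≡⟨ bj ⟩
    i                   ∎)

-- The representative is taken between 1 and `len u` rather than from 0 on, since `iter-new` follows
-- an inserted letter for exactly these numbers of steps.
Returns-reduce : ∀ {w : SMap n} {i u} → Returns w i u → ∀ m →
  ∃ λ m′ → 0 < m′ × m′ ≤ len u × orb w m′ i ≡ orb w m i
Returns-reduce {u = u} R zero = len u , s≤s z≤n , ℕₚ.≤-refl , cong proj₂ (back R)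
Returns-reduce {w = w} {i} {u} R (suc m) with Returns-reduce R m
... | m′ , 0<m′ , m′≤l , e with m′ ℕₚ.≟ len u
...   | no  m′≢l = suc m′ , s≤s z≤n , ℕₚ.≤∧≢⇒< m′≤l m′≢l , cong (λ j → proj₂ (w j)) e
...   | yes refl = 1 , s≤s z≤n , s≤s z≤n , cong (λ j → proj₂ (w j)) (trans (sym (cong proj₂ (back R))) e)

-- cl i is the cycle through ±(i + 1).
record Cycles (w : SMap n) : Set where
  field
    {number} : ℕ
    cols  : Vec Col number
    cl    : Fin n → Fin number
  colour : Fin n → Col
  colour i = lookup cols (cl i)
  field
    count-cl : ∀ c → count (λ j → ⌊ cl j ≟F c ⌋) (allFin n) ≡ len (lookup cols c)
    stay     : ∀ i → cl (proj₂ (w i)) ≡ cl i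
    returning : ∀ i → Returns w i (colour i)
    hit      : ∀ i j → cl i ≡ cl j → ∃ λ m → orb w m i ≡ j

  stay-iter : ∀ m p → cl (proj₂ (iter w m p)) ≡ cl (proj₂ p)
  stay-iter zero    p = refl
  stay-iter (suc m) p = trans (stay (proj₂ (iter w m p))) (stay-iter m p)

up : Point n → Point (suc n)
up (s , i) = (s , fs i)

-- p is the preimage of +1 (index fz) in the new element.
insert : SMap n → Point (suc n) → SMap (suc n)
insert w (s , fz)   fz     = (s , fz)
insert w (s , fz)   (fs j) = up (w j)
insert w (s , fs i) fz     = s ∙ up (w i)
insert w (s , fs i) (fs j) = if ⌊ j ≟F i ⌋ then (s , fz) else up (w j)

insert-at : ∀ (w : SMap n) s i → insert w (s , fs i) (fs i) ≡ (s , fz)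
insert-at w s i rewrite ⌊⌋⁺ (i ≟F i) refl = refl

insert-off : ∀ (w : SMap n) s i {j} → j ≢ i → insert w (s , fs i) (fs j) ≡ up (w j)
insert-off w s i {j} j≢i with j ≟F i
... | yes j≡i = ⊥-elim (j≢i j≡i)
... | no  _   = refl

module _ {w : SMap n} (C : Cycles w) where
  open Cycles C

  insertCycles-fixed : ∀ s → Cycles (insert w (s , fz))
  insertCycles-fixed s = record
    { cols      = (0 , s) Vec.∷ cols
    ; cl        = cl′
    ; count-cl  = count-cl′
    ; stay      = λ { fz → refl ; (fs i) → cong fs (stay i) }
    ; returning = returning′
    ; hit       = hit′
    }
    where
    cl′ : Fin (suc n) → Fin (suc number)
    cl′ fz     = fz
    cl′ (fs j) = fs (cl j)
    iter-up : ∀ m p → iter (insert w (s , fz)) m (up p) ≡ up (iter w m p)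
    iter-up zero    p = refl
    iter-up (suc m) p = cong (app (insert w (s , fz))) (iter-up m p)
    count-cl′ : ∀ c → count (λ j → ⌊ cl′ j ≟F c ⌋) (allFin (suc n)) ≡ len (lookup ((0 , s) Vec.∷ cols) c)
    count-cl′ fz     = trans (count-allFin-suc n (λ j → ⌊ cl′ j ≟F fz ⌋))
      (cong suc (count-none (λ j → ⌊ fs (cl j) ≟F fz ⌋) (allFin n) (λ _ → refl)))
    count-cl′ (fs c) = trans (count-allFin-suc n (λ j → ⌊ cl′ j ≟F fs c ⌋)) (trans
      (count-cong (allFin n) (λ j → ⌊⌋-cong (fs (cl j) ≟F fs c) (cl j ≟F c) suc-injective (cong fs)))
      (count-cl c))
    returning′ : ∀ i → Returns (insert w (s , fz)) i (lookup ((0 , s) Vec.∷ cols) (cl′ i))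
    returning′ fz     = record { back = refl ; minimal = λ { (suc m) _ (s≤s ()) } }
    returning′ (fs i) = record
      { back    = trans (iter-up (len (colour i)) (⊕ , i)) (cong up (back (returning i)))
      ; minimal = λ m a b e → minimal (returning i) m a b
                    (suc-injective (trans (sym (cong proj₂ (iter-up m (⊕ , i)))) e)) }
    hit′ : ∀ i j → cl′ i ≡ cl′ j → ∃ λ m → orb (insert w (s , fz)) m i ≡ j
    hit′ fz     fz     _ = 0 , refl
    hit′ (fs i) (fs j) e = let (m , q) = hit i j (suc-injective e) in
      m , trans (cong proj₂ (iter-up m (⊕ , i))) (cong fs q)

  module _ (s : Sign) (i : Fin n) where
    private
      W : SMap (suc n)
      W = insert w (s , fs i)
      u : Col
      u = colour i
      cols′ : Vec Col number
      cols′ = updateAt cols (cl i) inc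
      cl′ : Fin (suc n) → Fin number
      cl′ fz     = cl i
      cl′ (fs j) = cl j

      app-up : ∀ p → proj₂ p ≢ i → app W (up p) ≡ up (app w p)
      app-up (t , j) j≢i rewrite insert-off w s i j≢i = refl

      iter-up : ∀ m p → cl (proj₂ p) ≢ cl i → iter W m (up p) ≡ up (iter w m p)
      iter-up zero    p ne = refl
      iter-up (suc m) p ne = trans (cong (app W) (iter-up m p ne))
        (app-up (iter w m p) (λ e → ne (trans (sym (stay-iter m p)) (cong cl e))))

      -- The inserted letter leaves along the old image of `i`, with the sign `s`. By minimality the
      -- orbit then avoids `i`, the only old index whose image was changed, until `len u` steps are
      -- done.
      iter-new : ∀ m → 0 < m → m ≤ len u → iter W m (⊕ , fz) ≡ s ∙ up (iter w m (⊕ , i))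
      iter-new (suc zero)    _ _ = refl
      iter-new (suc (suc m)) _ l = begin
        app W (iter W (suc m) (⊕ , fz))          ≡⟨ cong (app W) (iter-new (suc m) (s≤s z≤n) (ℕₚ.<⇒≤ l)) ⟩
        app W (s ∙ up (iter w (suc m) (⊕ , i)))  ≡⟨ app-∙ W s (up (iter w (suc m) (⊕ , i))) ⟩
        s ∙ app W (up (iter w (suc m) (⊕ , i)))  ≡⟨ cong (s ∙_) (app-up (iter w (suc m) (⊕ , i)) (minimal (returning i) (suc m) (s≤s z≤n) l)) ⟩
        s ∙ up (iter w (suc (suc m)) (⊕ , i))    ∎

      returning-new : Returns W fz (inc u)
      returning-new = record { back = back′ ; minimal = λ { m 0<m (s≤s m≤l) e → new≢old m 0<m m≤l e } }
        where
        new≢old : ∀ m → 0 < m → m ≤ len u → orb W m fz ≢ fz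
        new≢old m 0<m m≤l e with trans (sym e) (cong proj₂ (iter-new m 0<m m≤l))
        ... | ()
        back′ : iter W (len (inc u)) (⊕ , fz) ≡ (proj₂ u , fz)
        back′ = begin
          app W (iter W (len u) (⊕ , fz))         ≡⟨ cong (app W) (iter-new (len u) (s≤s z≤n) ℕₚ.≤-refl) ⟩
          app W (s ∙ up (iter w (len u) (⊕ , i))) ≡⟨ cong (λ p → app W (s ∙ up p)) (back (returning i)) ⟩
          app W ((s · proj₂ u) , fs i)            ≡⟨ cong ((s · proj₂ u) ∙_) (insert-at w s i) ⟩
          -- The sign `s` is met twice, on leaving the new letter and on entering it, so the class
          -- of the cycle does not change.
          ((s · proj₂ u) · s , fz)                ≡⟨ cong (_, fz) (trans (cong (_· s) (Signₚ.*-comm s (proj₂ u)))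
                                                       (trans (Signₚ.*-assoc (proj₂ u) s s)
                                                       (trans (cong (proj₂ u ·_) (Signₚ.s*s≡+ s)) (Signₚ.*-identityʳ (proj₂ u))))) ⟩
          (proj₂ u , fz)                          ∎

      -- The letters of the grown cycle get their returns from the new letter through
      -- `Returns-rotate`, which asks for ways in both directions; the way back is the rest of the
      -- full turn of `len u + 1` steps.
      reach : ∀ x → cl′ x ≡ cl i → ∃ λ a → ∃ λ b → orb W a fz ≡ x × orb W b x ≡ fz
      reach fz     _ = 0 , 0 , refl , refl
      reach (fs j) e =
        let (m , q) = hit i j (sym e)
            (a , 0<a , a≤l , q′) = Returns-reduce (returning i) m
            there′ = trans (cong proj₂ (iter-new a 0<a a≤l)) (cong fs (trans q′ q))
        in a , len (inc u) ∸ a , there′ , (begin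
             orb W (len (inc u) ∸ a) (fs j)          ≡⟨ cong (orb W (len (inc u) ∸ a)) there′ ⟨
             orb W (len (inc u) ∸ a) (orb W a fz)    ≡⟨ orb-+ W (len (inc u) ∸ a) a fz ⟨
             orb W (len (inc u) ∸ a + a) fz          ≡⟨ cong (λ m → orb W m fz) (ℕₚ.m∸n+n≡m (ℕₚ.m≤n⇒m≤1+n a≤l)) ⟩
             orb W (len (inc u)) fz                  ≡⟨ cong proj₂ (back returning-new) ⟩
             fz                                      ∎)

    insertCycles-grown : Cycles W
    insertCycles-grown = record
      { cols      = cols′
      ; cl        = cl′
      ; count-cl  = count-cl′
      ; stay      = stay′
      ; returning = returning′
      ; hit       = hit′
      }
      where
      count-cl′ : ∀ c → count (λ j → ⌊ cl′ j ≟F c ⌋) (allFin (suc n)) ≡ len (lookup cols′ c)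
      count-cl′ c = trans (count-allFin-suc n (λ j → ⌊ cl′ j ≟F c ⌋))
        (trans (cong ((if ⌊ cl i ≟F c ⌋ then 1 else 0) +_) (count-cl c)) here′)
        where
        here′ : (if ⌊ cl i ≟F c ⌋ then 1 else 0) + len (lookup cols c) ≡ len (lookup cols′ c)
        here′ with cl i ≟F c
        ... | yes refl = sym (cong len (lookup∘updateAt (cl i) cols))
        ... | no  ne   = sym (cong len (lookup∘updateAt′ c (cl i) (ne ∘ sym) cols))
      stay′ : ∀ x → cl′ (proj₂ (W x)) ≡ cl′ x
      stay′ fz     = stay i
      stay′ (fs j) with j ≟F i
      ... | yes refl = refl
      ... | no  _    = stay j
      in-class : ∀ x → cl′ x ≡ cl i → Returns W x (lookup cols′ (cl′ x))
      in-class x e = subst (Returns W x) (sym (trans (cong (lookup cols′) e) (lookup∘updateAt (cl i) cols)))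
        (let (a , b , p , q) = reach x e in Returns-rotate a b returning-new p q)
      returning′ : ∀ x → Returns W x (lookup cols′ (cl′ x))
      returning′ fz = in-class fz refl
      returning′ (fs j) with cl j ≟F cl i
      ... | yes e = in-class (fs j) e
      ... | no ne = subst (Returns W (fs j)) (sym (lookup∘updateAt′ (cl j) (cl i) ne cols)) (record
        { back    = trans (iter-up (len (colour j)) (⊕ , j) ne) (cong up (back (returning j)))
        ; minimal = λ m a b e → minimal (returning j) m a b
                    (suc-injective (trans (sym (cong proj₂ (iter-up m (⊕ , j) ne))) e)) })
      hit-class : ∀ x y → cl′ x ≡ cl i → cl′ x ≡ cl′ y → ∃ λ m → orb W m x ≡ y
      hit-class x y e f =
        let (_ , b , _ , q) = reach x e
            (a , _ , p , _) = reach y (trans (sym f) e)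
        in a + b , trans (orb-+ W a b x) (trans (cong (orb W a) q) p)
      hit′ : ∀ x y → cl′ x ≡ cl′ y → ∃ λ m → orb W m x ≡ y
      hit′ fz     y f = hit-class fz y refl f
      hit′ (fs j) fz f = hit-class (fs j) fz f f
      hit′ (fs j) (fs k) f with cl j ≟F cl i
      ... | yes e = hit-class (fs j) (fs k) e f
      ... | no ne = let (m , q) = hit j k f in m , trans (cong proj₂ (iter-up m (⊕ , j) ne)) (cong fs q)

insertCycles : {w : SMap n} → Cycles w → ∀ p → Cycles (insert w p)
insertCycles C (s , fz)   = insertCycles-fixed C s
insertCycles C (s , fs i) = insertCycles-grown C s i

noCycles : Cycles {0} (λ ())
noCycles = record { cols = Vec.[] ; cl = λ () ; count-cl = λ () ; stay = λ () ; returning = λ () ; hit = λ () }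

-- The cycle data of an element is built up along its insertions instead of being extracted from its
-- orbits.
enum : ∀ n → List (Σ (SMap n) Cycles)
enum zero    = ((λ ()) , noCycles) ∷ []
enum (suc n) = concatMap (λ wC → map (λ p → insert (proj₁ wC) p , insertCycles (proj₂ wC) p) (allPoints (suc n))) (enum n)

Σ-enum-suc : ∀ n (f : Σ (SMap (suc n)) Cycles → ℚ) → Σℚ (enum (suc n)) f ≡
  Σℚ (enum n) (λ wC → Σℚ (allPoints (suc n)) (λ p → f (insert (proj₁ wC) p , insertCycles (proj₂ wC) p)))
Σ-enum-suc n f = trans (Σ-concatMap _ (enum n) f) (Σ-cong (enum n) (λ wC →
  Σ-map (λ p → insert (proj₁ wC) p , insertCycles (proj₂ wC) p) (allPoints (suc n)) f))

-- Enumeration of B_n by insertion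

==S⁻ : ∀ s t → s ==S t ≡ true → s ≡ t
==S⁻ s t = ⌊⌋⁻ (s Signₚ.≟ t)

==S-refl : ∀ s → s ==S s ≡ true
==S-refl s = ⌊⌋⁺ (s Signₚ.≟ s) refl

==P⁻ : ∀ (p q : Point n) → p ==P q ≡ true → p ≡ q
==P⁻ (s , i) (t , j) e = let (a , b) = ∧-split (s ==S t) e in cong₂ _,_ (==S⁻ s t a) (⌊⌋⁻ (i ≟F j) b)

==P-refl : ∀ (p : Point n) → p ==P p ≡ true
==P-refl (s , i) = cong₂ _∧_ (==S-refl s) (⌊⌋⁺ (i ≟F i) refl)

Σ-allFin-≟ : ∀ {n} (i : Fin n) (f : Fin n → ℚ) → Σℚ (allFin n) (λ j → 𝟙 ⌊ i ≟F j ⌋ *ℚ f j) ≡ f i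
Σ-allFin-≟ {suc n} fz f = begin
  _ ≡⟨ Σ-allFin-suc n (λ j → 𝟙 ⌊ fz ≟F j ⌋ *ℚ f j) ⟩
  1ℚ *ℚ f fz +ℚ Σℚ (allFin n) (λ j → 0ℚ *ℚ f (fs j))
    ≡⟨ cong₂ _+ℚ_ (ℚₚ.*-identityˡ (f fz)) (trans (Σ-cong (allFin n) (λ j → ℚₚ.*-zeroˡ (f (fs j)))) (Σ-zero (allFin n))) ⟩
  f fz +ℚ 0ℚ ≡⟨ ℚₚ.+-identityʳ (f fz) ⟩
  f fz ∎
Σ-allFin-≟ {suc n} (fs i) f = begin
  _ ≡⟨ Σ-allFin-suc n (λ j → 𝟙 ⌊ fs i ≟F j ⌋ *ℚ f j) ⟩
  0ℚ *ℚ f fz +ℚ Σℚ (allFin n) (λ j → 𝟙 ⌊ fs i ≟F fs j ⌋ *ℚ f (fs j))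
    ≡⟨ cong₂ _+ℚ_ (ℚₚ.*-zeroˡ (f fz)) (Σ-cong (allFin n) (λ j → cong (λ b → 𝟙 b *ℚ f (fs j))
         (⌊⌋-cong (fs i ≟F fs j) (i ≟F j) suc-injective (cong fs)))) ⟩
  0ℚ +ℚ Σℚ (allFin n) (λ j → 𝟙 ⌊ i ≟F j ⌋ *ℚ f (fs j))
    ≡⟨ ℚₚ.+-identityˡ (Σℚ (allFin n) (λ j → 𝟙 ⌊ i ≟F j ⌋ *ℚ f (fs j))) ⟩
  Σℚ (allFin n) (λ j → 𝟙 ⌊ i ≟F j ⌋ *ℚ f (fs j)) ≡⟨ Σ-allFin-≟ i (f ∘ fs) ⟩
  f (fs i) ∎

Σ-signs-== : ∀ s (f : Sign → ℚ) → Σℚ allSigns (λ t → 𝟙 (s ==S t) *ℚ f t) ≡ f s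
Σ-signs-== ⊕ f = begin
  1ℚ *ℚ f ⊕ +ℚ (0ℚ *ℚ f ⊖ +ℚ 0ℚ) ≡⟨ cong₂ _+ℚ_ (ℚₚ.*-identityˡ (f ⊕)) (trans (ℚₚ.+-identityʳ (0ℚ *ℚ f ⊖)) (ℚₚ.*-zeroˡ (f ⊖))) ⟩
  f ⊕ +ℚ 0ℚ                      ≡⟨ ℚₚ.+-identityʳ (f ⊕) ⟩
  f ⊕                            ∎
Σ-signs-== ⊖ f = begin
  0ℚ *ℚ f ⊕ +ℚ (1ℚ *ℚ f ⊖ +ℚ 0ℚ) ≡⟨ cong₂ _+ℚ_ (ℚₚ.*-zeroˡ (f ⊕)) (trans (ℚₚ.+-identityʳ (1ℚ *ℚ f ⊖)) (ℚₚ.*-identityˡ (f ⊖))) ⟩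
  0ℚ +ℚ f ⊖                      ≡⟨ ℚₚ.+-identityˡ (f ⊖) ⟩
  f ⊖                            ∎

Σ-points : ∀ (f : Point n → ℚ) →
  Σℚ (allPoints n) f ≡ Σℚ allSigns (λ s → Σℚ (allFin n) (λ i → f (s , i)))
Σ-points f = Σ-cartesianProduct allSigns (allFin _) f

Σ-points-== : ∀ (p : Point n) → Σℚ (allPoints n) (λ q → 𝟙 (p ==P q)) ≡ 1ℚ
Σ-points-== {n} (s , i) = begin
  _ ≡⟨ Σ-points (λ q → 𝟙 ((s , i) ==P q)) ⟩
  Σℚ allSigns (λ t → Σℚ (allFin n) (λ j → 𝟙 ((s ==S t) ∧ ⌊ i ≟F j ⌋)))
    ≡⟨ Σ-cong allSigns (λ t → trans
         (Σ-cong (allFin n) (λ j → trans (cong 𝟙 (Data.Bool.Properties.∧-comm (s ==S t) ⌊ i ≟F j ⌋)) (𝟙-∧ ⌊ i ≟F j ⌋ (s ==S t))))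
         (trans (Σ-allFin-≟ i (λ _ → 𝟙 (s ==S t))) (sym (ℚₚ.*-identityʳ (𝟙 (s ==S t)))))) ⟩
  Σℚ allSigns (λ t → 𝟙 (s ==S t) *ℚ 1ℚ) ≡⟨ Σ-signs-== s (λ _ → 1ℚ) ⟩
  1ℚ ∎
  where import Data.Bool.Properties

∈-allSigns : ∀ s → s ∈ allSigns
∈-allSigns ⊕ = here refl
∈-allSigns ⊖ = there (here refl)

∈-allPoints : ∀ (p : Point n) → p ∈ allPoints n
∈-allPoints (s , i) = ∈-cartesianProduct⁺ (∈-allSigns s) (∈-allFin i)

or-map⁻ : (p : A → Bool) (xs : List A) → or (map p xs) ≡ true → ∃ λ x → p x ≡ true
or-map⁻ p (x ∷ xs) e with p x in q
... | true  = x , q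
... | false = or-map⁻ p xs e

or-map⁺ : (p : A → Bool) {xs : List A} {x : A} → x ∈ xs → p x ≡ true → or (map p xs) ≡ true
or-map⁺ p (here refl) e rewrite e = refl
or-map⁺ p {y ∷ _} (there x∈) e with p y
... | true  = refl
... | false = or-map⁺ p x∈ e

-- The test `_==M_` with the codomain freed from the domain, as induction over the domain requires.
funEq : (Fin n → Point m) → (Fin n → Point m) → Bool
funEq f g = and (map (λ i → f i ==P g i) (allFin _))

funEq⁻ : ∀ (f g : Fin n → Point m) → funEq f g ≡ true → ∀ i → f i ≡ g i
funEq⁻ f g e i = ==P⁻ (f i) (g i) (All.lookup (and-map⁻ (λ i → f i ==P g i) e) (∈-allFin i))

funEq⁺ : ∀ (f g : Fin n → Point m) → (∀ i → f i ≡ g i) → funEq f g ≡ true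
funEq⁺ {n} f g e = and-map⁺ (λ i → f i ==P g i) {allFin n}
  (All.tabulate (λ {i} _ → trans (cong (_==P g i) (e i)) (==P-refl (g i))))

-- `funs` extends a function by a pattern-matching lambda. The hypothesis speaks of every `h` with
-- the right values, so this lambda never has to be named.
Σ-funs-suc : ∀ n (xs : List A) (F : (Fin (suc n) → A) → ℚ) (G : A → (Fin n → A) → ℚ) →
  (∀ h x f → h fz ≡ x → (∀ i → h (fs i) ≡ f i) → F h ≡ G x f) →
  Σℚ (funs (suc n) xs) F ≡ Σℚ xs (λ x → Σℚ (funs n xs) (G x))
Σ-funs-suc n xs F G e = trans (Σ-concatMap _ xs F) (Σ-cong xs (λ x → trans
  (Σ-map _ (funs n xs) F) (Σ-cong (funs n xs) (λ f → e _ x f refl (λ _ → refl)))))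

Σ-funs : ∀ n (g : Fin n → Point m) → Σℚ (funs n (allPoints m)) (λ f → 𝟙 (funEq f g)) ≡ 1ℚ
Σ-funs zero    g = refl
Σ-funs {m} (suc n) g = begin
  _ ≡⟨ Σ-funs-suc n (allPoints m) (λ f → 𝟙 (funEq f g)) (λ p f → 𝟙 (g fz ==P p) *ℚ 𝟙 (funEq f (g ∘ fs)))
         (λ h p f h₀ h₊ → trans (cong 𝟙 (split h p f h₀ h₊)) (𝟙-∧ (g fz ==P p) (funEq f (g ∘ fs)))) ⟩
  Σℚ (allPoints m) (λ p → Σℚ (funs n (allPoints m)) (λ f → 𝟙 (g fz ==P p) *ℚ 𝟙 (funEq f (g ∘ fs))))
    ≡⟨ Σ-cong (allPoints m) (λ p → trans (Σ-*ˡ (funs n (allPoints m)) (𝟙 (g fz ==P p)) (λ f → 𝟙 (funEq f (g ∘ fs))))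
         (trans (cong (𝟙 (g fz ==P p) *ℚ_) (Σ-funs n (g ∘ fs))) (ℚₚ.*-identityʳ (𝟙 (g fz ==P p))))) ⟩
  Σℚ (allPoints m) (λ p → 𝟙 (g fz ==P p)) ≡⟨ Σ-points-== (g fz) ⟩
  1ℚ ∎
  where
  split : ∀ (h : Fin (suc n) → Point m) p f → h fz ≡ p → (∀ i → h (fs i) ≡ f i) →
    funEq h g ≡ (g fz ==P p) ∧ funEq f (g ∘ fs)
  split h p f h₀ h₊ = ⇔-≡
    (λ e → let k = funEq⁻ h g e in cong₂ _∧_
      (trans (cong (g fz ==P_) (trans (sym h₀) (k fz))) (==P-refl (g fz)))
      (funEq⁺ f (g ∘ fs) (λ i → trans (sym (h₊ i)) (k (fs i)))))
    (λ e → let (a , b) = ∧-split (g fz ==P p) e in funEq⁺ h g (λ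
      { fz → trans h₀ (sym (==P⁻ (g fz) p a)) ; (fs i) → trans (h₊ i) (funEq⁻ f (g ∘ fs) b i) }))

-- Invertible signed maps

_LeftInverseOf_ : SMap n → SMap n → Set
v LeftInverseOf w = ∀ i → app v (w i) ≡ (⊕ , i)

leftInverse-app : ∀ {v w : SMap n} → v LeftInverseOf w → ∀ p → app v (app w p) ≡ p
leftInverse-app {v = v} {w} inv (s , i) = begin
  app v (s ∙ w i) ≡⟨ app-∙ v s (w i) ⟩
  s ∙ app v (w i) ≡⟨ cong (s ∙_) (inv i) ⟩
  (s · ⊕ , i)     ≡⟨ cong (_, i) (Signₚ.*-identityʳ s) ⟩
  (s , i)         ∎

record Invertible (w : SMap n) : Set where
  constructor invertible
  field
    inverse : SMap n
    left  : inverse LeftInverseOf w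
    right : w LeftInverseOf inverse

open Invertible

Invertible-cong : ∀ {v w : SMap n} → (∀ i → v i ≡ w i) → Invertible w → Invertible v
Invertible-cong {v = v} {w} e I = record
  { inverse = inverse I
  ; left    = λ i → trans (cong (app (inverse I)) (e i)) (left I i)
  ; right   = λ i → trans (app-cong (inverse I i)) (right I i) }
  where
  app-cong : ∀ p → app v p ≡ app w p
  app-cong (s , i) = cong (s ∙_) (e i)

module _ (w : SMap n) where
  private
    noCollision : Point n → Point n → Bool
    noCollision p q = not (app w p ==P app w q) ∨ (p ==P q)
    noCollisions : Point n → Bool
    noCollisions p = and (map (noCollision p) (allPoints n))
    attained : Point n → Bool
    attained q = or (map (λ p → app w p ==P q) (allPoints n))

  -- Surjectivity selects preimages of the positive points, which form a right inverse; injectivity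
  -- makes it a left inverse too.
  isBijection⁻ : isBijection w ≡ true → Invertible w
  isBijection⁻ e = record
    { inverse = v
    ; left    = λ i → inj _ _ (leftInverse-app {v = w} {v} (λ k → proj₂ (surj (⊕ , k))) (w i))
    ; right   = λ k → proj₂ (surj (⊕ , k)) }
    where
    e₁ : and (map noCollisions (allPoints n)) ≡ true
    e₁ = proj₁ (∧-split (and (map noCollisions (allPoints n))) e)
    e₂ : and (map attained (allPoints n)) ≡ true
    e₂ = proj₂ (∧-split (and (map noCollisions (allPoints n))) e)
    modus : ∀ b {c} → b ≡ true → not b ∨ c ≡ true → c ≡ true
    modus true refl f = f
    inj : ∀ p q → app w p ≡ app w q → p ≡ q
    inj p q f = ==P⁻ p q (modus (app w p ==P app w q)
      (trans (cong (app w p ==P_) (sym f)) (==P-refl (app w p)))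
      (All.lookup (and-map⁻ (noCollision p) {allPoints n}
        (All.lookup (and-map⁻ noCollisions e₁) (∈-allPoints p))) (∈-allPoints q)))
    surj : ∀ q → ∃ λ p → app w p ≡ q
    surj q =
      let (p , f) = or-map⁻ (λ p → app w p ==P q) (allPoints n)
            (All.lookup (and-map⁻ attained e₂) (∈-allPoints q))
      in p , ==P⁻ (app w p) q f
    v : SMap n
    v k = proj₁ (surj (⊕ , k))

  isBijection⁺ : Invertible w → isBijection w ≡ true
  isBijection⁺ I = cong₂ _∧_
    (and-map⁺ noCollisions {allPoints n} (All.tabulate (λ {p} _ →
      and-map⁺ (noCollision p) {allPoints n} (All.tabulate (λ {q} _ → injective p q)))))
    (and-map⁺ attained {allPoints n} (All.tabulate (λ {q} _ →
      or-map⁺ (λ p → app w p ==P q) (∈-allPoints (app (inverse I) q))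
        (trans (cong (_==P q) (leftInverse-app {v = w} {inverse I} (right I) q)) (==P-refl q)))))
    where
    injective : ∀ p q → noCollision p q ≡ true
    injective p q with app w p ==P app w q in e
    ... | false = refl
    ... | true  = trans (cong (_==P q) p≡q) (==P-refl q)
      where
      p≡q : p ≡ q
      p≡q = trans (sym (leftInverse-app {v = inverse I} {w} (left I) p))
        (trans (cong (app (inverse I)) (==P⁻ (app w p) (app w q) e)) (leftInverse-app {v = inverse I} {w} (left I) q))

-- For a cycle of length l, two full turns restore the sign whichever the class, so 2 l - 1 steps
-- invert one step. This number depends on the cycle only, hence by `stay` it is the same for `i`
-- and its image.
Cycles⇒Invertible : {w : SMap n} → Cycles w → Invertible w
Cycles⇒Invertible {n} {w} C = record
  { inverse = λ i → iter w (before i) (⊕ , i)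
  ; left    = λ i → begin
      (proj₁ (w i) · proj₁ (iter w (before (proj₂ (w i))) (⊕ , proj₂ (w i))) , _)
        ≡⟨ iter-∙ w (before (proj₂ (w i))) (proj₁ (w i)) (⊕ , proj₂ (w i)) ⟨
      iter w (before (proj₂ (w i))) (proj₁ (w i) ∙ (⊕ , proj₂ (w i)))
        ≡⟨ cong₂ (λ m s → iter w m (s , proj₂ (w i))) (cong (λ c → double (proj₁ (lookup cols c))) (stay i)) (Signₚ.*-identityʳ (proj₁ (w i))) ⟩
      iter w (before i) (app w (⊕ , i))
        ≡⟨ iter-comm w (before i) 1 (⊕ , i) ⟩
      app w (iter w (before i) (⊕ , i))
        ≡⟨ twice i ⟩
      (⊕ , i) ∎
  ; right   = twice }
  where
  open Cycles C
  double : ℕ → ℕ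
  double l = l + suc l
  before : Fin n → ℕ
  before i = double (proj₁ (colour i))
  twice : ∀ i → iter w (suc (before i)) (⊕ , i) ≡ (⊕ , i)
  twice i = begin
    iter w (l + l) (⊕ , i)          ≡⟨ iter-+ w l l (⊕ , i) ⟩
    iter w l (iter w l (⊕ , i))     ≡⟨ cong (iter w l) (trans (Returns.back (returning i)) (cong (_, i) (sym (Signₚ.*-identityʳ ε)))) ⟩
    iter w l (ε ∙ (⊕ , i))          ≡⟨ iter-∙ w l ε (⊕ , i) ⟩
    ε ∙ iter w l (⊕ , i)            ≡⟨ cong (ε ∙_) (Returns.back (returning i)) ⟩
    (ε · ε , i)                     ≡⟨ cong (_, i) (Signₚ.s*s≡+ ε) ⟩
    (⊕ , i)                         ∎
    where
    l = len (colour i)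
    ε = proj₂ (colour i)

up-injective : ∀ {p q : Point n} → up p ≡ up q → p ≡ q
up-injective {p = s , i} {t , .i} refl = refl

insert-cong : ∀ {w w′ : SMap n} p → (∀ i → w i ≡ w′ i) → ∀ x → insert w p x ≡ insert w′ p x
insert-cong (s , fz)   e fz     = refl
insert-cong (s , fz)   e (fs j) = cong up (e j)
insert-cong (s , fs i) e fz     = cong (λ p → s ∙ up p) (e i)
insert-cong (s , fs i) e (fs j) = cong (λ p → if ⌊ j ≟F i ⌋ then (s , fz) else up p) (e j)

insert-injective : ∀ {w w′ : SMap n} p p′ → (∀ x → insert w p x ≡ insert w′ p′ x) →
  p ≡ p′ × (∀ i → w i ≡ w′ i)
insert-injective (s , fz) (s′ , fz) e = e fz , λ i → up-injective (e (fs i))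
insert-injective (s , fz) (s′ , fs i) e with cong proj₂ (e fz)
... | ()
insert-injective (s , fs i) (s′ , fz) e with cong proj₂ (e fz)
... | ()
insert-injective {w = w} {w′} (s , fs i) (s′ , fs i′) e with i ≟F i′
... | no i≢i′ = ⊥-elim (fz≢fs (cong proj₂ (trans (sym (insert-at w s i)) (trans (e (fs i)) (insert-off w′ s′ i′ i≢i′)))))
  where
  fz≢fs : ∀ {n} {j : Fin n} → fz ≢ fs j
  fz≢fs ()
... | yes refl with cong proj₁ (trans (sym (insert-at w s i)) (trans (e (fs i)) (insert-at w′ s′ i)))
... | refl = refl , same
  where
  same : ∀ j → w j ≡ w′ j
  same j with j ≟F i
  ... | no j≢i   = up-injective (trans (sym (insert-off w s i j≢i)) (trans (e (fs j)) (insert-off w′ s i j≢i)))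
  -- The old image of `i` has become the image of the new letter, multiplied by `s`; a second
  -- multiplication by `s` recovers it.
  ... | yes refl = up-injective (trans (sym (∙-cancel s (up (w i)))) (trans (cong (s ∙_) (e fz)) (∙-cancel s (up (w′ i)))))

-- Bypasses the index fz; the last clause is never reached for a bijection.
lower : Point (suc n) → Point (suc n) → Fin n → Point n
lower (t , fs b) _           i = (t , b)
lower (t , fz)   (t′ , fs b) i = (t · t′ , b)
lower (t , fz)   (t′ , fz)   i = (⊕ , i)

contract : SMap (suc n) → SMap n
contract x i = lower (x (fs i)) (x fz) i

leftInverse-dual : ∀ {v w : SMap n} → v LeftInverseOf w → ∀ {i j s} → w i ≡ (s , j) → v j ≡ (s , i)
leftInverse-dual {v = v} {w} inv {i} {j} {s} e = begin
  v j                  ≡⟨ ∙-cancel s (v j) ⟨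
  s ∙ s ∙ v j          ≡⟨ cong (λ p → s ∙ app v p) e ⟨
  s ∙ app v (w i)      ≡⟨ cong (s ∙_) (inv i) ⟩
  (s · ⊕ , i)          ≡⟨ cong (_, i) (Signₚ.*-identityʳ s) ⟩
  (s , i)              ∎

-- Bypassing a letter commutes with inversion, so the contracted inverse inverts the contraction. In
-- the last case `fs i` and `fz` would both be sent to `fz` up to sign, against invertibility.
contract-leftInverse : ∀ {v w : SMap (suc n)} → v LeftInverseOf w → contract v LeftInverseOf contract w
contract-leftInverse {v = v} {w} inv i with w (fs i) in e
... | (t , fs b) rewrite leftInverse-dual {v = v} {w} inv e = cong (_, i) (Signₚ.s*s≡+ t)
... | (t , fz) with w fz in f
...   | (t′ , fs b) rewrite leftInverse-dual {v = v} {w} inv f | leftInverse-dual {v = v} {w} inv e =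
  cong (_, i) (trans (cong ((t · t′) ·_) (Signₚ.*-comm t′ t)) (Signₚ.s*s≡+ (t · t′)))
...   | (t′ , fz) with trans (sym (leftInverse-dual {v = v} {w} inv f)) (leftInverse-dual {v = v} {w} inv e)
...     | ()

-- The preimage `v fz` of the removed letter is the very datum that `insert` takes; together with
-- the bypassed element it determines `w`.
insert-contract : ∀ {v w : SMap (suc n)} → v LeftInverseOf w → w LeftInverseOf v → ∀ x →
  insert (contract w) (v fz) x ≡ w x
insert-contract {n} {v = v} {w} inv inv′ x with v fz in e
... | (s , fz) = fixed x
  where
  fixed : ∀ x → insert (contract w) (s , fz) x ≡ w x
  fixed fz = sym (leftInverse-dual {v = w} {v} inv′ e)
  fixed (fs i) with w (fs i) in f
  ... | (t , fs b) = refl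
  ... | (t , fz) with trans (sym e) (leftInverse-dual {v = v} {w} inv f)
  ...   | ()
... | (s , fs a) = moved x
  where
  wa : w (fs a) ≡ (s , fz)
  wa = leftInverse-dual {v = w} {v} inv′ e
  moved : ∀ x → insert (contract w) (s , fs a) x ≡ w x
  moved fz with w (fs a) | wa
  ... | .(s , fz) | refl with w fz in f
  ...   | (t′ , fs b) = cong (_, fs b) (sign-cancel s t′)
  ...   | (t′ , fz) with trans (sym e) (leftInverse-dual {v = v} {w} inv f)
  ...     | ()
  moved (fs i) with i ≟F a
  ... | yes refl = sym wa
  ... | no i≢a with w (fs i) in f
  ...   | (t , fs b) = refl
  ...   | (t , fz) with trans (sym e) (leftInverse-dual {v = v} {w} inv f)
  ...     | refl = ⊥-elim (i≢a refl)

-- By `insert-contract` and `insert-injective`, `x` equals `insert w p` precisely when `w` is its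
-- contraction and `p` the preimage of +1; so each level of the enumeration allows one choice.
Σ-enum-== : ∀ {n} (x : SMap n) → Invertible x → Σℚ (enum n) (λ wC → 𝟙 (x ==M proj₁ wC)) ≡ 1ℚ
Σ-enum-== {zero}  x I = refl
Σ-enum-== {suc n} x (invertible v inv inv′) = begin
  _ ≡⟨ Σ-enum-suc n (λ wC → 𝟙 (x ==M proj₁ wC)) ⟩
  _ ≡⟨ Σ-cong (enum n) (λ wC → Σ-cong (allPoints (suc n)) (λ p →
         trans (cong 𝟙 (equal (proj₁ wC) p)) (𝟙-∧ (contract x ==M proj₁ wC) (v fz ==P p)))) ⟩
  Σℚ (enum n) (λ wC → Σℚ (allPoints (suc n)) (λ p → 𝟙 (contract x ==M proj₁ wC) *ℚ 𝟙 (v fz ==P p)))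
    ≡⟨ Σ-cong (enum n) (λ wC → trans (Σ-*ˡ (allPoints (suc n)) (𝟙 (contract x ==M proj₁ wC)) (λ p → 𝟙 (v fz ==P p)))
         (trans (cong (𝟙 (contract x ==M proj₁ wC) *ℚ_) (Σ-points-== (v fz))) (ℚₚ.*-identityʳ (𝟙 (contract x ==M proj₁ wC))))) ⟩
  Σℚ (enum n) (λ wC → 𝟙 (contract x ==M proj₁ wC))
    ≡⟨ Σ-enum-== (contract x) (invertible (contract v) (contract-leftInverse {v = v} {x} inv) (contract-leftInverse {v = x} {v} inv′)) ⟩
  1ℚ ∎
  where
  x≗ : ∀ i → insert (contract x) (v fz) i ≡ x i
  x≗ = insert-contract {v = v} {x} inv inv′
  equal : ∀ w p → (x ==M insert w p) ≡ (contract x ==M w) ∧ (v fz ==P p)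
  equal w p = ⇔-≡
    (λ e → let (q , r) = insert-injective {w = contract x} {w} (v fz) p (λ i → trans (x≗ i) (funEq⁻ x (insert w p) e i))
           in cong₂ _∧_ (funEq⁺ (contract x) w r) (trans (cong (v fz ==P_) (sym q)) (==P-refl (v fz))))
    (λ e → let (q , r) = ∧-split (contract x ==M w) e in
      funEq⁺ x (insert w p) (λ i → trans (sym (x≗ i)) (trans
        (insert-cong {w = contract x} {w} (v fz) (funEq⁻ (contract x) w q) i)
        (cong (λ p → insert w p i) (==P⁻ (v fz) p r)))))

Extensional : {B : Set} → (SMap n → B) → Set
Extensional f = ∀ {x y} → (∀ i → x i ≡ y i) → f x ≡ f y

𝟙-*-==M : ∀ (x y : SMap n) {a b} → ((∀ i → x i ≡ y i) → a ≡ b) → 𝟙 (x ==M y) *ℚ a ≡ 𝟙 (x ==M y) *ℚ b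
𝟙-*-==M x y e = 𝟙-*-cong (x ==M y) (λ q → e (funEq⁻ x y q))

-- Matches `x ==M w` are counted in two ways: a bijection `x` has one match in `enum n`, and each
-- `w` there, being a bijection, has one among all listed functions.
Σ-Bn : ∀ n (f : SMap n → ℚ) → Extensional f → Σℚ (Bn n) f ≡ Σℚ (enum n) (λ wC → f (proj₁ wC))
Σ-Bn n f ext = begin
  Σℚ (Bn n) f
    ≡⟨ Σ-filterB isBijection Fs f ⟩
  Σℚ Fs (λ x → 𝟙 (isBijection x) *ℚ f x)
    ≡⟨ Σ-cong Fs (λ x → 𝟙-*-cong (isBijection x) (λ b → sym (trans (Σ-*ʳ (enum n) (f x) (λ wC → 𝟙 (x ==M proj₁ wC)))
         (trans (cong (_*ℚ f x) (Σ-enum-== x (isBijection⁻ x b))) (ℚₚ.*-identityˡ (f x)))))) ⟩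
  Σℚ Fs (λ x → 𝟙 (isBijection x) *ℚ Σℚ (enum n) (λ wC → 𝟙 (x ==M proj₁ wC) *ℚ f x))
    ≡⟨ Σ-cong Fs (λ x → trans (sym (Σ-*ˡ (enum n) (𝟙 (isBijection x)) (λ wC → 𝟙 (x ==M proj₁ wC) *ℚ f x)))
         (Σ-cong (enum n) (λ wC → same x (proj₁ wC) (proj₂ wC)))) ⟩
  Σℚ Fs (λ x → Σℚ (enum n) (λ wC → 𝟙 (x ==M proj₁ wC) *ℚ f (proj₁ wC)))
    ≡⟨ Σ-swap Fs (enum n) (λ x wC → 𝟙 (x ==M proj₁ wC) *ℚ f (proj₁ wC)) ⟩
  Σℚ (enum n) (λ wC → Σℚ Fs (λ x → 𝟙 (x ==M proj₁ wC) *ℚ f (proj₁ wC)))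
    ≡⟨ Σ-cong (enum n) (λ wC → trans (Σ-*ʳ Fs (f (proj₁ wC)) (λ x → 𝟙 (x ==M proj₁ wC)))
         (trans (cong (_*ℚ f (proj₁ wC)) (Σ-funs n (proj₁ wC))) (ℚₚ.*-identityˡ (f (proj₁ wC))))) ⟩
  Σℚ (enum n) (λ wC → f (proj₁ wC)) ∎
  where
  Fs : List (SMap n)
  Fs = funs n (allPoints n)
  same : ∀ x w → Cycles w → 𝟙 (isBijection x) *ℚ (𝟙 (x ==M w) *ℚ f x) ≡ 𝟙 (x ==M w) *ℚ f w
  same x w C = trans (*-left-comm (𝟙 (isBijection x)) (𝟙 (x ==M w)) (f x))
    (𝟙-*-==M x w (λ e → trans
      (cong (λ b → 𝟙 b *ℚ f x) (isBijection⁺ x (Invertible-cong {w = w} e (Cycles⇒Invertible C))))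
      (trans (ℚₚ.*-identityˡ (f x)) (ext e))))

Σ-Bn-== : ∀ n (x : SMap n) → Invertible x → (f : SMap n → ℚ) → Extensional f →
  Σℚ (Bn n) (λ y → 𝟙 (x ==M y) *ℚ f y) ≡ f x
Σ-Bn-== n x I f ext = begin
  _ ≡⟨ Σ-Bn n (λ y → 𝟙 (x ==M y) *ℚ f y) (λ {y} {z} e → cong₂ (λ b a → 𝟙 b *ℚ a)
         (⇔-≡ (λ q → funEq⁺ x z (λ i → trans (funEq⁻ x y q i) (e i)))
              (λ q → funEq⁺ x y (λ i → trans (funEq⁻ x z q i) (sym (e i))))) (ext e)) ⟩
  Σℚ (enum n) (λ wC → 𝟙 (x ==M proj₁ wC) *ℚ f (proj₁ wC))
    ≡⟨ Σ-cong (enum n) (λ wC → 𝟙-*-==M x (proj₁ wC) (λ e → sym (ext e))) ⟩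
  Σℚ (enum n) (λ wC → 𝟙 (x ==M proj₁ wC) *ℚ f x)
    ≡⟨ Σ-*ʳ (enum n) (f x) (λ wC → 𝟙 (x ==M proj₁ wC)) ⟩
  Σℚ (enum n) (λ wC → 𝟙 (x ==M proj₁ wC)) *ℚ f x
    ≡⟨ cong (_*ℚ f x) (Σ-enum-== x I) ⟩
  1ℚ *ℚ f x ≡⟨ ℚₚ.*-identityˡ (f x) ⟩
  f x ∎

-- Powers of cycles and cycle types

powM-iter : ∀ (w : SMap n) k i → powM w k i ≡ iter w k (⊕ , i)
powM-iter w zero    i = refl
powM-iter w (suc k) i = cong (app w) (powM-iter w k i)

app-powM : ∀ (w : SMap n) k p → app (powM w k) p ≡ iter w k p
app-powM w k (s , i) = begin
  s ∙ powM w k i          ≡⟨ cong (s ∙_) (powM-iter w k i) ⟩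
  s ∙ iter w k (⊕ , i)    ≡⟨ iter-∙ w k s (⊕ , i) ⟨
  iter w k (s · ⊕ , i)    ≡⟨ cong (λ t → iter w k (t , i)) (Signₚ.*-identityʳ s) ⟩
  iter w k (s , i)        ∎

iter-powM : ∀ (w : SMap n) k m p → iter (powM w k) m p ≡ iter w (m * k) p
iter-powM w k zero    p = refl
iter-powM w k (suc m) p = begin
  app (powM w k) (iter (powM w k) m p) ≡⟨ app-powM w k _ ⟩
  iter w k (iter (powM w k) m p)       ≡⟨ cong (iter w k) (iter-powM w k m p) ⟩
  iter w k (iter w (m * k) p)          ≡⟨ iter-+ w k (m * k) p ⟨
  iter w (suc m * k) p                 ∎

Returns-multiple : ∀ {w : SMap n} {i u} → Returns w i u → ∀ m →
  iter w (m * len u) (⊕ , i) ≡ (proj₂ u ^s m , i)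
Returns-multiple R zero = refl
Returns-multiple {w = w} {i} {u} R (suc m) = begin
  iter w (len u + m * len u) (⊕ , i)          ≡⟨ iter-+ w (len u) (m * len u) (⊕ , i) ⟩
  iter w (len u) (iter w (m * len u) (⊕ , i)) ≡⟨ cong (iter w (len u)) (trans (Returns-multiple R m) (cong (_, i) (sym (Signₚ.*-identityʳ (proj₂ u ^s m))))) ⟩
  iter w (len u) ((proj₂ u ^s m) ∙ (⊕ , i))   ≡⟨ iter-∙ w (len u) (proj₂ u ^s m) (⊕ , i) ⟩
  (proj₂ u ^s m) ∙ iter w (len u) (⊕ , i)     ≡⟨ cong ((proj₂ u ^s m) ∙_) (Returns.back R) ⟩
  ((proj₂ u ^s m) · proj₂ u , i)              ≡⟨ cong (_, i) (Signₚ.*-comm (proj₂ u ^s m) (proj₂ u)) ⟩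
  (proj₂ u ^s suc m , i)                      ∎

-- Full turns do not move the index, so the remainder of `m` modulo `len u` also leads back to `i`;
-- minimality forces it to be 0.
Returns-divides : ∀ {w : SMap n} {i u} → Returns w i u → ∀ m → orb w m i ≡ i → len u ∣ m
Returns-divides {w = w} {i} {u} R m e = m%n≡0⇒n∣m m (len u) (zero-or-less (m % len u) refl)
  where
  rem : orb w (m % len u) i ≡ i
  rem = begin
    orb w (m % len u) i
      ≡⟨ cong (orb w (m % len u)) (cong proj₂ (Returns-multiple R (m / len u))) ⟨
    orb w (m % len u) (orb w (m / len u * len u) i)
      ≡⟨ orb-+ w (m % len u) (m / len u * len u) i ⟨
    orb w (m % len u + m / len u * len u) i
      ≡⟨ cong (λ x → orb w x i) (m≡m%n+[m/n]*n m (len u)) ⟨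
    orb w m i ≡⟨ e ⟩
    i ∎
  zero-or-less : ∀ r → m % len u ≡ r → m % len u ≡ 0
  zero-or-less zero    q = q
  zero-or-less (suc r) q = ⊥-elim (Returns.minimal R (m % len u) (subst (0 <_) (sym q) (s≤s z≤n)) (m%n<n m (len u)) rem)

module _ (k : ℕ) where

  -- The numbers j and h of the overview, taken as quotients of divisibility proofs so that their
  -- products with the gcd are known at once.
  cofactor exponent : Col → ℕ
  cofactor u = _∣_.quotient (gcd[m,n]∣m (len u) k)
  exponent u = _∣_.quotient (gcd[m,n]∣n (len u) k)

  len-cofactor : ∀ u → len u ≡ cofactor u * gcd (len u) k
  len-cofactor u = _∣_.equality (gcd[m,n]∣m (len u) k)

  power-exponent : ∀ u → k ≡ exponent u * gcd (len u) k
  power-exponent u = _∣_.equality (gcd[m,n]∣n (len u) k)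

  gcd≢0 : ∀ u → gcd (len u) k ≢ 0
  gcd≢0 u e with gcd[m,n]≡0⇒m≡0 {len u} {k} e
  ... | ()

  cofactor≢0 : ∀ u → cofactor u ≢ 0
  cofactor≢0 u e with trans (len-cofactor u) (cong (_* gcd (len u) k) e)
  ... | ()

  cofactor-coprime : ∀ u → gcd (cofactor u) (exponent u) ≡ 1
  cofactor-coprime u = ℕₚ.*-cancelˡ-≡ (gcd (cofactor u) (exponent u)) 1 g {{ℕ.≢-nonZero (gcd≢0 u)}} (begin
    g * gcd (cofactor u) (exponent u)         ≡⟨ c*gcd[m,n]≡gcd[cm,cn] g (cofactor u) (exponent u) ⟩
    gcd (g * cofactor u) (g * exponent u)     ≡⟨ cong₂ gcd (trans (ℕₚ.*-comm g (cofactor u)) (sym (len-cofactor u)))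
                                                            (trans (ℕₚ.*-comm g (exponent u)) (sym (power-exponent u))) ⟩
    g                                         ≡⟨ ℕₚ.*-identityʳ g ⟨
    g * 1                                     ∎)
    where
    g : ℕ
    g = gcd (len u) k

  -- The k-th power of a cycle u splits into gcd (len u) k cycles of this colour.
  reduce : Col → Col
  reduce u = (pred (cofactor u) , proj₂ u ^s exponent u)

  len-reduce : ∀ u → len (reduce u) ≡ cofactor u
  len-reduce u = ℕₚ.suc-pred (cofactor u) {{ℕ.≢-nonZero (cofactor≢0 u)}}

  len-reduce-∣ : ∀ u → len (reduce u) ∣ len u
  len-reduce-∣ u = subst (_∣ len u) (sym (len-reduce u)) (divides (gcd (len u) k)
    (trans (len-cofactor u) (ℕₚ.*-comm (cofactor u) (gcd (len u) k))))

  -- `cofactor u` steps of the power are `exponent u` full turns of `u`. An earlier return after `m`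
  -- steps needs `len u` to divide `m * k`; after cancelling the gcd, coprimality makes `cofactor u`
  -- a divisor of `m`.
  Returns-powM : ∀ {w : SMap n} {i u} → Returns w i u → Returns (powM w k) i (reduce u)
  Returns-powM {w = w} {i} {u} R = returns back′ minimal′
    where
    g : ℕ
    g = gcd (len u) k
    swap : cofactor u * k ≡ exponent u * len u
    swap = begin
      cofactor u * k                ≡⟨ cong (cofactor u *_) (power-exponent u) ⟩
      cofactor u * (exponent u * g) ≡⟨ ℕₚ.*-assoc (cofactor u) (exponent u) g ⟨
      cofactor u * exponent u * g   ≡⟨ cong (_* g) (ℕₚ.*-comm (cofactor u) (exponent u)) ⟩
      exponent u * cofactor u * g   ≡⟨ ℕₚ.*-assoc (exponent u) (cofactor u) g ⟩
      exponent u * (cofactor u * g) ≡⟨ cong (exponent u *_) (len-cofactor u) ⟨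
      exponent u * len u            ∎
    back′ : iter (powM w k) (len (reduce u)) (⊕ , i) ≡ (proj₂ (reduce u) , i)
    back′ = begin
      iter (powM w k) (len (reduce u)) (⊕ , i) ≡⟨ iter-powM w k (len (reduce u)) (⊕ , i) ⟩
      iter w (len (reduce u) * k) (⊕ , i)      ≡⟨ cong (λ m → iter w m (⊕ , i)) (trans (cong (_* k) (len-reduce u)) swap) ⟩
      iter w (exponent u * len u) (⊕ , i)      ≡⟨ Returns-multiple R (exponent u) ⟩
      (proj₂ u ^s exponent u , i)              ∎
    minimal′ : ∀ m → 0 < m → m < len (reduce u) → orb (powM w k) m i ≢ i
    minimal′ m@(suc _) 0<m m<l e = ℕₚ.<⇒≱ m<l (∣⇒≤ (subst (_∣ m) (sym (len-reduce u)) J∣m))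
      where
      len∣ : len u ∣ m * k
      len∣ = Returns-divides R (m * k) (trans (sym (cong proj₂ (iter-powM w k m (⊕ , i)))) e)
      Jg∣ : cofactor u * g ∣ exponent u * m * g
      Jg∣ = subst₂ _∣_ (len-cofactor u) (begin
        m * k                ≡⟨ cong (m *_) (power-exponent u) ⟩
        m * (exponent u * g) ≡⟨ ℕₚ.*-assoc m (exponent u) g ⟨
        m * exponent u * g   ≡⟨ cong (_* g) (ℕₚ.*-comm m (exponent u)) ⟩
        exponent u * m * g   ∎) len∣
      J∣m : cofactor u ∣ m
      J∣m = coprime-divisor (gcd≡1⇒coprime (cofactor-coprime u))
        (*-cancelʳ-∣ g {{ℕ.≢-nonZero (gcd≢0 u)}} Jg∣)

-- Evaluation of the cycle type

firstReturn-≡ : ∀ (w : SMap n) p fuel start d → d < fuel → iter w (start + d) p ≡ p →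
  (∀ m → m < d → iter w (start + m) p ≢ p) → firstReturn w p fuel start ≡ start + d
firstReturn-≡ w p (suc fuel) start zero d<f e ne
  rewrite trans (cong (_==P p) (trans (cong (λ m → iter w m p) (sym (ℕₚ.+-identityʳ start))) e)) (==P-refl p)
  = sym (ℕₚ.+-identityʳ start)
firstReturn-≡ w p (suc fuel) start (suc d) (s≤s d<f) e ne with iter w start p ==P p in q
... | true  = ⊥-elim (ne 0 (s≤s z≤n) (trans (cong (λ m → iter w m p) (ℕₚ.+-identityʳ start)) (==P⁻ _ p q)))
... | false = trans (firstReturn-≡ w p fuel (suc start) d d<f
    (trans (cong (λ m → iter w m p) (sym (ℕₚ.+-suc start d))) e)
    (λ m m<d f → ne (suc m) (s≤s m<d) (trans (cong (λ m → iter w m p) (ℕₚ.+-suc start m)) f)))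
  (sym (ℕₚ.+-suc start d))

or-map-none : (p : A → Bool) {xs : List A} → All (λ x → p x ≡ false) xs → or (map p xs) ≡ false
or-map-none p []       = refl
or-map-none p (e ∷ es) rewrite e = or-map-none p es

==P-≢ : ∀ (p q : Point n) → p ≢ q → p ==P q ≡ false
==P-≢ p q ne with p ==P q in e
... | true  = ⊥-elim (ne (==P⁻ p q e))
... | false = refl

orbitLen-⊕ : ∀ {w : SMap n} {i l} → Returns w i (l , ⊕) → suc l ≤ n → orbitLen w i ≡ suc l
orbitLen-⊕ {n} {w} {i} {l} R l<n = firstReturn-≡ w (⊕ , i) (2 * n) 1 l
  (ℕₚ.<-≤-trans l<n (ℕₚ.m≤m+n n (n + 0))) (Returns.back R)
  (λ m m<l e → Returns.minimal R (suc m) (s≤s z≤n) (s≤s m<l) (cong proj₂ e))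

-- The index recurs only after full turns, and a single turn ends at the opposite point, so two
-- turns are needed.
orbitLen-⊖ : ∀ {w : SMap n} {i l} → Returns w i (l , ⊖) → suc l ≤ n → orbitLen w i ≡ 2 * suc l
-- The search starts at 1, so the length `2 * suc l` lies one less than that ahead; `suc l ≤ n`
-- keeps it within the fuel `2 * n`.
orbitLen-⊖ {n} {w} {i} {l} R l<n = firstReturn-≡ w (⊕ , i) (2 * n) 1 (pred (2 * suc l))
  (ℕₚ.*-monoʳ-≤ 2 l<n) (Returns-multiple R 2)
  (λ m m<l e → not-back (suc m) (s≤s z≤n) (s≤s m<l) (Returns-divides R (suc m) (cong proj₂ e)) e)
  where
  not-back : ∀ m → 0 < m → m < 2 * suc l → suc l ∣ m → iter w m (⊕ , i) ≢ (⊕ , i)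
  not-back m () m<2l (divides zero    refl) e
  not-back m _  m<2l (divides (suc zero) refl) e with trans (sym (Returns-multiple R 1)) e
  ... | ()
  not-back m _  m<2l (divides (suc (suc q)) refl) e =
    ℕₚ.<⇒≱ m<2l (ℕₚ.*-monoˡ-≤ (suc l) (s≤s (s≤s (z≤n {q}))))

-- The opposite point has the same index, so for class +1 no iterate within the orbit meets it. For
-- class -1 it is met halfway, and halving the orbit length restores the signed length.
cycType-≡ : ∀ {w : SMap n} {i u} → Returns w i u → len u ≤ n → cycType w i ≡ (len u , proj₂ u)
cycType-≡ {w = w} {i} {l , ⊕} R l<n = trans
  (cong (λ b → if b then (orbitLen w i / 2 , ⊖) else (orbitLen w i , ⊕)) none)
  (cong (_, ⊕) (orbitLen-⊕ R l<n))
  where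
  none : selfConj w i ≡ false
  none = or-map-none _ (All.tabulate (λ {m} m∈ → ==P-≢ _ _ (away m (subst (m <_) (orbitLen-⊕ R l<n) (∈-upTo⁻ m∈)))))
    where
    away : ∀ m → m < suc l → iter w m (⊕ , i) ≢ (⊖ , i)
    away zero    _   ()
    away (suc m) m<l e = Returns.minimal R (suc m) (s≤s z≤n) m<l (cong proj₂ e)
cycType-≡ {w = w} {i} {l , ⊖} R l<n = trans
  (cong (λ b → if b then (orbitLen w i / 2 , ⊖) else (orbitLen w i , ⊕)) some)
  (cong (_, ⊖) (trans (cong (_/ 2) (trans (orbitLen-⊖ R l<n) (ℕₚ.*-comm 2 (suc l)))) (m*n/n≡m (suc l) 2)))
  where
  some : selfConj w i ≡ true
  some = or-map⁺ (λ m → iter w m (⊕ , i) ==P (⊖ , i))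
    (∈-upTo⁺ (subst (suc l <_) (sym (orbitLen-⊖ R l<n)) (ℕₚ.m<m+n (suc l) (s≤s z≤n))))
    (trans (cong (_==P (⊖ , i)) (Returns.back R)) (==P-refl (⊖ , i)))

-- Exponents of the cycle monomials

app-cong : ∀ {w w′ : SMap n} → (∀ i → w i ≡ w′ i) → ∀ p → app w p ≡ app w′ p
app-cong e (s , i) = cong (s ∙_) (e i)

iter-cong : ∀ {w w′ : SMap n} → (∀ i → w i ≡ w′ i) → ∀ m p → iter w m p ≡ iter w′ m p
iter-cong         e zero    p = refl
iter-cong {w′ = w′} e (suc m) p = trans (app-cong e (iter _ m p)) (cong (app w′) (iter-cong e m p))

powM-cong : ∀ k {w w′ : SMap n} → (∀ i → w i ≡ w′ i) → ∀ i → powM w k i ≡ powM w′ k i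
powM-cong k {w} {w′} e i = trans (powM-iter w k i) (trans (iter-cong e k (⊕ , i)) (sym (powM-iter w′ k i)))

firstReturn-cong : ∀ {w w′ : SMap n} → (∀ i → w i ≡ w′ i) → ∀ p fuel start →
  firstReturn w p fuel start ≡ firstReturn w′ p fuel start
firstReturn-cong e p zero       start = refl
firstReturn-cong {w = w} {w′} e p (suc fuel) start = cong₂ (λ q r → if q ==P p then start else r)
  (iter-cong e start p) (firstReturn-cong e p fuel (suc start))

cycType-cong : ∀ {w w′ : SMap n} → (∀ i → w i ≡ w′ i) → ∀ i → cycType w i ≡ cycType w′ i
cycType-cong {n} {w} {w′} e i = cong₂ (λ b m → if b then (m / 2 , ⊖) else (m , ⊕))
  (trans (cong (λ m → or (map (λ m → iter w m (⊕ , i) ==P (⊖ , i)) (upTo m))) len-eq)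
         (cong or (map-cong (λ m → cong (_==P (⊖ , i)) (iter-cong e m (⊕ , i))) (upTo (orbitLen w′ i)))))
  len-eq
  where
  len-eq : orbitLen w i ≡ orbitLen w′ i
  len-eq = firstReturn-cong e (⊕ , i) (2 * n) 1

expo-cong : ∀ {w w′ : SMap n} → (∀ i → w i ≡ w′ i) → ∀ l ε → expo w l ε ≡ expo w′ l ε
expo-cong e zero    ε = refl
expo-cong {n} e (suc l) ε = cong (λ m → suc l * (m / suc l)) (count-cong (allFin n) (λ i →
  cong (λ t → (proj₁ t ≡ᵇ suc l) ∧ (proj₂ t ==S ε)) (cycType-cong e i)))

matches-cong : ∀ {w w′ : SMap n} {N} (a : Exps N) → (∀ i → w i ≡ w′ i) → matches w a ≡ matches w′ a
matches-cong {n} {N = N} a e = cong₂ _∧_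
  (cong and (map-cong (λ i → cong₂ (λ x y → (x ≡ᵇ a i ⊕) ∧ (y ≡ᵇ a i ⊖))
    (expo-cong e (suc (toℕ i)) ⊕) (expo-cong e (suc (toℕ i)) ⊖)) (allFin N)))
  (cong and (map-cong (λ l → cong₂ (λ x y → not (N <ᵇ l) ∨ ((x ≡ᵇ 0) ∧ (y ≡ᵇ 0)))
    (expo-cong e l ⊕) (expo-cong e l ⊖)) (upTo (suc n))))

Σ-toList : ∀ {m} (xs : Vec A m) (f : A → ℚ) → Σℚ (allFin m) (λ c → f (lookup xs c)) ≡ Σℚ (toList xs) f
Σ-toList Vec.[]       f = refl
Σ-toList (x Vec.∷ xs) f = trans (Σ-allFin-suc _ (λ c → f (lookup (x Vec.∷ xs) c))) (cong (f x +ℚ_) (Σ-toList xs f))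

All-toList : ∀ {m} {P : A → Set} (xs : Vec A m) → (∀ c → P (lookup xs c)) → All P (toList xs)
All-toList Vec.[]       p = []
All-toList (x Vec.∷ xs) p = p fz ∷ All-toList xs (p ∘ fs)

count≤length : (p : A → Bool) (xs : List A) → count p xs ≤ length xs
count≤length p []       = z≤n
count≤length p (x ∷ xs) with p x
... | true  = s≤s (count≤length p xs)
... | false = ℕₚ.m≤n⇒m≤1+n (count≤length p xs)

module _ (k : ℕ) where

  hasType : ℕ → Sign → Col → Bool
  hasType l ε u = (len (reduce k u) ≡ᵇ l) ∧ (proj₂ (reduce k u) ==S ε)

  contribution : Col → ℕ → Sign → ℕ
  contribution u l ε = if hasType l ε u then len u else 0

  -- Exponent of the variable (l , ε) in the monomial of the k-th power of an
  -- element with cycles v.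
  exponents : List Col → ℕ → Sign → ℕ
  exponents []      l ε = 0
  exponents (u ∷ v) l ε = contribution u l ε + exponents v l ε

  fromℕ-exponents : ∀ v l ε → fromℕ (exponents v l ε) ≡ Σℚ v (λ u → fromℕ (len u) *ℚ 𝟙 (hasType l ε u))
  fromℕ-exponents []      l ε = refl
  fromℕ-exponents (u ∷ v) l ε = trans (fromℕ-+ (contribution u l ε) (exponents v l ε))
    (cong₂ _+ℚ_ (indicator (hasType l ε u)) (fromℕ-exponents v l ε))
    where
    indicator : ∀ b → fromℕ (if b then len u else 0) ≡ fromℕ (len u) *ℚ 𝟙 b
    indicator true  = sym (ℚₚ.*-identityʳ (fromℕ (len u)))
    indicator false = sym (ℚₚ.*-zeroʳ (fromℕ (len u)))

  hasType⁻ : ∀ l ε u → hasType l ε u ≡ true → len (reduce k u) ≡ l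
  hasType⁻ l ε u e = ≡ᵇ⁻ (len (reduce k u)) l (proj₁ (∧-split (len (reduce k u) ≡ᵇ l) e))

  -- A cycle of length `l` in the power comes from a cycle whose length is a multiple of `l`. This
  -- makes the division in `mult` exact, so that `expo` gives back the number of letters.
  exponents-∣ : ∀ v l ε → l ∣ exponents v l ε
  exponents-∣ []      l ε = l ∣0
  exponents-∣ (u ∷ v) l ε with hasType l ε u in e
  ... | true  = ∣m∣n⇒∣m+n (subst (_∣ len u) (hasType⁻ l ε u e) (len-reduce-∣ k u)) (exponents-∣ v l ε)
  ... | false = exponents-∣ v l ε

  exponents-≥ : ∀ {u v} l ε → u ∈ v → hasType l ε u ≡ true → len u ≤ exponents v l ε
  exponents-≥ {u} {_ ∷ v} l ε (here refl) e rewrite e = ℕₚ.m≤m+n (len u) (exponents v l ε)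
  exponents-≥ {u} {x ∷ v} l ε (there u∈) e =
    ℕₚ.≤-trans (exponents-≥ l ε u∈ e) (ℕₚ.m≤n+m (exponents v l ε) (contribution x l ε))

  exponents-zero : ∀ {v} l ε → All (λ u → len (reduce k u) < l) v → exponents v l ε ≡ 0
  exponents-zero l ε []               = refl
  exponents-zero {u ∷ _} l ε (u<l ∷ v<l) with hasType l ε u in e
  ... | true  = ⊥-elim (ℕₚ.<-irrefl (hasType⁻ l ε u e) u<l)
  ... | false = exponents-zero l ε v<l

  -- The counterpart of `matches` on cycle lists; the second conjunct excludes variables of index
  -- above `N`.
  fits : ∀ {N} → List Col → Exps N → Bool
  fits {N} v a =
    and (map (λ i → (exponents v (suc (toℕ i)) ⊕ ≡ᵇ a i ⊕) ∧ (exponents v (suc (toℕ i)) ⊖ ≡ᵇ a i ⊖)) (allFin N))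
    ∧ and (map (λ u → len (reduce k u) ≤ᵇ N) v)

  module _ {w : SMap n} (C : Cycles w) where
    open Cycles C

    Σ-cl : ∀ (f : Fin number → ℚ) →
      Σℚ (allFin n) (λ i → f (cl i)) ≡ Σℚ (allFin number) (λ c → fromℕ (len (lookup cols c)) *ℚ f c)
    Σ-cl f = begin
      _ ≡⟨ Σ-cong (allFin n) (λ i → sym (Σ-allFin-≟ (cl i) f)) ⟩
      Σℚ (allFin n) (λ i → Σℚ (allFin number) (λ c → 𝟙 ⌊ cl i ≟F c ⌋ *ℚ f c))
        ≡⟨ Σ-swap (allFin n) (allFin number) (λ i c → 𝟙 ⌊ cl i ≟F c ⌋ *ℚ f c) ⟩
      Σℚ (allFin number) (λ c → Σℚ (allFin n) (λ i → 𝟙 ⌊ cl i ≟F c ⌋ *ℚ f c))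
        ≡⟨ Σ-cong (allFin number) (λ c → trans (Σ-*ʳ (allFin n) (f c) (λ i → 𝟙 ⌊ cl i ≟F c ⌋))
             (cong (_*ℚ f c) (trans (sym (fromℕ-count (λ i → ⌊ cl i ≟F c ⌋) (allFin n))) (cong fromℕ (count-cl c))))) ⟩
      Σℚ (allFin number) (λ c → fromℕ (len (lookup cols c)) *ℚ f c) ∎

    len≤n : ∀ c → len (lookup cols c) ≤ n
    len≤n c = subst₂ _≤_ (count-cl c) (length-tabulate {n = n} id) (count≤length (λ j → ⌊ cl j ≟F c ⌋) (allFin n))

    len-reduce≤n : ∀ c → len (reduce k (lookup cols c)) ≤ n
    len-reduce≤n c = ℕₚ.≤-trans (∣⇒≤ (len-reduce-∣ k (lookup cols c))) (len≤n c)

    -- All letters of a cycle `u` have the type `reduce k u` in the power, so `u` contributes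
    -- `len u` to the count of letters.
    expo-powM : ∀ l ε → expo (powM w k) (suc l) ε ≡ exponents (toList cols) (suc l) ε
    expo-powM l ε = trans (cong (λ m → suc l * (m / suc l)) counted) (m*[n/m]≡n (exponents-∣ (toList cols) (suc l) ε))
      where
      q : SMap n
      q = powM w k
      counted : count (λ i → (proj₁ (cycType q i) ≡ᵇ suc l) ∧ (proj₂ (cycType q i) ==S ε)) (allFin n) ≡
        exponents (toList cols) (suc l) ε
      counted = fromℕ-injective (begin
        _ ≡⟨ cong fromℕ (count-cong (allFin n) (λ i → cong (λ t → (proj₁ t ≡ᵇ suc l) ∧ (proj₂ t ==S ε))
               (cycType-≡ (Returns-powM k (returning i)) (len-reduce≤n (cl i))))) ⟩
        _ ≡⟨ fromℕ-count (λ i → hasType (suc l) ε (colour i)) (allFin n) ⟩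
        _ ≡⟨ Σ-cl (λ c → 𝟙 (hasType (suc l) ε (lookup cols c))) ⟩
        _ ≡⟨ Σ-toList cols (λ u → fromℕ (len u) *ℚ 𝟙 (hasType (suc l) ε u)) ⟩
        _ ≡⟨ fromℕ-exponents (toList cols) (suc l) ε ⟨
        _ ∎)

    -- A cycle of the power longer than `N` has length at most `n`, so its length is among those
    -- tested, and its exponent there is positive. Without such cycles all exponents beyond `N` are
    -- zero.
    matches-fits : ∀ {N} (a : Exps N) → matches (powM w k) a ≡ fits (toList cols) a
    matches-fits {N} a = cong₂ _∧_
      (cong and (map-cong (λ i → cong₂ (λ x y → (x ≡ᵇ a i ⊕) ∧ (y ≡ᵇ a i ⊖))
        (expo-powM (toℕ i) ⊕) (expo-powM (toℕ i) ⊖)) (allFin N)))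
      (⇔-≡ (λ e → and-map⁺ (λ u → len (reduce k u) ≤ᵇ N) (All.tabulate (λ {u} u∈ → short u u∈ (and-map⁻ absent e))))
           (λ e → and-map⁺ absent {upTo (suc n)} (All.tabulate (λ {l} _ → long l (and-map⁻ (λ u → len (reduce k u) ≤ᵇ N) e)))))
      where
      v : List Col
      v = toList cols
      absent : ℕ → Bool
      absent l = not (N <ᵇ l) ∨ ((expo (powM w k) l ⊕ ≡ᵇ 0) ∧ (expo (powM w k) l ⊖ ≡ᵇ 0))
      short : ∀ u → u ∈ v → All (λ l → absent l ≡ true) (upTo (suc n)) → (len (reduce k u) ≤ᵇ N) ≡ true
      short u u∈ ab with N ℕₚ.<? len (reduce k u)
      ... | no ¬N<r = ≤ᵇ⁺ (ℕₚ.≮⇒≥ ¬N<r)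
      ... | yes N<r = ⊥-elim (nonzero (proj₂ (reduce k u)) refl)
        where
        r = len (reduce k u)
        r≤n : r ≤ n
        r≤n = All.lookup (All-toList {P = λ u → len (reduce k u) ≤ n} cols len-reduce≤n) u∈
        zeroes : (expo (powM w k) r ⊕ ≡ᵇ 0) ∧ (expo (powM w k) r ⊖ ≡ᵇ 0) ≡ true
        zeroes with All.lookup ab (∈-upTo⁺ (s≤s r≤n))
        ... | e rewrite ≤ᵇ⁺ N<r = e
        zero-at : ∀ ε → expo (powM w k) r ε ≡ 0
        zero-at ⊕ = ≡ᵇ⁻ _ 0 (proj₁ (∧-split (expo (powM w k) r ⊕ ≡ᵇ 0) zeroes))
        zero-at ⊖ = ≡ᵇ⁻ _ 0 (proj₂ (∧-split (expo (powM w k) r ⊕ ≡ᵇ 0) zeroes))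
        nonzero : ∀ ε → proj₂ (reduce k u) ≡ ε → _
        nonzero ε q = ℕₚ.<⇒≢ (ℕₚ.<-≤-trans (s≤s z≤n) (exponents-≥ r ε u∈
            (cong₂ _∧_ (≡ᵇ⁺ {r} refl) (trans (cong (_==S ε) q) (==S-refl ε)))))
          (sym (trans (sym (expo-powM (proj₁ (reduce k u)) ε)) (zero-at ε)))
      long : ∀ l → All (λ u → (len (reduce k u) ≤ᵇ N) ≡ true) v → absent l ≡ true
      long zero    _  = refl
      long (suc l) le with N <ᵇ suc l in e
      ... | false = refl
      ... | true  = cong₂ _∧_ (≡ᵇ⁺ (gone ⊕)) (≡ᵇ⁺ (gone ⊖))
        where
        gone : ∀ ε → expo (powM w k) (suc l) ε ≡ 0
        gone ε = trans (expo-powM l ε) (exponents-zero (suc l) ε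
          (All.map (λ b → ℕₚ.≤-<-trans (≤ᵇ⁻ b) (≤ᵇ⁻ {suc N} e)) le))

-- Exponent vectors

module _ {N : ℕ} where

  -- By computation, `_==E_` is the instance at `_≡ᵇ_`; divisibility of monomials will be the one at
  -- `_≤ᵇ_`.
  allE : (ℕ → ℕ → Bool) → Exps N → Exps N → Bool
  allE R b a = and (map (λ i → R (b i ⊕) (a i ⊕) ∧ R (b i ⊖) (a i ⊖)) (allFin N))

  allE⁻ : ∀ R b a → allE R b a ≡ true → ∀ i s → R (b i s) (a i s) ≡ true
  allE⁻ R b a e i s = pick s (All.lookup (and-map⁻ (λ i → R (b i ⊕) (a i ⊕) ∧ R (b i ⊖) (a i ⊖)) e) (∈-allFin i))
    where
    pick : ∀ s → R (b i ⊕) (a i ⊕) ∧ R (b i ⊖) (a i ⊖) ≡ true → R (b i s) (a i s) ≡ true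
    pick ⊕ q = proj₁ (∧-split (R (b i ⊕) (a i ⊕)) q)
    pick ⊖ q = proj₂ (∧-split (R (b i ⊕) (a i ⊕)) q)

  allE⁺ : ∀ R b a → (∀ i s → R (b i s) (a i s) ≡ true) → allE R b a ≡ true
  allE⁺ R b a r = and-map⁺ (λ i → R (b i ⊕) (a i ⊕) ∧ R (b i ⊖) (a i ⊖)) {allFin N}
    (All.tabulate (λ {i} _ → cong₂ _∧_ (r i ⊕) (r i ⊖)))

  ==E⁻ : ∀ (a b : Exps N) → a ==E b ≡ true → ∀ i s → a i s ≡ b i s
  ==E⁻ a b e i s = ≡ᵇ⁻ (a i s) (b i s) (allE⁻ _≡ᵇ_ a b e i s)

  ==E⁺ : ∀ (a b : Exps N) → (∀ i s → a i s ≡ b i s) → a ==E b ≡ true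
  ==E⁺ a b e = allE⁺ _≡ᵇ_ a b (λ i s → ≡ᵇ⁺ (e i s))

leqE : ∀ {N} → Exps N → Exps N → Bool
leqE = allE _≤ᵇ_

allE-suc : ∀ {N} R (h b : Exps (suc N)) →
  allE R h b ≡ (R (h fz ⊕) (b fz ⊕) ∧ R (h fz ⊖) (b fz ⊖)) ∧ allE R (λ i → h (fs i)) (λ i → b (fs i))
allE-suc R h b = ⇔-≡
  (λ e → cong₂ _∧_ (cong₂ _∧_ (allE⁻ R h b e fz ⊕) (allE⁻ R h b e fz ⊖))
    (allE⁺ R (λ i → h (fs i)) (λ i → b (fs i)) (λ i s → allE⁻ R h b e (fs i) s)))
  (λ e → let (x , y) = ∧-split (R (h fz ⊕) (b fz ⊕) ∧ R (h fz ⊖) (b fz ⊖)) e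
             (x₁ , x₂) = ∧-split (R (h fz ⊕) (b fz ⊕)) x in
    allE⁺ R h b (λ { fz ⊕ → x₁ ; fz ⊖ → x₂ ; (fs i) s → allE⁻ R (λ i → h (fs i)) (λ i → b (fs i)) y i s }))

Σ-upTo-≡ᵇ : ∀ n b → Σℚ (upTo n) (λ p → 𝟙 (p ≡ᵇ b)) ≡ 𝟙 (b <ᵇ n)
Σ-upTo-≡ᵇ zero    b = refl
Σ-upTo-≡ᵇ (suc n) zero = trans (Σ-upTo-suc n (λ p → 𝟙 (p ≡ᵇ 0)))
  (trans (cong (1ℚ +ℚ_) (Σ-zero (upTo n))) (ℚₚ.+-identityʳ 1ℚ))
Σ-upTo-≡ᵇ (suc n) (suc b) = trans (Σ-upTo-suc n (λ p → 𝟙 (p ≡ᵇ suc b)))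
  (trans (cong (0ℚ +ℚ_) (Σ-upTo-≡ᵇ n b)) (ℚₚ.+-identityˡ (𝟙 (b <ᵇ n))))

Σ-upTo-≤ᵇ : ∀ a b → Σℚ (upTo (suc a)) (λ p → 𝟙 (p ≡ᵇ b)) ≡ 𝟙 (b ≤ᵇ a)
Σ-upTo-≤ᵇ a zero    = Σ-upTo-≡ᵇ (suc a) 0
Σ-upTo-≤ᵇ a (suc b) = Σ-upTo-≡ᵇ (suc a) (suc b)

-- As in `Σ-funs-suc`, quantifying over every `h` with the right values avoids naming the
-- pattern-matching lambda in `below`.
Σ-below-suc : ∀ N (a : Exps (suc N)) (F : Exps (suc N) → ℚ) (G : ℕ → ℕ → Exps N → ℚ) →
  (∀ h p q f → h fz ⊕ ≡ p → h fz ⊖ ≡ q → (∀ i s → h (fs i) s ≡ f i s) → F h ≡ G p q f) →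
  Σℚ (below (suc N) a) F ≡
  Σℚ (upTo (suc (a fz ⊕))) (λ p → Σℚ (upTo (suc (a fz ⊖))) (λ q → Σℚ (below N (λ i → a (fs i))) (G p q)))
Σ-below-suc N a F G e = trans
  (Σ-concatMap (λ p → concatMap (λ q → map (λ f → _) (below N (λ i → a (fs i)))) (upTo (suc (a fz ⊖)))) (upTo (suc (a fz ⊕))) F)
  (Σ-cong (upTo (suc (a fz ⊕))) (λ p →
    trans (Σ-concatMap (λ q → map (λ f → _) (below N (λ i → a (fs i)))) (upTo (suc (a fz ⊖))) F)
      (Σ-cong (upTo (suc (a fz ⊖))) (λ q →
        trans (Σ-map _ (below N (λ i → a (fs i))) F) (Σ-cong (below N (λ i → a (fs i))) (λ f →
          e _ p q f refl refl (λ _ _ → refl)))))))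

Σ-below-== : ∀ N (a b : Exps N) → Σℚ (below N a) (λ a₁ → 𝟙 (a₁ ==E b)) ≡ 𝟙 (leqE b a)
Σ-below-== zero    a b = refl
Σ-below-== (suc N) a b = begin
  _ ≡⟨ Σ-below-suc N a (λ a₁ → 𝟙 (a₁ ==E b)) (λ p q f → (𝟙 (p ≡ᵇ b fz ⊕) *ℚ 𝟙 (q ≡ᵇ b fz ⊖)) *ℚ 𝟙 (f ==E b₊)) split ⟩
  Σℚ ps (λ p → Σℚ qs (λ q → Σℚ (below N a₊) (λ f → (𝟙 (p ≡ᵇ b fz ⊕) *ℚ 𝟙 (q ≡ᵇ b fz ⊖)) *ℚ 𝟙 (f ==E b₊))))
    ≡⟨ Σ-cong ps (λ p → Σ-cong qs (λ q → trans (Σ-*ˡ (below N a₊) (𝟙 (p ≡ᵇ b fz ⊕) *ℚ 𝟙 (q ≡ᵇ b fz ⊖)) (λ f → 𝟙 (f ==E b₊)))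
         (cong ((𝟙 (p ≡ᵇ b fz ⊕) *ℚ 𝟙 (q ≡ᵇ b fz ⊖)) *ℚ_) (Σ-below-== N a₊ b₊)))) ⟩
  Σℚ ps (λ p → Σℚ qs (λ q → (𝟙 (p ≡ᵇ b fz ⊕) *ℚ 𝟙 (q ≡ᵇ b fz ⊖)) *ℚ r))
    ≡⟨ Σ-cong ps (λ p → trans (Σ-*ʳ qs r (λ q → 𝟙 (p ≡ᵇ b fz ⊕) *ℚ 𝟙 (q ≡ᵇ b fz ⊖)))
         (cong (_*ℚ r) (trans (Σ-*ˡ qs (𝟙 (p ≡ᵇ b fz ⊕)) (λ q → 𝟙 (q ≡ᵇ b fz ⊖)))
           (cong (𝟙 (p ≡ᵇ b fz ⊕) *ℚ_) (Σ-upTo-≤ᵇ (a fz ⊖) (b fz ⊖)))))) ⟩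
  Σℚ ps (λ p → (𝟙 (p ≡ᵇ b fz ⊕) *ℚ 𝟙 (b fz ⊖ ≤ᵇ a fz ⊖)) *ℚ r)
    ≡⟨ trans (Σ-*ʳ ps r (λ p → 𝟙 (p ≡ᵇ b fz ⊕) *ℚ 𝟙 (b fz ⊖ ≤ᵇ a fz ⊖)))
         (cong (_*ℚ r) (trans (Σ-*ʳ ps (𝟙 (b fz ⊖ ≤ᵇ a fz ⊖)) (λ p → 𝟙 (p ≡ᵇ b fz ⊕)))
           (cong (_*ℚ 𝟙 (b fz ⊖ ≤ᵇ a fz ⊖)) (Σ-upTo-≤ᵇ (a fz ⊕) (b fz ⊕))))) ⟩
  (𝟙 (b fz ⊕ ≤ᵇ a fz ⊕) *ℚ 𝟙 (b fz ⊖ ≤ᵇ a fz ⊖)) *ℚ r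
    ≡⟨ trans (cong (_*ℚ r) (sym (𝟙-∧ (b fz ⊕ ≤ᵇ a fz ⊕) (b fz ⊖ ≤ᵇ a fz ⊖))))
         (sym (𝟙-∧ ((b fz ⊕ ≤ᵇ a fz ⊕) ∧ (b fz ⊖ ≤ᵇ a fz ⊖)) (leqE b₊ a₊))) ⟩
  𝟙 (((b fz ⊕ ≤ᵇ a fz ⊕) ∧ (b fz ⊖ ≤ᵇ a fz ⊖)) ∧ leqE b₊ a₊) ≡⟨ cong 𝟙 (allE-suc _≤ᵇ_ b a) ⟨
  𝟙 (leqE b a) ∎
  where
  a₊ b₊ : Exps N
  a₊ i = a (fs i)
  b₊ i = b (fs i)
  ps qs : List ℕ
  ps = upTo (suc (a fz ⊕))
  qs = upTo (suc (a fz ⊖))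
  r : ℚ
  r = 𝟙 (leqE b₊ a₊)
  split : ∀ h p q f → h fz ⊕ ≡ p → h fz ⊖ ≡ q → (∀ i s → h (fs i) s ≡ f i s) →
    𝟙 (h ==E b) ≡ (𝟙 (p ≡ᵇ b fz ⊕) *ℚ 𝟙 (q ≡ᵇ b fz ⊖)) *ℚ 𝟙 (f ==E b₊)
  split h p q f refl refl e = begin
    𝟙 (h ==E b) ≡⟨ cong 𝟙 (allE-suc _≡ᵇ_ h b) ⟩
    𝟙 (((p ≡ᵇ b fz ⊕) ∧ (q ≡ᵇ b fz ⊖)) ∧ ((λ i → h (fs i)) ==E b₊))
      ≡⟨ trans (𝟙-∧ ((p ≡ᵇ b fz ⊕) ∧ (q ≡ᵇ b fz ⊖)) ((λ i → h (fs i)) ==E b₊))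
           (cong₂ _*ℚ_ (𝟙-∧ (p ≡ᵇ b fz ⊕) (q ≡ᵇ b fz ⊖)) (cong 𝟙 (⇔-≡
             (λ t → ==E⁺ f b₊ (λ i s → trans (sym (e i s)) (==E⁻ (λ i → h (fs i)) b₊ t i s)))
             (λ t → ==E⁺ (λ i → h (fs i)) b₊ (λ i s → trans (e i s) (==E⁻ f b₊ t i s)))))) ⟩
    (𝟙 (p ≡ᵇ b fz ⊕) *ℚ 𝟙 (q ≡ᵇ b fz ⊖)) *ℚ 𝟙 (f ==E b₊) ∎

ExtensionalE : ∀ {N} → (Exps N → ℚ) → Set
ExtensionalE f = ∀ {a b} → (∀ i s → a i s ≡ b i s) → f a ≡ f b

-- Evaluates a convolution in which one factor is a monomial: it either divides the target monomial,
-- in one way, or contributes nothing.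
Σ-below : ∀ N (a b : Exps N) (f : Exps N → ℚ) → ExtensionalE f →
  Σℚ (below N a) (λ a₁ → 𝟙 (a₁ ==E b) *ℚ f a₁) ≡ 𝟙 (leqE b a) *ℚ f b
Σ-below N a b f ext = begin
  _ ≡⟨ Σ-cong (below N a) (λ a₁ → 𝟙-*-cong (a₁ ==E b) (λ e → ext (==E⁻ a₁ b e))) ⟩
  Σℚ (below N a) (λ a₁ → 𝟙 (a₁ ==E b) *ℚ f b) ≡⟨ Σ-*ʳ (below N a) (f b) (λ a₁ → 𝟙 (a₁ ==E b)) ⟩
  Σℚ (below N a) (λ a₁ → 𝟙 (a₁ ==E b)) *ℚ f b ≡⟨ cong (_*ℚ f b) (Σ-below-== N a b) ⟩
  𝟙 (leqE b a) *ℚ f b ∎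

module _ (k : ℕ) {N : ℕ} where

  -- At 1 this is the exponent vector of the cycle in the variables r, at `k` that of its power in
  -- the variables t.
  monomial : Col → Exps N
  monomial u i s = contribution k u (suc (toℕ i)) s

  inRange : Col → Bool
  inRange u = len (reduce k u) ≤ᵇ N

  private
    exps : List Col → Exps N
    exps v i s = exponents k v (suc (toℕ i)) s

  fits⁻ : ∀ v a → fits k v a ≡ true → (∀ i s → exps v i s ≡ a i s) × All (λ u → inRange u ≡ true) v
  fits⁻ v a e = let (x , y) = ∧-split (exps v ==E a) e in ==E⁻ (exps v) a x , and-map⁻ inRange y

  fits⁺ : ∀ v a → (∀ i s → exps v i s ≡ a i s) → All (λ u → inRange u ≡ true) v → fits k v a ≡ true
  fits⁺ v a x y = cong₂ _∧_ (==E⁺ (exps v) a x) (and-map⁺ inRange y)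

  fits-cong : ∀ v {a b : Exps N} → (∀ i s → a i s ≡ b i s) → fits k v a ≡ fits k v b
  fits-cong v {a} {b} e = ⇔-≡
    (λ t → let (x , y) = fits⁻ v a t in fits⁺ v b (λ i s → trans (x i s) (e i s)) y)
    (λ t → let (x , y) = fits⁻ v b t in fits⁺ v a (λ i s → trans (x i s) (sym (e i s))) y)

  exponents-↭ : ∀ {v v′} → v ↭ v′ → ∀ l ε → exponents k v l ε ≡ exponents k v′ l ε
  exponents-↭ ↭.refl         l ε = refl
  exponents-↭ (↭.prep x π)   l ε = cong (contribution k x l ε +_) (exponents-↭ π l ε)
  exponents-↭ {v′ = _ ∷ _ ∷ v′} (↭.swap x y π) l ε = trans (sym (ℕₚ.+-assoc cx cy _))
    (trans (cong₂ _+_ (ℕₚ.+-comm cx cy) (exponents-↭ π l ε)) (ℕₚ.+-assoc cy cx (exponents k v′ l ε)))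
    where
    cx = contribution k x l ε
    cy = contribution k y l ε
  exponents-↭ (↭.trans π ρ)  l ε = trans (exponents-↭ π l ε) (exponents-↭ ρ l ε)

  fits-↭ : ∀ (a : Exps N) {v v′} → v ↭ v′ → fits k v a ≡ fits k v′ a
  fits-↭ a {v} {v′} π = ⇔-≡ (transport π) (transport (↭.↭-sym π))
    where
    transport : ∀ {v v′} → v ↭ v′ → fits k v a ≡ true → fits k v′ a ≡ true
    transport {v} {v′} π e = let (x , y) = fits⁻ v a e in
      fits⁺ v′ a (λ i s → trans (sym (exponents-↭ π (suc (toℕ i)) s)) (x i s)) (All-resp-↭ π y)

  -- Removing a cycle divides the monomial by its share; `leqE` ensures that the truncated
  -- subtraction in `subE` is exact.
  fits-∷ : ∀ u v a → fits k (u ∷ v) a ≡ inRange u ∧ (leqE (monomial u) a ∧ fits k v (subE a (monomial u)))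
  fits-∷ u v a = ⇔-≡ to from
    where
    to : fits k (u ∷ v) a ≡ true → inRange u ∧ (leqE (monomial u) a ∧ fits k v (subE a (monomial u))) ≡ true
    to e with fits⁻ (u ∷ v) a e
    ... | x , (r ∷ y) = cong₂ _∧_ r (cong₂ _∧_
      (allE⁺ _≤ᵇ_ (monomial u) a (λ i s → ≤ᵇ⁺ (subst (monomial u i s ≤_) (x i s) (ℕₚ.m≤m+n (monomial u i s) (exps v i s)))))
      (fits⁺ v (subE a (monomial u)) (λ i s → trans (sym (ℕₚ.m+n∸m≡n (monomial u i s) (exps v i s)))
        (cong (_∸ monomial u i s) (x i s))) y))
    from : inRange u ∧ (leqE (monomial u) a ∧ fits k v (subE a (monomial u))) ≡ true → fits k (u ∷ v) a ≡ true
    from e =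
      let (r , e′) = ∧-split (inRange u) e
          (le , e″) = ∧-split (leqE (monomial u) a) e′
          (x , y) = fits⁻ v (subE a (monomial u)) e″
      in fits⁺ (u ∷ v) a (λ i s → trans (cong (monomial u i s +_) (x i s))
           (ℕₚ.m+[n∸m]≡n (≤ᵇ⁻ {monomial u i s} (allE⁻ _≤ᵇ_ (monomial u) a le i s)))) (r ∷ y)

-- The series Φ

≡ᵇ-comm : ∀ m n → (m ≡ᵇ n) ≡ (n ≡ᵇ m)
≡ᵇ-comm m n = ⇔-≡ (λ e → ≡ᵇ⁺ (sym (≡ᵇ⁻ m n e))) (λ e → ≡ᵇ⁺ (sym (≡ᵇ⁻ n m e)))

==S-comm : ∀ s t → (s ==S t) ≡ (t ==S s)
==S-comm s t = ⌊⌋-cong (s Signₚ.≟ t) (t Signₚ.≟ s) sym sym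

Σ-upTo-pick : ∀ n b (f : ℕ → ℚ) → Σℚ (upTo n) (λ p → 𝟙 (b ≡ᵇ p) *ℚ f p) ≡ 𝟙 (b <ᵇ n) *ℚ f b
Σ-upTo-pick n b f = begin
  _ ≡⟨ Σ-cong (upTo n) (λ p → trans (𝟙-*-cong (b ≡ᵇ p) (λ e → cong f (sym (≡ᵇ⁻ b p e))))
         (cong (λ t → 𝟙 t *ℚ f b) (≡ᵇ-comm b p))) ⟩
  Σℚ (upTo n) (λ p → 𝟙 (p ≡ᵇ b) *ℚ f b) ≡⟨ Σ-*ʳ (upTo n) (f b) (λ p → 𝟙 (p ≡ᵇ b)) ⟩
  Σℚ (upTo n) (λ p → 𝟙 (p ≡ᵇ b)) *ℚ f b ≡⟨ cong (_*ℚ f b) (Σ-upTo-≡ᵇ n b) ⟩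
  𝟙 (b <ᵇ n) *ℚ f b ∎

if-𝟙 : ∀ b x → (if b then x else 0ℚ) ≡ 𝟙 b *ℚ x
if-𝟙 true  x = sym (ℚₚ.*-identityˡ x)
if-𝟙 false x = sym (ℚₚ.*-zeroˡ x)

-- The variables r record the element itself, so what is proved for powers applies to them at
-- exponent 1.
reduce-1 : ∀ u → reduce 1 u ≡ u
reduce-1 u@(l , ε) = cong₂ _,_ (cong pred cofactor≡) (trans (cong (ε ^s_) exponent≡) (Signₚ.*-identityʳ ε))
  where
  exponent≡ : exponent 1 u ≡ 1
  exponent≡ = ℕₚ.m*n≡1⇒m≡1 (exponent 1 u) (gcd (len u) 1) (sym (power-exponent 1 u))
  gcd≡ : gcd (len u) 1 ≡ 1
  gcd≡ = ℕₚ.m*n≡1⇒n≡1 (exponent 1 u) (gcd (len u) 1) (sym (power-exponent 1 u))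
  cofactor≡ : cofactor 1 u ≡ len u
  cofactor≡ = sym (trans (len-cofactor 1 u) (trans (cong (cofactor 1 u *_) gcd≡) (ℕₚ.*-identityʳ (cofactor 1 u))))

module _ {N : ℕ} where

  single : ℕ → Sign → ℕ → Exps N
  single j θ L i s = if (suc (toℕ i) ≡ᵇ j) ∧ (s ==S θ) then L else 0

  private
    cell : (j : ℕ) → Sign → (L : ℕ) → Sign → Exps N → Exps N → Fin N → Sign → Bool
    cell j θ L ε a c i s = (a i s ≡ᵇ single L ε L i s) ∧ (c i s ≡ᵇ single j θ L i s)
    cells : (j : ℕ) → Sign → (L : ℕ) → Sign → Exps N → Exps N → Fin N → Bool
    cells j θ L ε a c i = and (map (cell j θ L ε a c i) allSigns)

  isMono⁻ : ∀ j θ L ε (a c : Exps N) → isMono j θ L ε a c ≡ true →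
    (L ≤ᵇ N) ≡ true × (j ≤ᵇ N) ≡ true × (∀ i s → a i s ≡ single L ε L i s × c i s ≡ single j θ L i s)
  isMono⁻ j θ L ε a c e =
    let (x , e′) = ∧-split (L ≤ᵇ N) e
        (y , z)  = ∧-split (j ≤ᵇ N) e′
    in x , y , λ i s →
      let t = All.lookup (and-map⁻ (cell j θ L ε a c i) (All.lookup (and-map⁻ (cells j θ L ε a c) z) (∈-allFin i))) (∈-allSigns s)
          (t₁ , t₂) = ∧-split (a i s ≡ᵇ single L ε L i s) t
      in ≡ᵇ⁻ (a i s) _ t₁ , ≡ᵇ⁻ (c i s) _ t₂

  isMono⁺ : ∀ j θ L ε (a c : Exps N) → (L ≤ᵇ N) ≡ true → (j ≤ᵇ N) ≡ true →
    (∀ i s → a i s ≡ single L ε L i s × c i s ≡ single j θ L i s) → isMono j θ L ε a c ≡ true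
  isMono⁺ j θ L ε a c x y z = cong₂ _∧_ x (cong₂ _∧_ y (and-map⁺ (cells j θ L ε a c) {allFin N} (All.tabulate (λ {i} _ →
    and-map⁺ (cell j θ L ε a c i) {allSigns} (All.tabulate (λ {s} _ →
      cong₂ _∧_ (≡ᵇ⁺ (proj₁ (z i s))) (≡ᵇ⁺ (proj₂ (z i s)))))))))

  single-monomial : ∀ k u i s → single (len (reduce k u)) (proj₂ (reduce k u)) (len u) i s ≡ monomial k u i s
  single-monomial k u i s = cong (λ b → if b then len u else 0) (cong₂ _∧_
    (≡ᵇ-comm (suc (toℕ i)) (len (reduce k u))) (==S-comm s (proj₂ (reduce k u))))

  single-monomial-1 : ∀ u i s → single (len u) (proj₂ u) (len u) i s ≡ monomial 1 u i s
  single-monomial-1 u i s = trans (cong (λ x → single (len x) (proj₂ x) (len u) i s) (sym (reduce-1 u))) (single-monomial 1 u i s)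

  -- A cycle determines its term of Φ: `reduce k u` gives index and class of the variable t, `u`
  -- itself those of r.
  isTerm : ℕ → Exps N → Exps N → Col → Bool
  isTerm k a c u = isMono (len (reduce k u)) (proj₂ (reduce k u)) (len u) (proj₂ u) a c

  isTerm-≡ : ∀ k a c u → isTerm k a c u ≡
    (inRange 1 {N} u ∧ inRange k {N} u) ∧ ((a ==E monomial 1 u) ∧ (c ==E monomial k u))
  isTerm-≡ k a c u = ⇔-≡
    (λ e → let (x , y , z) = isMono⁻ _ _ _ _ a c e in cong₂ _∧_
      (cong₂ _∧_ (trans (cong (λ v → len v ≤ᵇ N) (reduce-1 u)) x) y)
      (cong₂ _∧_ (==E⁺ a (monomial 1 u) (λ i s → trans (proj₁ (z i s)) (single-monomial-1 u i s)))
                 (==E⁺ c (monomial k u) (λ i s → trans (proj₂ (z i s)) (single-monomial k u i s)))))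
    (λ e → let (r , m)   = ∧-split (inRange 1 {N} u ∧ inRange k {N} u) e
               (r₁ , r₂) = ∧-split (inRange 1 {N} u) r
               (m₁ , m₂) = ∧-split (a ==E monomial 1 u) m in
      isMono⁺ _ _ _ _ a c (trans (cong (λ v → len v ≤ᵇ N) (sym (reduce-1 u))) r₁) r₂
        (λ i s → trans (==E⁻ a (monomial 1 u) m₁ i s) (sym (single-monomial-1 u i s))
               , trans (==E⁻ c (monomial k u) m₂ i s) (sym (single-monomial k u i s))))

<ᵇ⁺ : ∀ {m n} → m < n → (m <ᵇ n) ≡ true
<ᵇ⁺ {m} {n} = ≤ᵇ⁺ {suc m} {n}

module _ (k : ℕ) (1≤k : 1 ≤ k) where

  private
    admissible : ℕ → ℕ → Bool
    admissible j h = ⌊ suc h ∣? k ⌋ ∧ (gcd (suc h) (suc j) ≡ᵇ 1)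
    L : ℕ → ℕ → ℕ
    L j h = suc j * k / suc h

  -- If k = g h and gcd (h, j) = 1 then gcd (j g, k) = g, so the pair (j , h) is
  -- recovered from the length j k / h of the cycle.
  admissible⇒ : ∀ j h → admissible j h ≡ true → ∃ λ l → L j h ≡ suc l ×
    (∀ ε → cofactor k (l , ε) ≡ suc j × exponent k (l , ε) ≡ suc h)
  admissible⇒ j h e with ∧-split ⌊ suc h ∣? k ⌋ e
  ... | e₁ , e₂ with ⌊⌋⁻ (suc h ∣? k) e₁
  ...   | divides zero    k≡0 = ⊥-elim (ℕₚ.<⇒≢ 1≤k (sym k≡0))
  ...   | divides g@(suc g₀) k≡ = g₀ + j * g , L≡ , λ ε → J≡ ε , H≡ ε
    where
    L≡ : L j h ≡ suc j * g
    L≡ = trans (cong (_/ suc h) (trans (cong (suc j *_) k≡) (sym (ℕₚ.*-assoc (suc j) g (suc h))))) (m*n/n≡m (suc j * g) (suc h))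
    u : Sign → Col
    u ε = g₀ + j * g , ε
    gcd≡ : ∀ ε → gcd (len (u ε)) k ≡ g
    gcd≡ ε = begin
      gcd (suc j * g) k               ≡⟨ cong₂ gcd (ℕₚ.*-comm (suc j) g) k≡ ⟩
      gcd (g * suc j) (g * suc h)     ≡⟨ c*gcd[m,n]≡gcd[cm,cn] g (suc j) (suc h) ⟨
      g * gcd (suc j) (suc h)         ≡⟨ cong (g *_) (trans (gcd-comm (suc j) (suc h)) (≡ᵇ⁻ (gcd (suc h) (suc j)) 1 e₂)) ⟩
      g * 1                           ≡⟨ ℕₚ.*-identityʳ g ⟩
      g                               ∎
    J≡ : ∀ ε → cofactor k (u ε) ≡ suc j
    J≡ ε = ℕₚ.*-cancelʳ-≡ (cofactor k (u ε)) (suc j) g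
      (trans (cong (cofactor k (u ε) *_) (sym (gcd≡ ε))) (sym (len-cofactor k (u ε))))
    H≡ : ∀ ε → exponent k (u ε) ≡ suc h
    H≡ ε = ℕₚ.*-cancelʳ-≡ (exponent k (u ε)) (suc h) g
      (trans (cong (exponent k (u ε) *_) (sym (gcd≡ ε))) (trans (sym (power-exponent k (u ε)))
        (trans k≡ (ℕₚ.*-comm g (suc h)))))

  ⇒admissible : ∀ j h l ε → cofactor k (l , ε) ≡ suc j → exponent k (l , ε) ≡ suc h →
    admissible j h ≡ true × L j h ≡ suc l
  ⇒admissible j h l ε J≡ H≡ =
    cong₂ _∧_ (⌊⌋⁺ (suc h ∣? k) (divides g k≡))
      (≡ᵇ⁺ (trans (gcd-comm (suc h) (suc j)) (trans (cong₂ gcd (sym J≡) (sym H≡)) (cofactor-coprime k u)))) ,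
    (begin
      suc j * k / suc h                ≡⟨ cong (λ x → suc j * x / suc h) k≡ ⟩
      suc j * (g * suc h) / suc h      ≡⟨ cong (_/ suc h) (sym (ℕₚ.*-assoc (suc j) g (suc h))) ⟩
      suc j * g * suc h / suc h        ≡⟨ m*n/n≡m (suc j * g) (suc h) ⟩
      suc j * g                        ≡⟨ cong (_* g) J≡ ⟨
      cofactor k u * g                 ≡⟨ len-cofactor k u ⟨
      suc l                            ∎)
    where
    u : Col
    u = l , ε
    g : ℕ
    g = gcd (len u) k
    k≡ : k ≡ g * suc h
    k≡ = trans (power-exponent k u) (trans (cong (_* g) H≡) (ℕₚ.*-comm (suc h) g))

  module _ {N : ℕ} (a c : Exps N) where

    private
      byLength : ℕ → ℚ
      byLength l = Σℚ allSigns (λ ε → 𝟙 (isTerm k a c (l , ε)) *ℚ weight (l , ε))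

      byFactors : ℕ → ℕ → ℚ
      byFactors j h = Σℚ allSigns (λ ε → 𝟙 (isMono (suc j) (ε ^s suc h) (L j h) ε a c) *ℚ inv (2 * L j h))

    -- The class θ must be `ε ^s suc h`, so the sum over θ has only one contributing term.
    Phi-byFactors : Phi k N a c ≡ Σℚ (upTo N) (λ j → Σℚ (upTo k) (λ h → 𝟙 (admissible j h) *ℚ byFactors j h))
    Phi-byFactors = Σ-cong (upTo N) (λ j → trans
      (Σ-swap allSigns (upTo k) (λ θ h → if admissible j h then Σℚ allSigns (λ ε →
         if (ε ^s suc h) ==S θ ∧ isMono (suc j) θ (L j h) ε a c then inv (2 * L j h) else 0ℚ) else 0ℚ))
      (Σ-cong (upTo k) (λ h → begin
        _ ≡⟨ Σ-cong allSigns (λ θ → trans (if-𝟙 (admissible j h) _) (cong (𝟙 (admissible j h) *ℚ_)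
               (Σ-cong allSigns (λ ε → trans (if-𝟙 ((ε ^s suc h) ==S θ ∧ isMono (suc j) θ (L j h) ε a c) (inv (2 * L j h)))
                 (trans (cong (_*ℚ inv (2 * L j h)) (𝟙-∧ ((ε ^s suc h) ==S θ) (isMono (suc j) θ (L j h) ε a c)))
                        (ℚₚ.*-assoc (𝟙 ((ε ^s suc h) ==S θ)) (𝟙 (isMono (suc j) θ (L j h) ε a c)) (inv (2 * L j h)))))))) ⟩
        Σℚ allSigns (λ θ → 𝟙 (admissible j h) *ℚ Σℚ allSigns (λ ε → 𝟙 ((ε ^s suc h) ==S θ) *ℚ t j h ε θ))
          ≡⟨ Σ-*ˡ allSigns (𝟙 (admissible j h)) (λ θ → Σℚ allSigns (λ ε → 𝟙 ((ε ^s suc h) ==S θ) *ℚ t j h ε θ)) ⟩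
        𝟙 (admissible j h) *ℚ Σℚ allSigns (λ θ → Σℚ allSigns (λ ε → 𝟙 ((ε ^s suc h) ==S θ) *ℚ t j h ε θ))
          ≡⟨ cong (𝟙 (admissible j h) *ℚ_) (trans
               (Σ-swap allSigns allSigns (λ θ ε → 𝟙 ((ε ^s suc h) ==S θ) *ℚ t j h ε θ))
               (Σ-cong allSigns (λ ε → Σ-signs-== (ε ^s suc h) (t j h ε)))) ⟩
        𝟙 (admissible j h) *ℚ byFactors j h ∎)))
      where
      t : ℕ → ℕ → Sign → Sign → ℚ
      t j h ε θ = 𝟙 (isMono (suc j) θ (L j h) ε a c) *ℚ inv (2 * L j h)

    -- A cycle longer than `N` needs a variable r that is absent from the monomials considered, so
    -- every cutoff from `N` on has the same effect.
    byLength-big : ∀ l n → N ≤ n → 𝟙 (l <ᵇ n) *ℚ byLength l ≡ byLength l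
    byLength-big l n N≤n with l <ᵇ n in e
    ... | true  = ℚₚ.*-identityˡ (byLength l)
    ... | false = trans (ℚₚ.*-zeroˡ (byLength l)) (sym (trans (Σ-cong allSigns vanish) (Σ-zero allSigns)))
      where
      vanish : ∀ ε → 𝟙 (isTerm k a c (l , ε)) *ℚ weight (l , ε) ≡ 0ℚ
      vanish ε with isTerm k a c (l , ε) in q
      ... | false = ℚₚ.*-zeroˡ (weight (l , ε))
      ... | true with isMono⁻ (len (reduce k (l , ε))) (proj₂ (reduce k (l , ε))) (suc l) ε a c q
      ...   | x , _ with trans (sym e) (<ᵇ⁺ {l} {n} (ℕₚ.≤-trans (≤ᵇ⁻ {suc l} x) N≤n))
      ...     | ()

    -- An admissible pair determines the length, and with it the reduced cycle, so its terms are
    -- those of the cycles of that length; a length beyond `M` has only zero terms.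
    byFactors-byLength : ∀ M → N ≤ M → ∀ j h → 𝟙 (admissible j h) *ℚ byFactors j h ≡
      Σℚ (upTo M) (λ l → 𝟙 (admissible j h ∧ (L j h ≡ᵇ suc l)) *ℚ byLength l)
    byFactors-byLength M N≤M j h with admissible j h in e
    ... | false = trans (ℚₚ.*-zeroˡ (byFactors j h)) (sym (trans (Σ-cong (upTo M) (λ l → ℚₚ.*-zeroˡ (byLength l))) (Σ-zero (upTo M))))
    ... | true with admissible⇒ j h e
    ...   | l , L≡ , JH = begin
      1ℚ *ℚ byFactors j h ≡⟨ ℚₚ.*-identityˡ (byFactors j h) ⟩
      byFactors j h ≡⟨ Σ-cong allSigns (λ ε → cong₂ _*ℚ_
          (cong 𝟙 (trans (cong (λ x → isMono (suc j) (ε ^s suc h) x ε a c) L≡)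
            (cong₂ (λ x θ → isMono x θ (suc l) ε a c) (sym (trans (len-reduce k (l , ε)) (proj₁ (JH ε)))) (cong (ε ^s_) (sym (proj₂ (JH ε)))))))
          (cong (λ x → inv (2 * x)) L≡)) ⟩
      byLength l ≡⟨ byLength-big l M N≤M ⟨
      𝟙 (l <ᵇ M) *ℚ byLength l ≡⟨ Σ-upTo-pick M l byLength ⟨
      Σℚ (upTo M) (λ l′ → 𝟙 (l ≡ᵇ l′) *ℚ byLength l′)
        ≡⟨ Σ-cong (upTo M) (λ l′ → cong (λ x → 𝟙 (x ≡ᵇ suc l′) *ℚ byLength l′) (sym L≡)) ⟩
      Σℚ (upTo M) (λ l′ → 𝟙 (L j h ≡ᵇ suc l′) *ℚ byLength l′) ∎

    -- The pair can only consist of cofactor and exponent of a cycle of length `suc l`; as divisors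
    -- of `suc l` and of `k` they lie within the ranges of summation.
    unique-factors : ∀ l → l < N →
      Σℚ (upTo N) (λ j → Σℚ (upTo k) (λ h → 𝟙 (admissible j h ∧ (L j h ≡ᵇ suc l)))) ≡ 1ℚ
    unique-factors l l<N = begin
      _ ≡⟨ Σ-cong (upTo N) (λ j → Σ-cong (upTo k) (λ h → trans (cong 𝟙 (equal j h)) (𝟙-∧ (j ≡ᵇ J₀) (h ≡ᵇ H₀)))) ⟩
      Σℚ (upTo N) (λ j → Σℚ (upTo k) (λ h → 𝟙 (j ≡ᵇ J₀) *ℚ 𝟙 (h ≡ᵇ H₀)))
        ≡⟨ Σ-cong (upTo N) (λ j → trans (Σ-*ˡ (upTo k) (𝟙 (j ≡ᵇ J₀)) (λ h → 𝟙 (h ≡ᵇ H₀)))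
             (cong (𝟙 (j ≡ᵇ J₀) *ℚ_) (trans (Σ-upTo-≡ᵇ k H₀) (cong 𝟙 (<ᵇ⁺ H₀<k))))) ⟩
      Σℚ (upTo N) (λ j → 𝟙 (j ≡ᵇ J₀) *ℚ 1ℚ)
        ≡⟨ trans (Σ-*ʳ (upTo N) 1ℚ (λ j → 𝟙 (j ≡ᵇ J₀))) (ℚₚ.*-identityʳ (Σℚ (upTo N) (λ j → 𝟙 (j ≡ᵇ J₀)))) ⟩
      Σℚ (upTo N) (λ j → 𝟙 (j ≡ᵇ J₀)) ≡⟨ trans (Σ-upTo-≡ᵇ N J₀) (cong 𝟙 (<ᵇ⁺ J₀<N)) ⟩
      1ℚ ∎
      where
      u : Col
      -- Cofactor and exponent depend on the length alone; the sign is an arbitrary choice.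
      u = l , ⊕
      J₀ H₀ : ℕ
      J₀ = pred (cofactor k u)
      H₀ = pred (exponent k u)
      J≡ : suc J₀ ≡ cofactor k u
      J≡ = len-reduce k u
      exponent≢0 : exponent k u ≢ 0
      exponent≢0 e = ℕₚ.<⇒≢ 1≤k (sym (trans (power-exponent k u) (cong (_* gcd (len u) k) e)))
      H≡ : suc H₀ ≡ exponent k u
      H≡ = ℕₚ.suc-pred (exponent k u) {{ℕ.≢-nonZero exponent≢0}}
      J₀<N : J₀ < N
      J₀<N = ℕₚ.≤-trans (∣⇒≤ (len-reduce-∣ k u)) l<N
      H₀<k : H₀ < k
      H₀<k = subst (_≤ k) (sym H≡) (∣⇒≤ {{ℕ.>-nonZero 1≤k}}
        (divides (gcd (len u) k) (trans (power-exponent k u) (ℕₚ.*-comm (exponent k u) (gcd (len u) k)))))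
      equal : ∀ j h → (admissible j h ∧ (L j h ≡ᵇ suc l)) ≡ (j ≡ᵇ J₀) ∧ (h ≡ᵇ H₀)
      equal j h = ⇔-≡ to from
        where
        to : admissible j h ∧ (L j h ≡ᵇ suc l) ≡ true → (j ≡ᵇ J₀) ∧ (h ≡ᵇ H₀) ≡ true
        to e with ∧-split (admissible j h) e
        ... | x , y with admissible⇒ j h x
        ...   | l′ , L≡ , JH with trans (sym L≡) (≡ᵇ⁻ (L j h) (suc l) y)
        ...     | refl = cong₂ _∧_ (≡ᵇ⁺ (cong pred (sym (proj₁ (JH ⊕))))) (≡ᵇ⁺ (cong pred (sym (proj₂ (JH ⊕)))))
        from : (j ≡ᵇ J₀) ∧ (h ≡ᵇ H₀) ≡ true → admissible j h ∧ (L j h ≡ᵇ suc l) ≡ true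
        from e =
          let (x , y) = ∧-split (j ≡ᵇ J₀) e
              (p , q) = ⇒admissible j h l ⊕
                (trans (sym J≡) (cong suc (sym (≡ᵇ⁻ j J₀ x)))) (trans (sym H≡) (cong suc (sym (≡ᵇ⁻ h H₀ y))))
          in cong₂ _∧_ p (≡ᵇ⁺ q)

    -- The bound `M` is left free because the recursion on sizes may need longer cycles than Φ
    -- itself has at `N`.
    Phi-colours : ∀ M → N ≤ M → Phi k N a c ≡ Σℚ (colours M) (λ u → weight u *ℚ 𝟙 (isTerm k a c u))
    Phi-colours M N≤M = begin
      _ ≡⟨ Phi-byFactors ⟩
      _ ≡⟨ Σ-cong (upTo N) (λ j → Σ-cong (upTo k) (λ h → byFactors-byLength M N≤M j h)) ⟩
      Σℚ (upTo N) (λ j → Σℚ (upTo k) (λ h → Σℚ (upTo M) (λ l → I j h l *ℚ byLength l)))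
        ≡⟨ Σ-cong (upTo N) (λ j → Σ-swap (upTo k) (upTo M) (λ h l → I j h l *ℚ byLength l)) ⟩
      Σℚ (upTo N) (λ j → Σℚ (upTo M) (λ l → Σℚ (upTo k) (λ h → I j h l *ℚ byLength l)))
        ≡⟨ Σ-swap (upTo N) (upTo M) (λ j l → Σℚ (upTo k) (λ h → I j h l *ℚ byLength l)) ⟩
      Σℚ (upTo M) (λ l → Σℚ (upTo N) (λ j → Σℚ (upTo k) (λ h → I j h l *ℚ byLength l)))
        ≡⟨ Σ-cong (upTo M) (λ l → trans (Σ-cong (upTo N) (λ j → Σ-*ʳ (upTo k) (byLength l) (λ h → I j h l)))
             (Σ-*ʳ (upTo N) (byLength l) (λ j → Σℚ (upTo k) (λ h → I j h l)))) ⟩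
      Σℚ (upTo M) (λ l → S l *ℚ byLength l)
        ≡⟨ Σ-cong (upTo M) absorb ⟩
      Σℚ (upTo M) byLength
        ≡⟨ Σ-cong (upTo M) (λ l → Σ-cong allSigns (λ ε → ℚₚ.*-comm (𝟙 (isTerm k a c (l , ε))) (weight (l , ε)))) ⟩
      _ ≡⟨ Σ-colours M (λ u → weight u *ℚ 𝟙 (isTerm k a c u)) ⟨
      _ ∎
      where
      I : ℕ → ℕ → ℕ → ℚ
      I j h l = 𝟙 (admissible j h ∧ (L j h ≡ᵇ suc l))
      S : ℕ → ℚ
      S l = Σℚ (upTo N) (λ j → Σℚ (upTo k) (λ h → I j h l))
      -- `unique-factors` covers `l < N` only; beyond that `byLength l` is zero.
      absorb : ∀ l → S l *ℚ byLength l ≡ byLength l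
      absorb l = begin
        S l *ℚ byLength l                       ≡⟨ cong (S l *ℚ_) (byLength-big l N ℕₚ.≤-refl) ⟨
        S l *ℚ (𝟙 (l <ᵇ N) *ℚ byLength l)       ≡⟨ *-left-comm (S l) (𝟙 (l <ᵇ N)) (byLength l) ⟩
        𝟙 (l <ᵇ N) *ℚ (S l *ℚ byLength l)       ≡⟨ 𝟙-*-cong (l <ᵇ N) (λ e → trans
                                                     (cong (_*ℚ byLength l) (unique-factors l (≤ᵇ⁻ {suc l} e))) (ℚₚ.*-identityˡ (byLength l))) ⟩
        𝟙 (l <ᵇ N) *ℚ byLength l                ≡⟨ byLength-big l N ℕₚ.≤-refl ⟩
        byLength l                              ∎

-- Comparison of coefficients

module _ (k : ℕ) {N : ℕ} where

  -- The coefficient at `a`, `c` of the product of the monomials of the cycles in `v`.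
  coefficient : Exps N → Exps N → List Col → ℚ
  coefficient a c v = 𝟙 (fits 1 v a) *ℚ 𝟙 (fits k v c)

  coefficient-symmetric : ∀ a c → Symmetric (coefficient a c)
  coefficient-symmetric a c π = cong₂ (λ x y → 𝟙 x *ℚ 𝟙 y) (fits-↭ 1 a π) (fits-↭ k c π)

  coefficient-cong : ∀ v {a b c d : Exps N} → (∀ i s → a i s ≡ b i s) → (∀ i s → c i s ≡ d i s) →
    coefficient a c v ≡ coefficient b d v
  coefficient-cong v e f = cong₂ (λ x y → 𝟙 x *ℚ 𝟙 y) (fits-cong 1 v e) (fits-cong k v f)

  coefficient-∷ : ∀ a c u v → coefficient a c (u ∷ v) ≡
    𝟙 (inRange 1 {N} u ∧ inRange k {N} u) *ℚ (𝟙 (leqE (monomial 1 u) a) *ℚ (𝟙 (leqE (monomial k u) c) *ℚ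
      coefficient (subE a (monomial 1 u)) (subE c (monomial k u)) v))
  coefficient-∷ a c u v = begin
    𝟙 (fits 1 (u ∷ v) a) *ℚ 𝟙 (fits k (u ∷ v) c)
      ≡⟨ cong₂ _*ℚ_ (factor 1 a) (factor k c) ⟩
    (r₁ *ℚ (m₁ *ℚ f₁)) *ℚ (r₂ *ℚ (m₂ *ℚ f₂))
      ≡⟨ solve 6 (λ r₁ m₁ f₁ r₂ m₂ f₂ → (r₁ :* (m₁ :* f₁)) :* (r₂ :* (m₂ :* f₂)) :=
           (r₁ :* r₂) :* (m₁ :* (m₂ :* (f₁ :* f₂)))) refl r₁ m₁ f₁ r₂ m₂ f₂ ⟩
    (r₁ *ℚ r₂) *ℚ (m₁ *ℚ (m₂ *ℚ (f₁ *ℚ f₂)))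
      ≡⟨ cong (_*ℚ (m₁ *ℚ (m₂ *ℚ (f₁ *ℚ f₂)))) (𝟙-∧ (inRange 1 {N} u) (inRange k {N} u)) ⟨
    _ ∎
    where
    open +-*-Solver
    r₁ m₁ f₁ r₂ m₂ f₂ : ℚ
    r₁ = 𝟙 (inRange 1 {N} u)
    m₁ = 𝟙 (leqE (monomial 1 u) a)
    f₁ = 𝟙 (fits 1 v (subE a (monomial 1 u)))
    r₂ = 𝟙 (inRange k {N} u)
    m₂ = 𝟙 (leqE (monomial k u) c)
    f₂ = 𝟙 (fits k v (subE c (monomial k u)))
    factor : ∀ k (a : Exps N) → 𝟙 (fits k (u ∷ v) a) ≡
      𝟙 (inRange k {N} u) *ℚ (𝟙 (leqE (monomial k u) a) *ℚ 𝟙 (fits k v (subE a (monomial k u))))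
    factor k a = trans (cong 𝟙 (fits-∷ k u v a)) (trans (𝟙-∧ (inRange k {N} u) _)
      (cong (𝟙 (inRange k {N} u) *ℚ_) (𝟙-∧ (leqE (monomial k u) a) (fits k v (subE a (monomial k u))))))

isZeroE-== : ∀ {N} (a : Exps N) → isZeroE a ≡ (λ _ _ → 0) ==E a
isZeroE-== {N} a = cong and (map-cong (λ i → cong₂ _∧_ (≡ᵇ-comm (a i ⊕) 0) (≡ᵇ-comm (a i ⊖) 0)) (allFin N))

module _ (k : ℕ) (1≤k : 1 ≤ k) {N M : ℕ} (N≤M : N ≤ M) where

  -- Each cycle contributes one weighted monomial to Φ, so of all splittings of the exponents only
  -- the one at that monomial survives. `G` stands for the remaining power of Φ.
  mulS-Phi : ∀ (G : Exps N → Exps N → ℚ) →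
    (∀ {a b c d} → (∀ i s → a i s ≡ b i s) → (∀ i s → c i s ≡ d i s) → G a c ≡ G b d) → ∀ a c →
    Σℚ (below N a) (λ a₁ → Σℚ (below N c) (λ c₁ → Phi k N a₁ c₁ *ℚ G (subE a a₁) (subE c c₁))) ≡
    Σℚ (colours M) (λ u → weight u *ℚ (𝟙 (inRange 1 {N} u ∧ inRange k {N} u) *ℚ (𝟙 (leqE (monomial 1 u) a) *ℚ
      (𝟙 (leqE (monomial k u) c) *ℚ G (subE a (monomial 1 u)) (subE c (monomial k u))))))
  mulS-Phi G ext a c = begin
    _ ≡⟨ Σ-cong (below N a) (λ a₁ → Σ-cong (below N c) (λ c₁ → trans
           (cong (_*ℚ G (subE a a₁) (subE c c₁)) (Phi-colours k 1≤k a₁ c₁ M N≤M))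
           (trans (sym (Σ-*ʳ (colours M) (G (subE a a₁) (subE c c₁)) (λ u → weight u *ℚ 𝟙 (isTerm k a₁ c₁ u))))
                  (Σ-cong (colours M) (λ u → separate u a₁ c₁))))) ⟩
    Σℚ (below N a) (λ a₁ → Σℚ (below N c) (λ c₁ → Σℚ (colours M) (λ u → t u a₁ c₁)))
      ≡⟨ Σ-cong (below N a) (λ a₁ → Σ-swap (below N c) (colours M) (λ c₁ u → t u a₁ c₁)) ⟩
    Σℚ (below N a) (λ a₁ → Σℚ (colours M) (λ u → Σℚ (below N c) (λ c₁ → t u a₁ c₁)))
      ≡⟨ Σ-swap (below N a) (colours M) (λ a₁ u → Σℚ (below N c) (λ c₁ → t u a₁ c₁)) ⟩
    Σℚ (colours M) (λ u → Σℚ (below N a) (λ a₁ → Σℚ (below N c) (λ c₁ → t u a₁ c₁)))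
      ≡⟨ Σ-cong (colours M) collapse ⟩
    _ ∎
    where
    g : Col → Exps N → Exps N → ℚ
    g u a₁ c₁ = 𝟙 (c₁ ==E monomial k u) *ℚ G (subE a a₁) (subE c c₁)
    r : Col → ℚ
    r u = 𝟙 (inRange 1 {N} u ∧ inRange k {N} u)
    t : Col → Exps N → Exps N → ℚ
    t u a₁ c₁ = (weight u *ℚ r u) *ℚ (𝟙 (a₁ ==E monomial 1 u) *ℚ g u a₁ c₁)
    separate : ∀ u a₁ c₁ → (weight u *ℚ 𝟙 (isTerm k a₁ c₁ u)) *ℚ G (subE a a₁) (subE c c₁) ≡ t u a₁ c₁
    separate u a₁ c₁ = begin
      (weight u *ℚ 𝟙 (isTerm k a₁ c₁ u)) *ℚ x
        ≡⟨ cong (λ b → (weight u *ℚ b) *ℚ x) (trans (cong 𝟙 (isTerm-≡ k a₁ c₁ u))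
             (trans (𝟙-∧ (inRange 1 {N} u ∧ inRange k {N} u) _) (cong (r u *ℚ_) (𝟙-∧ (a₁ ==E monomial 1 u) (c₁ ==E monomial k u))))) ⟩
      (weight u *ℚ (r u *ℚ (p *ℚ q))) *ℚ x
        ≡⟨ solve 5 (λ w r p q x → (w :* (r :* (p :* q))) :* x := (w :* r) :* (p :* (q :* x))) refl (weight u) (r u) p q x ⟩
      t u a₁ c₁ ∎
      where
      open +-*-Solver
      p q x : ℚ
      p = 𝟙 (a₁ ==E monomial 1 u)
      q = 𝟙 (c₁ ==E monomial k u)
      x = G (subE a a₁) (subE c c₁)
    collapse : ∀ u → Σℚ (below N a) (λ a₁ → Σℚ (below N c) (λ c₁ → t u a₁ c₁)) ≡
      weight u *ℚ (r u *ℚ (𝟙 (leqE (monomial 1 u) a) *ℚ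
        (𝟙 (leqE (monomial k u) c) *ℚ G (subE a (monomial 1 u)) (subE c (monomial k u)))))
    collapse u = begin
      _ ≡⟨ Σ-cong (below N a) (λ a₁ → trans
             (Σ-*ˡ (below N c) (weight u *ℚ r u) (λ c₁ → 𝟙 (a₁ ==E monomial 1 u) *ℚ g u a₁ c₁))
             (cong ((weight u *ℚ r u) *ℚ_) (trans (Σ-*ˡ (below N c) (𝟙 (a₁ ==E monomial 1 u)) (g u a₁))
               (cong (𝟙 (a₁ ==E monomial 1 u) *ℚ_) (Σ-below N c (monomial k u) (λ c₁ → G (subE a a₁) (subE c c₁))
                 (λ e → ext (λ _ _ → refl) (λ i s → cong (c i s ∸_) (e i s)))))))) ⟩
      _ ≡⟨ Σ-*ˡ (below N a) (weight u *ℚ r u) (λ a₁ → 𝟙 (a₁ ==E monomial 1 u) *ℚ h a₁) ⟩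
      _ ≡⟨ cong ((weight u *ℚ r u) *ℚ_) (Σ-below N a (monomial 1 u) h
             (λ e → cong (𝟙 (leqE (monomial k u) c) *ℚ_) (ext (λ i s → cong (a i s ∸_) (e i s)) (λ _ _ → refl)))) ⟩
      (weight u *ℚ r u) *ℚ (𝟙 (leqE (monomial 1 u) a) *ℚ h (monomial 1 u))
        ≡⟨ ℚₚ.*-assoc (weight u) (r u) (𝟙 (leqE (monomial 1 u) a) *ℚ h (monomial 1 u)) ⟩
      _ ∎
      where
      h : Exps N → ℚ
      h a₁ = 𝟙 (leqE (monomial k u) c) *ℚ G (subE a a₁) (subE c (monomial k u))

  powS-Phi : ∀ m a c → powS (Phi k) m N a c ≡ wordSum M m (coefficient k a c)
  powS-Phi zero a c = begin
    𝟙 (isZeroE a ∧ isZeroE c)           ≡⟨ 𝟙-∧ (isZeroE a) (isZeroE c) ⟩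
    𝟙 (isZeroE a) *ℚ 𝟙 (isZeroE c)      ≡⟨ cong₂ (λ x y → 𝟙 x *ℚ 𝟙 y) (empty a) (empty c) ⟩
    coefficient k a c []                ∎
    where
    empty : ∀ (b : Exps N) → isZeroE b ≡ ((λ _ _ → 0) ==E b) ∧ true
    empty b = trans (isZeroE-== b) (sym (Data.Bool.Properties.∧-identityʳ ((λ _ _ → 0) ==E b)))
  powS-Phi (suc m) a c = begin
    _ ≡⟨ Σ-cong (below N a) (λ a₁ → Σ-cong (below N c) (λ c₁ →
           cong (Phi k N a₁ c₁ *ℚ_) (powS-Phi m (subE a a₁) (subE c c₁)))) ⟩
    _ ≡⟨ mulS-Phi (λ a c → wordSum M m (coefficient k a c))
           (λ e f → wordSum-cong M m (λ v _ → coefficient-cong k v e f)) a c ⟩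
    _ ≡⟨ Σ-cong (colours M) (λ u → cong (weight u *ℚ_) (sym (unfold u))) ⟩
    wordSum M (suc m) (coefficient k a c) ∎
    where
    unfold : ∀ u → wordSum M m (λ v → coefficient k a c (u ∷ v)) ≡
      𝟙 (inRange 1 {N} u ∧ inRange k {N} u) *ℚ (𝟙 (leqE (monomial 1 u) a) *ℚ (𝟙 (leqE (monomial k u) c) *ℚ
        wordSum M m (coefficient k (subE a (monomial 1 u)) (subE c (monomial k u)))))
    unfold u = begin
      _ ≡⟨ wordSum-cong M m (λ v _ → coefficient-∷ k a c u v) ⟩
      _ ≡⟨ wordSum-*ˡ M m r (λ v → p *ℚ (q *ℚ x v)) ⟩
      _ ≡⟨ cong (r *ℚ_) (wordSum-*ˡ M m p (λ v → q *ℚ x v)) ⟩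
      _ ≡⟨ cong (λ y → r *ℚ (p *ℚ y)) (wordSum-*ˡ M m q x) ⟩
      _ ∎
      where
      r p q : ℚ
      r = 𝟙 (inRange 1 {N} u ∧ inRange k {N} u)
      p = 𝟙 (leqE (monomial 1 u) a)
      q = 𝟙 (leqE (monomial k u) c)
      x : List Col → ℚ
      x = coefficient k (subE a (monomial 1 u)) (subE c (monomial k u))

-- Degrees of monomials and sizes of cycle lists

Σ-allFin-toℕ : ∀ n (f : ℕ → ℚ) → Σℚ (allFin n) (λ i → f (toℕ i)) ≡ Σℚ (upTo n) f
Σ-allFin-toℕ zero    f = refl
Σ-allFin-toℕ (suc n) f = trans (Σ-allFin-suc n (λ i → f (toℕ i)))
  (trans (cong (f 0 +ℚ_) (Σ-allFin-toℕ n (λ i → f (suc i)))) (sym (Σ-upTo-suc n f)))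

fromℕ-degE : ∀ {N} (a : Exps N) → fromℕ (degE a) ≡ Σℚ (allFin N) (λ i → Σℚ allSigns (λ s → fromℕ (a i s)))
fromℕ-degE {N} a = go (allFin N)
  where
  go : ∀ is → fromℕ (foldr _+_ 0 (map (λ i → a i ⊕ + a i ⊖) is)) ≡ Σℚ is (λ i → Σℚ allSigns (λ s → fromℕ (a i s)))
  go []       = refl
  go (i ∷ is) = trans (fromℕ-+ (a i ⊕ + a i ⊖) _) (cong₂ _+ℚ_
    (trans (fromℕ-+ (a i ⊕) (a i ⊖)) (cong (fromℕ (a i ⊕) +ℚ_) (sym (ℚₚ.+-identityʳ (fromℕ (a i ⊖)))))) (go is))

fromℕ-size : ∀ v → fromℕ (size v) ≡ Σℚ v (λ u → fromℕ (len u))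
fromℕ-size []      = refl
fromℕ-size (u ∷ v) = trans (fromℕ-+ (len u) (size v)) (cong (fromℕ (len u) +ℚ_) (fromℕ-size v))

-- A cycle in range contributes its length to exactly one variable, so the total degree counts the
-- letters. This bounds the sizes of the words that matter.
fits-degree : ∀ k {N} v (a : Exps N) → fits k v a ≡ true → size v ≡ degE a
fits-degree k {N} v a e = fromℕ-injective (sym (begin
  fromℕ (degE a)
    ≡⟨ fromℕ-degE a ⟩
  Σℚ (allFin N) (λ i → Σℚ allSigns (λ s → fromℕ (a i s)))
    ≡⟨ Σ-cong (allFin N) (λ i → Σ-cong allSigns (λ s →
         trans (cong fromℕ (sym (proj₁ fit i s))) (fromℕ-exponents k v (suc (toℕ i)) s))) ⟩
  Σℚ (allFin N) (λ i → Σℚ allSigns (λ s → Σℚ v (λ u → fromℕ (len u) *ℚ h i s u)))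
    ≡⟨ Σ-cong (allFin N) (λ i → Σ-swap allSigns v (λ s u → fromℕ (len u) *ℚ h i s u)) ⟩
  Σℚ (allFin N) (λ i → Σℚ v (λ u → Σℚ allSigns (λ s → fromℕ (len u) *ℚ h i s u)))
    ≡⟨ Σ-swap (allFin N) v (λ i u → Σℚ allSigns (λ s → fromℕ (len u) *ℚ h i s u)) ⟩
  Σℚ v (λ u → Σℚ (allFin N) (λ i → Σℚ allSigns (λ s → fromℕ (len u) *ℚ h i s u)))
    ≡⟨ Σ-congAll (All.map (λ {u} r → one u r) (proj₂ fit)) ⟩
  Σℚ v (λ u → fromℕ (len u))
    ≡⟨ fromℕ-size v ⟨
  fromℕ (size v) ∎))
  where
  fit : _
  fit = fits⁻ k v a e
  h : Fin N → Sign → Col → ℚ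
  h i s u = 𝟙 (hasType k (suc (toℕ i)) s u)
  one : ∀ u → inRange k {N} u ≡ true →
    Σℚ (allFin N) (λ i → Σℚ allSigns (λ s → fromℕ (len u) *ℚ h i s u)) ≡ fromℕ (len u)
  one u r = begin
    _ ≡⟨ Σ-cong (allFin N) (λ i → trans (Σ-*ˡ allSigns (fromℕ (len u)) (λ s → h i s u)) (cong (fromℕ (len u) *ℚ_) (begin
           Σℚ allSigns (λ s → h i s u)
             ≡⟨ Σ-cong allSigns (λ s → trans (cong 𝟙 (Data.Bool.Properties.∧-comm (l ≡ᵇ toℕ i) (ε ==S s))) (𝟙-∧ (ε ==S s) (l ≡ᵇ toℕ i))) ⟩
           Σℚ allSigns (λ s → 𝟙 (ε ==S s) *ℚ 𝟙 (l ≡ᵇ toℕ i))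
             ≡⟨ Σ-signs-== ε (λ _ → 𝟙 (l ≡ᵇ toℕ i)) ⟩
           𝟙 (l ≡ᵇ toℕ i) ∎))) ⟩
    Σℚ (allFin N) (λ i → fromℕ (len u) *ℚ 𝟙 (l ≡ᵇ toℕ i))
      ≡⟨ Σ-allFin-toℕ N (λ i → fromℕ (len u) *ℚ 𝟙 (l ≡ᵇ i)) ⟩
    Σℚ (upTo N) (λ i → fromℕ (len u) *ℚ 𝟙 (l ≡ᵇ i))
      ≡⟨ Σ-cong (upTo N) (λ i → ℚₚ.*-comm (fromℕ (len u)) (𝟙 (l ≡ᵇ i))) ⟩
    Σℚ (upTo N) (λ i → 𝟙 (l ≡ᵇ i) *ℚ fromℕ (len u))
      ≡⟨ Σ-upTo-pick N l (λ _ → fromℕ (len u)) ⟩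
    𝟙 (l <ᵇ N) *ℚ fromℕ (len u)
      ≡⟨ trans (cong (λ b → 𝟙 b *ℚ fromℕ (len u)) r) (ℚₚ.*-identityˡ (fromℕ (len u))) ⟩
    fromℕ (len u) ∎
    where
    l = proj₁ (reduce k u)
    ε = proj₂ (reduce k u)

-- Growing a cycle in place and growing it after a move to the front give permuted lists, which `F`
-- does not tell apart.
Σ-updateAt : ∀ {m} (xs : Vec Col m) (F : List Col → ℚ) → Symmetric F →
  Σℚ (allFin m) (λ c → fromℕ (len (lookup xs c)) *ℚ F (toList (updateAt xs c inc))) ≡
  Σℚ (picks (toList xs)) (λ p → fromℕ (len (proj₁ p)) *ℚ F (inc (proj₁ p) ∷ proj₂ p))
Σ-updateAt Vec.[] F s = refl
Σ-updateAt {suc m} (x Vec.∷ xs) F s = begin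
  _ ≡⟨ Σ-allFin-suc m (λ c → fromℕ (len (lookup (x Vec.∷ xs) c)) *ℚ F (toList (updateAt (x Vec.∷ xs) c inc))) ⟩
  _ ≡⟨ cong (fromℕ (len x) *ℚ F (inc x ∷ toList xs) +ℚ_) (trans
         (Σ-updateAt xs (λ v → F (x ∷ v)) (λ π → s (↭.prep x π)))
         (Σ-cong (picks (toList xs)) (λ p → cong (fromℕ (len (proj₁ p)) *ℚ_) (s (↭.swap x (inc (proj₁ p)) ↭.refl))))) ⟩
  _ ≡⟨ Σ-picks-∷ x (toList xs) (λ u r → fromℕ (len u) *ℚ F (inc u ∷ r)) ⟨
  _ ∎

cycles : {w : SMap n} → Cycles w → List Col
cycles C = toList (Cycles.cols C)

Σ-insertions : ∀ {w : SMap n} (C : Cycles w) (F : List Col → ℚ) → Symmetric F →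
  Σℚ (allPoints (suc n)) (λ p → F (cycles (insertCycles C p))) ≡ insertions F (cycles C)
Σ-insertions {n} C F s = begin
  _ ≡⟨ Σ-points (λ p → F (cycles (insertCycles C p))) ⟩
  _ ≡⟨ Σ-cong allSigns (λ ε → Σ-allFin-suc n (λ i → F (cycles (insertCycles C (ε , i))))) ⟩
  -- The sign of an insertion behind an old letter does not affect the cycle list, so `Z` occurs
  -- once for each sign; hence the factor 2 in `insertions`.
  Σℚ allSigns (λ ε → F ((0 , ε) ∷ cycles C) +ℚ Z)
    ≡⟨ Σ-+ allSigns (λ ε → F ((0 , ε) ∷ cycles C)) (λ _ → Z) ⟩
  fixed +ℚ (Z +ℚ (Z +ℚ 0ℚ))
    ≡⟨ cong (fixed +ℚ_) (trans (cong (Z +ℚ_) (ℚₚ.+-identityʳ Z)) (cong₂ _+ℚ_ Z≡ Z≡)) ⟩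
  fixed +ℚ (Z′ +ℚ Z′)
    ≡⟨ cong (fixed +ℚ_) (trans (sym (Σ-+ (picks (cycles C)) g g)) (Σ-cong (picks (cycles C)) (λ p → double (len (proj₁ p)) (F (inc (proj₁ p) ∷ proj₂ p))))) ⟩
  insertions F (cycles C) ∎
  where
  open Cycles C
  fixed Z Z′ : ℚ
  fixed = Σℚ allSigns (λ ε → F ((0 , ε) ∷ cycles C))
  Z = Σℚ (allFin n) (λ i → F (toList (updateAt cols (cl i) inc)))
  g : Col × List Col → ℚ
  g p = fromℕ (len (proj₁ p)) *ℚ F (inc (proj₁ p) ∷ proj₂ p)
  Z′ = Σℚ (picks (cycles C)) g
  Z≡ : Z ≡ Z′
  Z≡ = trans (Σ-cl 1 C (λ c → F (toList (updateAt cols c inc)))) (Σ-updateAt cols F s)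
  double : ∀ l x → fromℕ l *ℚ x +ℚ fromℕ l *ℚ x ≡ fromℕ (2 * l) *ℚ x
  double l x = trans (sym (ℚₚ.*-distribʳ-+ x (fromℕ l) (fromℕ l)))
    (cong (_*ℚ x) (trans (sym (fromℕ-+ l l)) (cong (λ y → fromℕ (l + y)) (sym (ℕₚ.+-identityʳ l)))))

-- This is 2^n n!, written as it grows by insertion: the new letter has `2 * suc n` possible
-- preimages.
order : ℕ → ℕ
order zero    = 1
order (suc n) = 2 * suc n * order n

order≢0 : ∀ n → order n ≢ 0
order≢0 zero    ()
order≢0 (suc n) = *-≢0 {2 * suc n} (λ ()) (order≢0 n)

module _ (M D : ℕ) where

  -- `F` has to vary because the induction passes to `insertions F`; the factor supplied by
  -- `expSum-insertions` is exactly the growth of the group order.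
  Σ-enum : ∀ n F → Symmetric F → n ≤ D → n ≤ M →
    Σℚ (enum n) (λ wC → F (cycles (proj₂ wC))) ≡ fromℕ (order n) *ℚ expSum M D (degreePart M D n F)
  Σ-enum zero F s _ _ = sym (trans (ℚₚ.*-identityˡ (expSum M D (degreePart M D 0 F))) (begin
    _ ≡⟨ Σ-upTo-suc D (λ m → inv (fact m) *ℚ wordSum M m (degreePart M D 0 F)) ⟩
    1ℚ *ℚ (1ℚ *ℚ F []) +ℚ Σℚ (upTo D) (λ m → inv (fact (suc m)) *ℚ wordSum M (suc m) (degreePart M D 0 F))
      -- Only the empty word has size 0.
      ≡⟨ cong₂ _+ℚ_ (trans (ℚₚ.*-identityˡ (1ℚ *ℚ F [])) (ℚₚ.*-identityˡ (F [])))
           (trans (Σ-cong (upTo D) (λ m → trans (cong (inv (fact (suc m)) *ℚ_) (trans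
              (wordSum-cong M (suc m) nonempty) (wordSum-zero M (suc m)))) (ℚₚ.*-zeroʳ (inv (fact (suc m)))))) (Σ-zero (upTo D))) ⟩
    F [] +ℚ 0ℚ ∎))
    where
    nonempty : ∀ {m} v → length v ≡ suc m → degreePart M D 0 F v ≡ 0ℚ
    nonempty (u ∷ v) _ = degreePart-big M D 0 F (u ∷ v) (s≤s z≤n)
  Σ-enum (suc n) F s n<D n<M = begin
    _ ≡⟨ Σ-enum-suc n (λ wC → F (cycles (proj₂ wC))) ⟩
    _ ≡⟨ Σ-cong (enum n) (λ wC → Σ-insertions (proj₂ wC) F s) ⟩
    _ ≡⟨ Σ-enum n (insertions F) (insertions-symmetric F s) (ℕₚ.<⇒≤ n<D) (ℕₚ.<⇒≤ n<M) ⟩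
    o *ℚ expSum M D (degreePart M D n (insertions F))
      ≡⟨ cong (o *ℚ_) (expSum-insertions M D n F s n<D n<M) ⟩
    o *ℚ (fromℕ (2 * suc n) *ℚ x)    ≡⟨ *-left-comm o (fromℕ (2 * suc n)) x ⟩
    fromℕ (2 * suc n) *ℚ (o *ℚ x)    ≡⟨ ℚₚ.*-assoc (fromℕ (2 * suc n)) o x ⟨
    (fromℕ (2 * suc n) *ℚ o) *ℚ x    ≡⟨ cong (_*ℚ x) (fromℕ-* (2 * suc n) (order n)) ⟨
    fromℕ (order (suc n)) *ℚ x       ∎
    where
    o x : ℚ
    o = fromℕ (order n)
    x = expSum M D (degreePart M D (suc n) F)

-- The order of B_n

Σ-ones : (xs : List A) → Σℚ xs (λ _ → 1ℚ) ≡ fromℕ (length xs)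
Σ-ones []       = refl
Σ-ones (x ∷ xs) = trans (cong (1ℚ +ℚ_) (Σ-ones xs)) (sym (fromℕ-+ 1 (length xs)))

length-enum : ∀ n → length (enum n) ≡ order n
length-enum zero    = refl
length-enum (suc n) = fromℕ-injective (begin
  _ ≡⟨ Σ-ones (enum (suc n)) ⟨
  _ ≡⟨ Σ-enum-suc n (λ _ → 1ℚ) ⟩
  _ ≡⟨ Σ-cong (enum n) (λ _ → trans points (sym (ℚₚ.*-identityʳ (fromℕ (2 * suc n))))) ⟩
  _ ≡⟨ Σ-*ˡ (enum n) (fromℕ (2 * suc n)) (λ _ → 1ℚ) ⟩
  _ ≡⟨ cong (fromℕ (2 * suc n) *ℚ_) (trans (Σ-ones (enum n)) (cong fromℕ (length-enum n))) ⟩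
  _ ≡⟨ fromℕ-* (2 * suc n) (order n) ⟨
  _ ∎)
  where
  x : ℚ
  x = fromℕ (suc n)
  points : Σℚ (allPoints (suc n)) (λ _ → 1ℚ) ≡ fromℕ (2 * suc n)
  points = begin
    _ ≡⟨ Σ-points {suc n} (λ _ → 1ℚ) ⟩
    _ ≡⟨ Σ-cong allSigns (λ _ → trans (Σ-ones (allFin (suc n))) (cong fromℕ (length-tabulate {n = suc n} id))) ⟩
    x +ℚ (x +ℚ fromℕ 0)   ≡⟨ cong (x +ℚ_) (fromℕ-+ (suc n) 0) ⟨
    x +ℚ fromℕ (suc n + 0) ≡⟨ fromℕ-+ (suc n) (suc n + 0) ⟨
    fromℕ (2 * suc n)     ∎

length-Bn : ∀ n → length (Bn n) ≡ order n
length-Bn n = fromℕ-injective (trans (sym (Σ-ones (Bn n))) (trans (Σ-Bn n (λ _ → 1ℚ) (λ _ → refl))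
  (trans (Σ-ones (enum n)) (cong fromℕ (length-enum n)))))

-- Sums over k-th powers and the final comparison

powM-Invertible : ∀ (w : SMap n) k → Invertible w → Invertible (powM w k)
powM-Invertible w k (invertible v l r) = invertible (powM v k) (cancel v w l) (cancel w v r)
  where
  undo : ∀ v w → v LeftInverseOf w → ∀ k p → iter v k (iter w k p) ≡ p
  undo v w l zero    p = refl
  undo v w l (suc k) p = begin
    app v (iter v k (app w (iter w k p))) ≡⟨ iter-comm v 1 k (app w (iter w k p)) ⟩
    iter v k (app v (app w (iter w k p))) ≡⟨ cong (iter v k) (leftInverse-app {v = v} {w} l (iter w k p)) ⟩
    iter v k (iter w k p)                 ≡⟨ undo v w l k p ⟩
    p                                     ∎
  cancel : ∀ v w → v LeftInverseOf w → powM v k LeftInverseOf powM w k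
  cancel v w l i = trans (app-powM v k (powM w k i))
    (trans (cong (iter v k) (powM-iter w k i)) (undo v w l k (⊕ , i)))

-- The power `y` is determined by `x` and is itself a signed bijection, so the pairs reduce to the
-- elements `x`, whose contribution depends on their cycles only.
Σ-roots : ∀ k n {N} (a c : Exps N) →
  fromℕ (count (λ xy → (powM (proj₁ xy) k ==M proj₂ xy) ∧ matches (proj₁ xy) a ∧ matches (proj₂ xy) c)
    (cartesianProduct (Bn n) (Bn n))) ≡
  Σℚ (enum n) (λ wC → coefficient k a c (cycles (proj₂ wC)))
Σ-roots k n a c = begin
  _ ≡⟨ fromℕ-count (λ xy → root (proj₁ xy) (proj₂ xy)) (cartesianProduct (Bn n) (Bn n)) ⟩
  _ ≡⟨ Σ-cartesianProduct (Bn n) (Bn n) (λ xy → 𝟙 (root (proj₁ xy) (proj₂ xy))) ⟩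
  Σℚ (Bn n) (λ x → Σℚ (Bn n) (λ y → 𝟙 (root x y)))
    ≡⟨ Σ-Bn n (λ x → Σℚ (Bn n) (λ y → 𝟙 (root x y))) (λ {x} {x′} e → Σ-cong (Bn n) (λ y →
         cong₂ (λ p q → 𝟙 (p ∧ q ∧ matches y c)) (==M-cong y (powM-cong k e)) (matches-cong a e))) ⟩
  Σℚ (enum n) (λ wC → Σℚ (Bn n) (λ y → 𝟙 (root (proj₁ wC) y)))
    ≡⟨ Σ-cong (enum n) (λ wC → at (proj₂ wC)) ⟩
  Σℚ (enum n) (λ wC → coefficient k a c (cycles (proj₂ wC))) ∎
  where
  root : SMap n → SMap n → Bool
  root x y = (powM x k ==M y) ∧ matches x a ∧ matches y c
  ==M-cong : ∀ {x x′ : SMap n} y → (∀ i → x i ≡ x′ i) → (x ==M y) ≡ (x′ ==M y)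
  ==M-cong y e = cong and (map-cong (λ i → cong (_==P y i) (e i)) (allFin n))
  at : ∀ {w : SMap n} (C : Cycles w) → Σℚ (Bn n) (λ y → 𝟙 (root w y)) ≡ coefficient k a c (cycles C)
  at {w} C = begin
    _ ≡⟨ Σ-cong (Bn n) (λ y → trans (𝟙-∧ (powM w k ==M y) (matches w a ∧ matches y c))
           (cong (𝟙 (powM w k ==M y) *ℚ_) (𝟙-∧ (matches w a) (matches y c)))) ⟩
    Σℚ (Bn n) (λ y → 𝟙 (powM w k ==M y) *ℚ (𝟙 (matches w a) *ℚ 𝟙 (matches y c)))
      ≡⟨ Σ-Bn-== n (powM w k) (powM-Invertible w k (Cycles⇒Invertible C)) (λ y → 𝟙 (matches w a) *ℚ 𝟙 (matches y c))
           (λ e → cong (λ b → 𝟙 (matches w a) *ℚ 𝟙 b) (matches-cong c e)) ⟩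
    𝟙 (matches w a) *ℚ 𝟙 (matches (powM w k) c)
      ≡⟨ cong₂ (λ p q → 𝟙 p *ℚ 𝟙 q) (matches-fits 1 C a) (matches-fits k C c) ⟩
    coefficient k a c (cycles C) ∎

theorem3p6 : (k : ℕ) → 1 ≤ k → LHS k ≋ RHS k
theorem3p6 k 1≤k N a c = begin
  Σℚ (upTo (suc D)) (λ n → Gn k n N a c)
    ≡⟨ Σ-upTo-cong (suc D) (λ { n (s≤s n≤D) → Gn≡ n n≤D }) ⟩
  Σℚ (upTo (suc D)) (λ n → Σℚ (upTo (suc D)) (λ m → inv (fact m) *ℚ wordSum M m (degreePart M D n X)))
    -- For a fixed number `m` of cycles, the degree parts then add up to all of `X`.
    ≡⟨ Σ-swap (upTo (suc D)) (upTo (suc D)) (λ n m → inv (fact m) *ℚ wordSum M m (degreePart M D n X)) ⟩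
  Σℚ (upTo (suc D)) (λ m → Σℚ (upTo (suc D)) (λ n → inv (fact m) *ℚ wordSum M m (degreePart M D n X)))
    ≡⟨ Σ-cong (upTo (suc D)) (λ m → trans
         (Σ-*ˡ (upTo (suc D)) (inv (fact m)) (λ n → wordSum M m (degreePart M D n X)))
         (cong (inv (fact m) *ℚ_) (trans (sym (wordSum-Σ M m (upTo (suc D)) (λ n → degreePart M D n X)))
           (trans (wordSum-cong M m (λ v _ → all-degrees v)) (sym (powS-Phi k 1≤k N≤M m a c)))))) ⟩
  Σℚ (upTo (suc D)) (λ m → inv (fact m) *ℚ powS (Phi k) m N a c) ∎
  where
  D M : ℕ
  D = degE a + degE c
  -- Large enough for both uses: at least `N` for the expansion of Φ, and at least every `n ≤ D` for
  -- the recursion.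
  M = N + D
  N≤M : N ≤ M
  N≤M = ℕₚ.m≤m+n N D
  X : List Col → ℚ
  X = coefficient k a c
  Gn≡ : ∀ n → n ≤ D → Gn k n N a c ≡ expSum M D (degreePart M D n X)
  Gn≡ n n≤D = begin
    _ ≡⟨ cong₂ _*ℚ_ (cong inv (length-Bn n)) (Σ-roots k n a c) ⟩
    inv (order n) *ℚ Σℚ (enum n) (λ wC → X (cycles (proj₂ wC)))
      ≡⟨ cong (inv (order n) *ℚ_) (Σ-enum M D n X (coefficient-symmetric k a c) n≤D (ℕₚ.≤-trans n≤D (ℕₚ.m≤n+m D N))) ⟩
    inv (order n) *ℚ (fromℕ (order n) *ℚ x) ≡⟨ ℚₚ.*-assoc (inv (order n)) (fromℕ (order n)) x ⟨
    (inv (order n) *ℚ fromℕ (order n)) *ℚ x ≡⟨ cong (_*ℚ x) (trans (ℚₚ.*-comm (inv (order n)) (fromℕ (order n))) (inv-inverse (order n) (order≢0 n))) ⟩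
    1ℚ *ℚ x ≡⟨ ℚₚ.*-identityˡ x ⟩
    x ∎
    where
    x : ℚ
    x = expSum M D (degreePart M D n X)
  -- A word whose r-exponents fit `a` has size `degE a ≤ D`, so its degree occurs in the sum; for
  -- any other word `X v` is zero.
  all-degrees : ∀ v → Σℚ (upTo (suc D)) (λ n → degreePart M D n X v) ≡ X v
  all-degrees v = trans (Σ-upTo-pick (suc D) (size v) (λ _ → X v)) bounded
    where
    bounded : 𝟙 (size v <ᵇ suc D) *ℚ X v ≡ X v
    bounded with fits 1 v a in e
    ... | true  = trans (cong (λ b → 𝟙 b *ℚ (1ℚ *ℚ 𝟙 (fits k v c))) (<ᵇ⁺ (s≤s (subst (_≤ D) (sym (fits-degree 1 v a e)) (ℕₚ.m≤m+n (degE a) (degE c))))))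
                        (ℚₚ.*-identityˡ (1ℚ *ℚ 𝟙 (fits k v c)))
    ... | false = trans (cong (𝟙 (size v <ᵇ suc D) *ℚ_) (ℚₚ.*-zeroˡ (𝟙 (fits k v c))))
                        (trans (ℚₚ.*-zeroʳ (𝟙 (size v <ᵇ suc D))) (sym (ℚₚ.*-zeroˡ (𝟙 (fits k v c)))))
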